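{- For all integers $n\geq 0$ and $m\geq 0$, $$B_{3,7}\left(4^{7m}n+\frac{4^{7m}-1}{3}\right)\equiv 3^m B_{3,7}(n)\pmod 7,$$ $$B_{3,7}\left(4^{7m+7}n+\frac{10\cdot 4^{7m+6}-1}{3}\right)\equiv 0\pmod 7.$$
   Context: For integers $l,m>1$, an $l$-regular partition is a partition none of whose parts is divisible by $l$. A $(l,m)$-regular bipartition of $n$ is a pair of partitions $(\lambda,\mu)$ such that the sum of all parts of $\lambda$ and $\mu$ is $n$, $\lambda$ is $l$-regular and $\mu$ is $m$-regular. $B_{l,m}(n)$ denotes the number of $(l,m)$-regular bipartitions of $n$; equivalently $\sum_{n\ge 0}B_{l,m}(n)q^n=\frac{f_lf_m}{f_1^2}$, where $f_k=\prod_{j\ge1}(1-q^{jk})$. -}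

module Defs where

open import Data.List.Base
  using (List; []; _∷_; length; filter; upTo; cartesianProduct; cartesianProductWith)
open import Data.List.Membership.Propositional using (_∈_)
open import Data.List.Membership.Propositional.Properties
  using (∈-cartesianProductWith⁺; ∈-cartesianProductWith⁻; ∈-cartesianProduct⁺;
         ∈-filter⁺; ∈-filter⁻; ∈-upTo⁺)
open import Data.List.Properties using (∷-injective)
open import Data.List.Relation.Unary.All as All using (All; []; _∷_; all?)
open import Data.List.Relation.Unary.AllPairs using ([]; _∷_)
open import Data.List.Relation.Unary.Any using (here; there)
open import Data.List.Relation.Unary.Linked using (Linked; linked?)
open import Data.List.Relation.Unary.Unique.Propositional using (Unique)
import Data.List.Relation.Unary.Unique.Propositional.Properties as Unique
open import Data.Nat.Base
  using (ℕ; zero; suc; _+_; _≤_; _≥_; _<_; _>_; ∣_-_∣; z≤n; s≤s)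
open import Data.Nat.Divisibility using (_∣_; _∤_; _∣?_)
open import Data.Nat.ListAction using (sum)
open import Data.Nat.Properties
  using (_≟_; _≥?_; _>?_; ≤-trans; ≤-reflexive; m≤m+n; m≤n+m; +-mono-≤)
open import Data.Product.Base using (_×_; _,_; proj₂)
open import Function.Bundles using (_⇔_; mk⇔)
open import Relation.Binary.PropositionalEquality.Core using (_≡_; _≢_; refl)
open import Relation.Nullary.Decidable using (¬?; _×-dec_)
open import Relation.Unary using (Decidable)

infix 4 _≡_[mod_]

_≡_[mod_] : ℕ → ℕ → ℕ → Set
a ≡ b [mod d ] = d ∣ ∣ a - b ∣

IsPartition : List ℕ → Set
IsPartition ps = Linked _≥_ ps × All (_> 0) ps

Regular : ℕ → List ℕ → Set
Regular l ps = All (l ∤_) ps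

IsRegularPartition : ℕ → List ℕ → Set
IsRegularPartition l ps = IsPartition ps × Regular l ps

IsRegularBipartition : (l m n : ℕ) → List ℕ × List ℕ → Set
IsRegularBipartition l m n (ps , qs) =
  IsRegularPartition l ps × IsRegularPartition m qs × sum ps + sum qs ≡ n

isRegularPartition? : ∀ l → Decidable (IsRegularPartition l)
isRegularPartition? l ps =
  (linked? _≥?_ ps ×-dec all? (_>? 0) ps) ×-dec all? (λ p → ¬? (l ∣? p)) ps

isRegularBipartition? : ∀ l m n → Decidable (IsRegularBipartition l m n)
isRegularBipartition? l m n (ps , qs) =
  isRegularPartition? l ps ×-dec isRegularPartition? m qs ×-dec (sum ps + sum qs ≟ n)

-- All lists of length at most k with entries at most b.
boundedLists : (k b : ℕ) → List (List ℕ)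
boundedLists zero    b = [] ∷ []
boundedLists (suc k) b = [] ∷ cartesianProductWith _∷_ (upTo (suc b)) (boundedLists k b)

-- A partition occurring in a bipartition of n has at most n parts, each at
-- most n, so the search space below loses nothing (see ∈-regularBipartitions).
regularBipartitions : (l m n : ℕ) → List (List ℕ × List ℕ)
regularBipartitions l m n =
  filter (isRegularBipartition? l m n)
         (cartesianProduct (boundedLists n n) (boundedLists n n))

B : (l m n : ℕ) → ℕ
B l m n = length (regularBipartitions l m n)

-- B l m n is the number of (l,m)-regular bipartitions of n: the list it
-- measures contains exactly these (∈-regularBipartitions), each of them once
-- (regularBipartitions-unique).

boundedLists-unique : ∀ k b → Unique (boundedLists k b)
boundedLists-unique zero    b = [] ∷ []
boundedLists-unique (suc k) b =
  All.tabulate []≢ ∷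
  Unique.cartesianProductWith⁺ _∷_ ∷-injective
    (Unique.upTo⁺ (suc b)) (boundedLists-unique k b)
  where
  []≢ : ∀ {xs} → xs ∈ cartesianProductWith _∷_ (upTo (suc b)) (boundedLists k b) → [] ≢ xs
  []≢ xs∈ refl with ∈-cartesianProductWith⁻ _∷_ (upTo (suc b)) (boundedLists k b) xs∈
  ... | _ , _ , _ , _ , ()

∈-boundedLists : ∀ {k b xs} → length xs ≤ k → All (_≤ b) xs → xs ∈ boundedLists k b
∈-boundedLists {zero}  z≤n         []             = here refl
∈-boundedLists {suc k} z≤n         []             = here refl
∈-boundedLists {suc k} (s≤s len≤k) (x≤b ∷ xs≤b) =
  there (∈-cartesianProductWith⁺ _∷_ (∈-upTo⁺ (s≤s x≤b)) (∈-boundedLists len≤k xs≤b))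

length≤sum : ∀ {ps} → All (_> 0) ps → length ps ≤ sum ps
length≤sum []            = z≤n
length≤sum (p>0 ∷ ps>0) = +-mono-≤ p>0 (length≤sum ps>0)

parts≤sum : ∀ ps → All (_≤ sum ps) ps
parts≤sum []       = []
parts≤sum (p ∷ ps) =
  m≤m+n p (sum ps) ∷ All.map (λ q≤ → ≤-trans q≤ (m≤n+m (sum ps) p)) (parts≤sum ps)

∈-boundedLists-partition : ∀ {ps n} → IsPartition ps → sum ps ≤ n → ps ∈ boundedLists n n
∈-boundedLists-partition {ps} (_ , ps>0) sum≤n =
  ∈-boundedLists (≤-trans (length≤sum ps>0) sum≤n)
                 (All.map (λ p≤ → ≤-trans p≤ sum≤n) (parts≤sum ps))

∈-regularBipartitions : ∀ l m n pq →
  pq ∈ regularBipartitions l m n ⇔ IsRegularBipartition l m n pq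
∈-regularBipartitions l m n pq@(ps , qs) = mk⇔
  (λ pq∈ → proj₂ (∈-filter⁻ (isRegularBipartition? l m n)
                            {xs = cartesianProduct (boundedLists n n) (boundedLists n n)} pq∈))
  (λ bip@((part-ps , _) , (part-qs , _) , sum≡n) →
    ∈-filter⁺ (isRegularBipartition? l m n)
      (∈-cartesianProduct⁺
        (∈-boundedLists-partition part-ps
          (≤-trans (m≤m+n (sum ps) (sum qs)) (≤-reflexive sum≡n)))
        (∈-boundedLists-partition part-qs
          (≤-trans (m≤n+m (sum qs) (sum ps)) (≤-reflexive sum≡n))))
      bip)

regularBipartitions-unique : ∀ l m n → Unique (regularBipartitions l m n)
regularBipartitions-unique l m n =
  Unique.filter⁺ (isRegularBipartition? l m n)
    (Unique.cartesianProduct⁺ (boundedLists-unique n n) (boundedLists-unique n n))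

{-# OPTIONS --safe #-}
module Submission where

open import Defs
open import Algebra.Bundles using (CommutativeRing)
import Algebra.Solver.Ring
open import Algebra.Solver.Ring.AlmostCommutativeRing
  using (fromCommutativeRing; _-Raw-AlmostCommutative⟶_)
open import Data.Bool.Base using (true; false; if_then_else_)
open import Data.Empty using (⊥; ⊥-elim)
open import Data.Integer.Base using (ℤ; +_; -[1+_]; 0ℤ; 1ℤ; -1ℤ; ∣_∣)
import Data.Integer.Base as ℤ hiding (+_)
import Data.Integer.Properties as ℤ
open import Algebra.Properties.AbelianGroup ℤ.+-0-abelianGroup using ()
  renaming (∙-cancelˡ to +ℤ-cancelˡ; ∙-cancelʳ to +ℤ-cancelʳ)
open import Data.Integer.Tactic.RingSolver using () renaming (solve-∀ to solve-∀ℤ)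
open import Data.List.Base
  using (List; []; _∷_; _++_; map; filter; length; applyUpTo; cartesianProduct)
open import Data.List.Membership.Propositional using (_∈_; _∉_)
open import Data.List.Membership.Propositional.Properties
  using (∈-map⁺; ∈-map⁻; ∈-++⁺ˡ; ∈-++⁺ʳ; ∈-++⁻; ∈-cartesianProduct⁺; ∈-∃++; ∈-applyUpTo⁺)
open import Data.List.Properties using (∷-injective)
open import Data.List.Relation.Unary.All as All using (All; []; _∷_)
import Data.List.Relation.Unary.All.Properties as All
open import Data.List.Relation.Unary.AllPairs using ([]; _∷_)
open import Data.List.Relation.Unary.Any using (here; there)
open import Data.List.Relation.Unary.Linked using (Linked; []; [-]; _∷_)
open import Data.List.Relation.Unary.Unique.Propositional using (Unique)
import Data.List.Relation.Unary.Unique.Propositional.Properties as Unique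
open import Data.Maybe.Base using (Maybe; just; nothing)
open import Data.Nat.Base
open import Data.Nat.Divisibility using (_∣_; _∤_; _∣?_; divides; ∣m+n∣m⇒∣n; m∣m*n; ∣⇒≤)
open import Data.Nat.DivMod using (m*n/n≡m)
open import Data.Nat.ListAction using (sum)
open import Data.Nat.Properties
open import Data.Nat.Tactic.RingSolver using () renaming (solve-∀ to solve-∀ℕ)
open import Data.Product.Base using (_×_; _,_; proj₁; proj₂; ∃)
open import Data.Product.Properties using (,-injective)
open import Data.Sum.Base using (_⊎_; inj₁; inj₂; [_,_]′)
open import Data.Sum.Properties using (inj₁-injective; inj₂-injective)
open import Data.Unit.Base using (⊤; tt)
open import Function.Base using (_∘_; case_of_; flip)
open import Function.Bundles using (_⇔_; mk⇔)
open import Level using (0ℓ)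
open import Relation.Binary.Bundles using (Setoid)
open import Relation.Binary.PropositionalEquality hiding (J)
import Relation.Binary.Reasoning.Setoid
open import Relation.Nullary using (Dec; yes; no; ¬_; does)
open import Relation.Nullary.Decidable using (_×-dec_; ¬?; does-⇔; dec-true; dec-false)

-- Since f₇ ≡ f₁⁷ (mod 7), the generating function of B 3 7 is F = f₁⁵ f₃
-- modulo 7. Up to powers of q, F and F° = f₁ f₃⁵ are modular forms spanning a
-- space stable under the Hecke operator T₂, which makes them satisfy
--   odd part of F   = q (4 F(q⁴) - 9 F°(q²)),
--   even part of F° = F(q²) + 4 q² F°(q⁴),
-- so that b(16 n + 5) ≡ - b(4 n + 1) - 16 b(n) and b(16 n + 13) ≡ - b(4 n + 3)
-- for the coefficients b of F. The polynomial z² + z + 16 has the double root 3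
-- modulo 7, so along N ↦ 4 N + 1 the coefficients are 3^j (α + j β), which is
-- multiplied by 3⁷ ≡ 3 after seven steps.
--
-- The two dissections reduce to the 2-dissections of f₃³ / f₁ (an instance of
-- Weierstrass' three-term theta relation) and of f₁³ f₆² / (f₂² f₃) (a
-- rearrangement of a sum over ℤ[√-3] using the units of ℤ[ω]). Both follow
-- from Jacobi's triple product by re-indexing double sums.

-- Everything rests on two relations between products over residues modulo 6, where `T` and `X` mix
-- parities while `t`, `g`, `x`, `f` are series in q²: T v = t X² x² with v = g² + q t²
-- (`relation-a`), and u = T³ X² t³ g² x² with u = g² - 3 q t² (`relation-b`). Up to factors that
-- are series in q², F is u² v and F° is u v², so their odd and even parts are read off polynomials
-- in g² and q t². Multiplying each relation by its conjugate under q ↦ -q removes `T` and `X` and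
-- identifies these parts as combinations of F and F° at q² and q⁴. The 3 in u arises because the
-- odd part of `K 1ℤ` is q E(q⁴) with E = 3 f₃³ / f₁: both series solve the same contracting
-- equation. Reducing modulo 7 from the outset costs nothing: only series with constant term 1 are
-- ever cancelled, and 2 is invertible, so parts of different parity can still be separated. For the
-- second congruence the iteration starts at 4 n + 3, where the first step is a mere change of sign;
-- this forces β = α, and the sixth step produces the factor 1 + 6 = 7.

infix 4 _≈₇_ _≋_ _≈[_]_

-- The quotient is kept as data: a congruence is proved by naming the multiple of 7, which leaves an
-- identity over ℤ.
record _≈₇_ (a b : ℤ) : Set where
  constructor differBy
  field
    quot : ℤ
    eq   : a ≡ b ℤ.+ + 7 ℤ.* quot

≈₇-reflexive : ∀ {a b} → a ≡ b → a ≈₇ b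
≈₇-reflexive {a} refl = differBy 0ℤ (lemma a)
  where
  lemma : ∀ a → a ≡ a ℤ.+ + 7 ℤ.* 0ℤ
  lemma = solve-∀ℤ

≈₇-refl : ∀ {a} → a ≈₇ a
≈₇-refl = ≈₇-reflexive refl

≈₇-sym : ∀ {a b} → a ≈₇ b → b ≈₇ a
≈₇-sym {b = b} (differBy k refl) = differBy (ℤ.- k) (lemma b k)
  where
  lemma : ∀ b k → b ≡ b ℤ.+ + 7 ℤ.* k ℤ.+ + 7 ℤ.* (ℤ.- k)
  lemma = solve-∀ℤ

≈₇-trans : ∀ {a b c} → a ≈₇ b → b ≈₇ c → a ≈₇ c
≈₇-trans {c = c} (differBy k refl) (differBy l refl) = differBy (k ℤ.+ l) (lemma c k l)
  where
  lemma : ∀ c k l → c ℤ.+ + 7 ℤ.* l ℤ.+ + 7 ℤ.* k ≡ c ℤ.+ + 7 ℤ.* (k ℤ.+ l)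
  lemma = solve-∀ℤ

+-cong₇ : ∀ {a b c d} → a ≈₇ b → c ≈₇ d → a ℤ.+ c ≈₇ b ℤ.+ d
+-cong₇ {b = b} {d = d} (differBy k refl) (differBy l refl) = differBy (k ℤ.+ l) (lemma b d k l)
  where
  lemma : ∀ b d k l → b ℤ.+ + 7 ℤ.* k ℤ.+ (d ℤ.+ + 7 ℤ.* l) ≡ b ℤ.+ d ℤ.+ + 7 ℤ.* (k ℤ.+ l)
  lemma = solve-∀ℤ

*-cong₇ : ∀ {a b c d} → a ≈₇ b → c ≈₇ d → a ℤ.* c ≈₇ b ℤ.* d
*-cong₇ {b = b} {d = d} (differBy k refl) (differBy l refl) =
  differBy (b ℤ.* l ℤ.+ k ℤ.* d ℤ.+ + 7 ℤ.* k ℤ.* l) (lemma b d k l)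
  where
  lemma : ∀ b d k l → (b ℤ.+ + 7 ℤ.* k) ℤ.* (d ℤ.+ + 7 ℤ.* l) ≡
          b ℤ.* d ℤ.+ + 7 ℤ.* (b ℤ.* l ℤ.+ k ℤ.* d ℤ.+ + 7 ℤ.* k ℤ.* l)
  lemma = solve-∀ℤ

-‿cong₇ : ∀ {a b} → a ≈₇ b → ℤ.- a ≈₇ ℤ.- b
-‿cong₇ {b = b} (differBy k refl) = differBy (ℤ.- k) (lemma b k)
  where
  lemma : ∀ b k → ℤ.- (b ℤ.+ + 7 ℤ.* k) ≡ ℤ.- b ℤ.+ + 7 ℤ.* (ℤ.- k)
  lemma = solve-∀ℤ

-- Power series, with coefficients read modulo 7

Series : Set
Series = ℕ → ℤ

record _≋_ (S T : Series) : Set where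
  constructor pointwise
  field
    _at_ : ∀ n → S n ≈₇ T n
open _≋_ public

-- Congruence modulo q^N. Infinite sums and products are handled through these truncations, where
-- they become finite.
record _≈[_]_ (S : Series) (N : ℕ) (T : Series) : Set where
  constructor below
  field
    _at<_ : ∀ {n} → n < N → S n ≈₇ T n
open _≈[_]_ public

tail : Series → Series
tail S n = S (suc n)

infixl 6 _⊕_
infixl 7 _⊗_
infix  8 ⊝_

_⊕_ : Series → Series → Series
(S ⊕ T) n = S n ℤ.+ T n

⊝_ : Series → Series
(⊝ S) n = ℤ.- S n

_⊗_ : Series → Series → Series
(S ⊗ T) zero    = S 0 ℤ.* T 0
(S ⊗ T) (suc n) = S 0 ℤ.* T (suc n) ℤ.+ (tail S ⊗ T) n

const : ℤ → Series
const c zero    = c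
const c (suc n) = 0ℤ

0ₛ 1ₛ : Series
0ₛ = const 0ℤ
1ₛ = const 1ℤ

≋-reflexive : ∀ {S T} → (∀ n → S n ≡ T n) → S ≋ T
≋-reflexive eq = pointwise λ n → ≈₇-reflexive (eq n)

≋⇒≈[] : ∀ {N S T} → S ≋ T → S ≈[ N ] T
≋⇒≈[] S≋T = below λ {n} _ → S≋T at n

≈[]⇒≋ : ∀ {S T} → (∀ N → S ≈[ N ] T) → S ≋ T
≈[]⇒≋ eq = pointwise λ n → eq (suc n) at< ≤-refl

≈[]-weaken : ∀ {M N S T} → M ≤ N → S ≈[ N ] T → S ≈[ M ] T
≈[]-weaken M≤N eq = below λ n<M → eq at< ≤-trans n<M M≤N

⊕-cong[] : ∀ {N S S′ T T′} → S ≈[ N ] S′ → T ≈[ N ] T′ → S ⊕ T ≈[ N ] S′ ⊕ T′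
⊕-cong[] p q = below λ n<N → +-cong₇ (p at< n<N) (q at< n<N)

⊝-cong[] : ∀ {N S S′} → S ≈[ N ] S′ → ⊝ S ≈[ N ] ⊝ S′
⊝-cong[] p = below λ n<N → -‿cong₇ (p at< n<N)

⊗-cong[] : ∀ {N S S′ T T′} → S ≈[ N ] S′ → T ≈[ N ] T′ → S ⊗ T ≈[ N ] S′ ⊗ T′
⊗-cong[] {N} p q = below λ {n} n<N →
  go n (λ k≤n → p at< ≤-<-trans k≤n n<N) (λ k≤n → q at< ≤-<-trans k≤n n<N)
  where
  go : ∀ {S S′ T T′} n → (∀ {k} → k ≤ n → S k ≈₇ S′ k) → (∀ {k} → k ≤ n → T k ≈₇ T′ k) →
       (S ⊗ T) n ≈₇ (S′ ⊗ T′) n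
  go zero    p q = *-cong₇ (p z≤n) (q z≤n)
  go (suc n) p q = +-cong₇ (*-cong₇ (p z≤n) (q ≤-refl))
                           (go n (p ∘ s≤s) (q ∘ m≤n⇒m≤1+n))

⊗-distribʳ-at : ∀ U S T n → ((S ⊕ T) ⊗ U) n ≡ (S ⊗ U ⊕ T ⊗ U) n
⊗-distribʳ-at U S T zero    = ℤ.*-distribʳ-+ (U 0) (S 0) (T 0)
⊗-distribʳ-at U S T (suc n) =
  trans (cong (ℤ._+_ ((S 0 ℤ.+ T 0) ℤ.* U (suc n))) (⊗-distribʳ-at U (tail S) (tail T) n))
        (lemma (S 0) (T 0) (U (suc n)) _ _)
  where
  lemma : ∀ s t u x y → (s ℤ.+ t) ℤ.* u ℤ.+ (x ℤ.+ y) ≡ s ℤ.* u ℤ.+ x ℤ.+ (t ℤ.* u ℤ.+ y)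
  lemma = solve-∀ℤ

-- The product recurses on its left factor, so commutativity needs the mirror recursion, which
-- splits off the last term of the convolution.
⊗-snoc : ∀ S T n → (S ⊗ T) (suc n) ≡ (S ⊗ tail T) n ℤ.+ S (suc n) ℤ.* T 0
⊗-snoc S T zero    = refl
⊗-snoc S T (suc n) =
  trans (cong (ℤ._+_ (S 0 ℤ.* T (suc (suc n)))) (⊗-snoc (tail S) T n)) (sym (ℤ.+-assoc (S 0 ℤ.* T (suc (suc n))) ((tail S ⊗ tail T) n) (S (suc (suc n)) ℤ.* T 0)))

⊗-comm-at : ∀ S T n → (S ⊗ T) n ≡ (T ⊗ S) n
⊗-comm-at S T zero    = ℤ.*-comm (S 0) (T 0)
⊗-comm-at S T (suc n) =
  trans (trans (cong₂ ℤ._+_ (ℤ.*-comm (S 0) (T (suc n))) (⊗-comm-at (tail S) T n))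
               (ℤ.+-comm (T (suc n) ℤ.* S 0) ((T ⊗ tail S) n)))
        (sym (⊗-snoc T S n))

⊗-scale : ∀ c S T n → ((λ k → c ℤ.* S k) ⊗ T) n ≡ c ℤ.* (S ⊗ T) n
⊗-scale c S T zero    = ℤ.*-assoc c (S 0) (T 0)
⊗-scale c S T (suc n) =
  trans (cong (ℤ._+_ (c ℤ.* S 0 ℤ.* T (suc n))) (⊗-scale c (tail S) T n)) (lemma c (S 0) (T (suc n)) _)
  where
  lemma : ∀ c s t x → c ℤ.* s ℤ.* t ℤ.+ c ℤ.* x ≡ c ℤ.* (s ℤ.* t ℤ.+ x)
  lemma = solve-∀ℤ

⊗-assoc-at : ∀ S T U n → ((S ⊗ T) ⊗ U) n ≡ (S ⊗ (T ⊗ U)) n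
⊗-assoc-at S T U zero    = ℤ.*-assoc (S 0) (T 0) (U 0)
⊗-assoc-at S T U (suc n) = begin
  S 0 ℤ.* T 0 ℤ.* U (suc n) ℤ.+ (tail (S ⊗ T) ⊗ U) n
    ≡⟨ cong (ℤ._+_ (S 0 ℤ.* T 0 ℤ.* U (suc n)))
            (⊗-distribʳ-at U (λ k → S 0 ℤ.* T (suc k)) (tail S ⊗ T) n) ⟩
  S 0 ℤ.* T 0 ℤ.* U (suc n) ℤ.+ (((λ k → S 0 ℤ.* T (suc k)) ⊗ U) n ℤ.+ ((tail S ⊗ T) ⊗ U) n)
    ≡⟨ cong₂ (λ x y → S 0 ℤ.* T 0 ℤ.* U (suc n) ℤ.+ (x ℤ.+ y))
             (⊗-scale (S 0) (tail T) U n) (⊗-assoc-at (tail S) T U n) ⟩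
  S 0 ℤ.* T 0 ℤ.* U (suc n) ℤ.+ (S 0 ℤ.* (tail T ⊗ U) n ℤ.+ (tail S ⊗ (T ⊗ U)) n)
    ≡⟨ lemma (S 0) (T 0) (U (suc n)) _ _ ⟩
  S 0 ℤ.* (T ⊗ U) (suc n) ℤ.+ (tail S ⊗ (T ⊗ U)) n ∎
  where
  open ≡-Reasoning
  lemma : ∀ s t u x y → s ℤ.* t ℤ.* u ℤ.+ (s ℤ.* x ℤ.+ y) ≡ s ℤ.* (t ℤ.* u ℤ.+ x) ℤ.+ y
  lemma = solve-∀ℤ

zeros-⊗ : ∀ S n → ((λ _ → 0ℤ) ⊗ S) n ≡ 0ℤ
zeros-⊗ S zero    = refl
zeros-⊗ S (suc n) = trans (ℤ.+-identityˡ _) (zeros-⊗ S n)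

const-⊗ : ∀ c S n → (const c ⊗ S) n ≡ c ℤ.* S n
const-⊗ c S zero    = refl
const-⊗ c S (suc n) = trans (cong (ℤ._+_ (c ℤ.* S (suc n))) (zeros-⊗ S n)) (ℤ.+-identityʳ _)

0ₛ-at : ∀ n → 0ₛ n ≡ 0ℤ
0ₛ-at zero    = refl
0ₛ-at (suc n) = refl

seriesRing : CommutativeRing 0ℓ 0ℓ
seriesRing = record
  { Carrier = Series ; _≈_ = _≋_ ; _+_ = _⊕_ ; _*_ = _⊗_ ; -_ = ⊝_ ; 0# = 0ₛ ; 1# = 1ₛ
  ; isCommutativeRing = record
    { isRing = record
      { +-isAbelianGroup = record
        { isGroup = record
          { isMonoid = record
            { isSemigroup = record
              { isMagma = record
                { isEquivalence = record
                  { refl  = pointwise λ _ → ≈₇-refl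
                  ; sym   = λ p → pointwise λ n → ≈₇-sym (p at n)
                  ; trans = λ p q → pointwise λ n → ≈₇-trans (p at n) (q at n)
                  }
                ; ∙-cong = λ p q → pointwise λ n → +-cong₇ (p at n) (q at n)
                }
              ; assoc = λ S T U → ≋-reflexive λ n → ℤ.+-assoc (S n) (T n) (U n)
              }
            ; identity = (λ S → ≋-reflexive λ n → trans (cong (ℤ._+ S n) (0ₛ-at n)) (ℤ.+-identityˡ _))
                       , (λ S → ≋-reflexive λ n → trans (cong (ℤ._+_ (S n)) (0ₛ-at n)) (ℤ.+-identityʳ _))
            }
          ; inverse = (λ S → ≋-reflexive λ n → trans (ℤ.+-inverseˡ (S n)) (sym (0ₛ-at n)))
                    , (λ S → ≋-reflexive λ n → trans (ℤ.+-inverseʳ (S n)) (sym (0ₛ-at n)))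
          ; ⁻¹-cong = λ p → pointwise λ n → -‿cong₇ (p at n)
          }
        ; comm = λ S T → ≋-reflexive λ n → ℤ.+-comm (S n) (T n)
        }
      ; *-cong = λ p q → ≈[]⇒≋ λ N → ⊗-cong[] (≋⇒≈[] p) (≋⇒≈[] q)
      ; *-assoc = λ S T U → ≋-reflexive (⊗-assoc-at S T U)
      ; *-identity = (λ S → ≋-reflexive (identityˡ S))
                   , (λ S → ≋-reflexive λ n → trans (⊗-comm-at S 1ₛ n) (identityˡ S n))
      ; distrib = (λ S T U → ≋-reflexive λ n →
                    trans (⊗-comm-at S (T ⊕ U) n)
                      (trans (⊗-distribʳ-at S T U n)
                             (cong₂ ℤ._+_ (⊗-comm-at T S n) (⊗-comm-at U S n))))
                , (λ S T U → ≋-reflexive (⊗-distribʳ-at S T U))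
      }
    ; *-comm = λ S T → ≋-reflexive (⊗-comm-at S T)
    }
  }
  where
  identityˡ : ∀ S n → (1ₛ ⊗ S) n ≡ S n
  identityˡ S n = trans (const-⊗ 1ℤ S n) (ℤ.*-identityˡ _)

module R = CommutativeRing seriesRing

open R public using () renaming
  (refl to ≋-refl; reflexive to ≡⇒≋; sym to ≋-sym; trans to ≋-trans; +-cong to ⊕-cong; *-cong to ⊗-cong; -‿cong to ⊝-cong)

truncated : ℕ → Setoid 0ℓ 0ℓ
truncated N = record
  { Carrier = Series ; _≈_ = _≈[ N ]_
  ; isEquivalence = record
    { refl  = below λ _ → ≈₇-refl
    ; sym   = λ p → below λ n<N → ≈₇-sym (p at< n<N)
    ; trans = λ p q → below λ n<N → ≈₇-trans (p at< n<N) (q at< n<N)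
    }
  }

module Trunc {N : ℕ} = Setoid (truncated N)
open Trunc public using () renaming (refl to ≈[]-refl; sym to ≈[]-sym; trans to ≈[]-trans)

-- Makes the integers the coefficients of the ring solver, so that numerals such as -3 or 9 are
-- evaluated inside identities between series.
const-morphism : CommutativeRing.rawRing ℤ.+-*-commutativeRing
                 -Raw-AlmostCommutative⟶ fromCommutativeRing seriesRing
const-morphism = record
  { ⟦_⟧    = const
  ; +-homo = λ a b → ≋-reflexive λ { zero → refl ; (suc n) → refl }
  ; *-homo = λ a b → ≋-reflexive λ n → sym (trans (const-⊗ a (const b) n) (*-const a b n))
  ; -‿homo = λ a → ≋-reflexive λ { zero → refl ; (suc n) → refl }
  ; 0-homo = ≋-refl
  ; 1-homo = ≋-refl
  }
  where
  *-const : ∀ a b n → a ℤ.* const b n ≡ const (a ℤ.* b) n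
  *-const a b zero    = refl
  *-const a b (suc n) = ℤ.*-zeroʳ a

const-≟ : ∀ a b → Maybe (const a ≋ const b)
const-≟ a b with a ℤ.≟ b
... | yes refl = just ≋-refl
... | no _     = nothing

module Solver = Algebra.Solver.Ring
  (CommutativeRing.rawRing ℤ.+-*-commutativeRing) (fromCommutativeRing seriesRing) const-morphism const-≟
open Solver public using (solve; _:=_; _:+_; _:*_; _:-_; :-_; _:^_; con)

module ≋-Reasoning = Relation.Binary.Reasoning.Setoid R.setoid
module ≈[]-Reasoning {N : ℕ} = Relation.Binary.Reasoning.Setoid (truncated N)

-- Powers of q and the substitutions q ↦ q² and q ↦ -q.

shift : Series → Series
shift S zero    = 0ℤ
shift S (suc n) = S n

shift-cong : ∀ {S T} → S ≋ T → shift S ≋ shift T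
shift-cong p = pointwise λ { zero → ≈₇-refl ; (suc n) → p at n }

shift-cong[] : ∀ {N S T} → S ≈[ N ] T → shift S ≈[ suc N ] shift T
shift-cong[] p = below λ { {zero} _ → ≈₇-refl ; {suc n} (s≤s n<N) → p at< n<N }

shift-⊗ : ∀ S T → shift S ⊗ T ≋ shift (S ⊗ T)
shift-⊗ S T = ≋-reflexive λ { zero → refl ; (suc n) → ℤ.+-identityˡ ((S ⊗ T) n) }

infix 9 q^_

q^_ : ℕ → Series
q^ zero  = 1ₛ
q^ suc k = shift (q^ k)

q^-+ : ∀ m n → q^ (m + n) ≋ q^ m ⊗ q^ n
q^-+ zero    n = ≋-sym (R.*-identityˡ (q^ n))
q^-+ (suc m) n = ≋-trans (shift-cong (q^-+ m n)) (≋-sym (shift-⊗ (q^ m) (q^ n)))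

q^≈0 : ∀ {N k} → N ≤ k → q^ k ≈[ N ] 0ₛ
q^≈0 {N} {k} N≤k = below λ {n} n<N → ≈₇-reflexive (trans (vanish k n (≤-trans n<N N≤k)) (sym (0ₛ-at n)))
  where
  vanish : ∀ k n → n < k → (q^ k) n ≡ 0ℤ
  vanish (suc k) zero    _         = refl
  vanish (suc k) (suc n) (s≤s n<k) = vanish k n n<k

q : Series
q = q^ 1

q-⊗ : ∀ S → q ⊗ S ≋ shift S
q-⊗ S = ≋-trans (shift-⊗ 1ₛ S) (shift-cong (R.*-identityˡ S))

-- S(q²)
dbl : Series → Series
dbl S zero          = S 0
dbl S (suc zero)    = 0ℤ
dbl S (suc (suc n)) = dbl (tail S) n

dbl-even : ∀ S n → dbl S (n + n) ≡ S n
dbl-even S zero    = refl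
dbl-even S (suc n) = trans (cong (tail (dbl S)) (+-suc n n)) (dbl-even (tail S) n)

dbl-odd : ∀ S n → dbl S (suc (n + n)) ≡ 0ℤ
dbl-odd S zero    = refl
dbl-odd S (suc n) = trans (cong (tail (tail (dbl S))) (+-suc n n)) (dbl-odd (tail S) n)

dbl-cong[] : ∀ {N S T} → S ≈[ N ] T → dbl S ≈[ N ] dbl T
dbl-cong[] p = below λ {n} n<N → go n (λ k≤n → p at< ≤-<-trans k≤n n<N)
  where
  go : ∀ {S T} n → (∀ {k} → k ≤ n → S k ≈₇ T k) → dbl S n ≈₇ dbl T n
  go zero          p = p z≤n
  go (suc zero)    p = ≈₇-refl
  go (suc (suc n)) p = go n (λ k≤n → p (s≤s (m≤n⇒m≤1+n k≤n)))

dbl-cong : ∀ {S T} → S ≋ T → dbl S ≋ dbl T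
dbl-cong p = ≈[]⇒≋ λ N → dbl-cong[] (≋⇒≈[] p)

dbl-⊕-at : ∀ S T n → dbl (S ⊕ T) n ≡ (dbl S ⊕ dbl T) n
dbl-⊕-at S T zero          = refl
dbl-⊕-at S T (suc zero)    = refl
dbl-⊕-at S T (suc (suc n)) = dbl-⊕-at (tail S) (tail T) n

dbl-⊕ : ∀ S T → dbl (S ⊕ T) ≋ dbl S ⊕ dbl T
dbl-⊕ S T = ≋-reflexive (dbl-⊕-at S T)

dbl-scale-at : ∀ c S n → dbl (λ k → c ℤ.* S k) n ≡ c ℤ.* dbl S n
dbl-scale-at c S zero          = refl
dbl-scale-at c S (suc zero)    = sym (ℤ.*-zeroʳ c)
dbl-scale-at c S (suc (suc n)) = dbl-scale-at c (tail S) n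

dbl-⊗ : ∀ S T → dbl (S ⊗ T) ≋ dbl S ⊗ dbl T
dbl-⊗ S T = ≋-reflexive (go S T)
  where
  open ≡-Reasoning
  go : ∀ S T n → dbl (S ⊗ T) n ≡ (dbl S ⊗ dbl T) n
  go S T zero          = refl
  go S T (suc zero)    = sym (trans (ℤ.+-identityʳ _) (ℤ.*-zeroʳ (S 0)))
  go S T (suc (suc n)) = begin
    dbl ((λ k → S 0 ℤ.* T (suc k)) ⊕ (tail S ⊗ T)) n
      ≡⟨ dbl-⊕-at (λ k → S 0 ℤ.* T (suc k)) (tail S ⊗ T) n ⟩
    dbl (λ k → S 0 ℤ.* T (suc k)) n ℤ.+ dbl (tail S ⊗ T) n
      ≡⟨ cong₂ ℤ._+_ (dbl-scale-at (S 0) (tail T) n) (go (tail S) T n) ⟩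
    S 0 ℤ.* dbl (tail T) n ℤ.+ (dbl (tail S) ⊗ dbl T) n
      ≡⟨ cong (ℤ._+_ (S 0 ℤ.* dbl (tail T) n)) (sym (ℤ.+-identityˡ _)) ⟩
    S 0 ℤ.* dbl (tail T) n ℤ.+ (0ℤ ℤ.+ (dbl (tail S) ⊗ dbl T) n) ∎

dbl²-⊗ : ∀ A B → dbl (dbl (A ⊗ B)) ≋ dbl (dbl A) ⊗ dbl (dbl B)
dbl²-⊗ A B = ≋-trans (dbl-cong (dbl-⊗ A B)) (dbl-⊗ (dbl A) (dbl B))

dbl-const : ∀ c → dbl (const c) ≋ const c
dbl-const c = ≋-reflexive λ { zero → refl ; (suc zero) → refl ; (suc (suc n)) → zeros n }
  where
  zeros : ∀ n → dbl (λ _ → 0ℤ) n ≡ 0ℤ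
  zeros zero          = refl
  zeros (suc zero)    = refl
  zeros (suc (suc n)) = zeros n

dbl-q^ : ∀ k → dbl (q^ k) ≋ q^ (k + k)
dbl-q^ zero    = dbl-const 1ℤ
dbl-q^ (suc k) = ≋-trans (≋-reflexive λ { zero → refl ; (suc zero) → refl ; (suc (suc n)) → refl })
  (≋-trans (shift-cong (shift-cong (dbl-q^ k))) (≋-reflexive λ n → cong (λ j → (q^ suc j) n) (sym (+-suc k k))))

-- S(-q)
alt : Series → Series
alt S zero    = S 0
alt S (suc n) = ℤ.- alt (tail S) n

alt-cong[] : ∀ {N S T} → S ≈[ N ] T → alt S ≈[ N ] alt T
alt-cong[] p = below λ {n} n<N → go n (λ k≤n → p at< ≤-<-trans k≤n n<N)
  where
  go : ∀ {S T} n → (∀ {k} → k ≤ n → S k ≈₇ T k) → alt S n ≈₇ alt T n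
  go zero    p = p z≤n
  go (suc n) p = -‿cong₇ (go n (p ∘ s≤s))

alt-cong : ∀ {S T} → S ≋ T → alt S ≋ alt T
alt-cong p = ≈[]⇒≋ λ N → alt-cong[] (≋⇒≈[] p)

alt-⊕-at : ∀ S T n → alt (S ⊕ T) n ≡ (alt S ⊕ alt T) n
alt-⊕-at S T zero    = refl
alt-⊕-at S T (suc n) = trans (cong ℤ.-_ (alt-⊕-at (tail S) (tail T) n)) (ℤ.neg-distrib-+ (alt (tail S) n) (alt (tail T) n))

alt-⊕ : ∀ S T → alt (S ⊕ T) ≋ alt S ⊕ alt T
alt-⊕ S T = ≋-reflexive (alt-⊕-at S T)

alt-scale-at : ∀ c S n → alt (λ k → c ℤ.* S k) n ≡ c ℤ.* alt S n
alt-scale-at c S zero    = refl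
alt-scale-at c S (suc n) = trans (cong ℤ.-_ (alt-scale-at c (tail S) n)) (ℤ.neg-distribʳ-* c (alt (tail S) n))

neg-⊗-at : ∀ S T n → ((⊝ S) ⊗ T) n ≡ ℤ.- (S ⊗ T) n
neg-⊗-at S T zero    = sym (ℤ.neg-distribˡ-* (S 0) (T 0))
neg-⊗-at S T (suc n) =
  trans (cong₂ ℤ._+_ (sym (ℤ.neg-distribˡ-* (S 0) (T (suc n)))) (neg-⊗-at (tail S) T n))
        (sym (ℤ.neg-distrib-+ (S 0 ℤ.* T (suc n)) ((tail S ⊗ T) n)))

alt-⊗ : ∀ S T → alt (S ⊗ T) ≋ alt S ⊗ alt T
alt-⊗ S T = ≋-reflexive (go S T)
  where
  open ≡-Reasoning
  go : ∀ S T n → alt (S ⊗ T) n ≡ (alt S ⊗ alt T) n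
  go S T zero    = refl
  go S T (suc n) = begin
    ℤ.- alt ((λ k → S 0 ℤ.* T (suc k)) ⊕ (tail S ⊗ T)) n
      ≡⟨ cong ℤ.-_ (alt-⊕-at (λ k → S 0 ℤ.* T (suc k)) (tail S ⊗ T) n) ⟩
    ℤ.- (alt (λ k → S 0 ℤ.* T (suc k)) n ℤ.+ alt (tail S ⊗ T) n)
      ≡⟨ cong₂ (λ x y → ℤ.- (x ℤ.+ y)) (alt-scale-at (S 0) (tail T) n) (go (tail S) T n) ⟩
    ℤ.- (S 0 ℤ.* alt (tail T) n ℤ.+ (alt (tail S) ⊗ alt T) n)
      ≡⟨ ℤ.neg-distrib-+ (S 0 ℤ.* alt (tail T) n) ((alt (tail S) ⊗ alt T) n) ⟩
    ℤ.- (S 0 ℤ.* alt (tail T) n) ℤ.+ ℤ.- (alt (tail S) ⊗ alt T) n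
      ≡⟨ cong₂ ℤ._+_ (ℤ.neg-distribʳ-* (S 0) (alt (tail T) n)) (sym (neg-⊗-at (alt (tail S)) (alt T) n)) ⟩
    S 0 ℤ.* ℤ.- alt (tail T) n ℤ.+ ((⊝ alt (tail S)) ⊗ alt T) n ∎

alt-dbl : ∀ S → alt (dbl S) ≋ dbl S
alt-dbl S = ≋-reflexive (go S)
  where
  go : ∀ S n → alt (dbl S) n ≡ dbl S n
  go S zero          = refl
  go S (suc zero)    = refl
  go S (suc (suc n)) = trans (ℤ.neg-involutive _) (go (tail S) n)

alt-const : ∀ c → alt (const c) ≋ const c
alt-const c = ≋-trans (alt-cong (≋-sym (dbl-const c))) (≋-trans (alt-dbl (const c)) (dbl-const c))

alt-q^odd : ∀ k → alt (q^ suc (k + k)) ≋ ⊝ (q^ suc (k + k))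
alt-q^odd k = pointwise λ
  { zero    → ≈₇-refl
  ; (suc n) → -‿cong₇ (≋-trans (alt-cong (≋-sym (dbl-q^ k))) (≋-trans (alt-dbl (q^ k)) (dbl-q^ k)) at n)
  }

-- Cancellation of series with constant term 1.

Unit : Series → Set
Unit S = S 0 ≡ 1ℤ

⊗-unit : ∀ {S T} → Unit S → Unit T → Unit (S ⊗ T)
⊗-unit u v = cong₂ ℤ._*_ u v

-- Write S = 1 + X with X divisible by q. Then D = S D - X D, and if D vanishes modulo q^N, the
-- shift in X makes X D vanish modulo q^(N+1).
cancel-0[] : ∀ {S D} N → Unit S → S ⊗ D ≈[ N ] 0ₛ → D ≈[ N ] 0ₛ
cancel-0[] zero    unit eq = below λ ()
cancel-0[] {S} {D} (suc N) unit eq = begin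
  D                                          ≈⟨ ≋⇒≈[] (solve 2 (λ D X → D := (con 1ℤ :+ X) :* D :- X :* D) ≋-refl D X) ⟩
  (1ₛ ⊕ X) ⊗ D ⊕ ⊝ (X ⊗ D)
    ≈⟨ ⊕-cong[] (≋⇒≈[] (⊗-cong {y = S} (≋-sym S≋1+X) ≋-refl))
                (⊝-cong[] (≈[]-trans (≋⇒≈[] (shift-⊗ (tail S) D)) (shift-cong[] tailSD≈0))) ⟩
  S ⊗ D ⊕ ⊝ shift 0ₛ                         ≈⟨ ⊕-cong[] eq (⊝-cong[] (≋⇒≈[] shift0≋0)) ⟩
  0ₛ ⊕ ⊝ 0ₛ                                  ≈⟨ ≋⇒≈[] (R.-‿inverseʳ 0ₛ) ⟩
  0ₛ ∎
  where
  open ≈[]-Reasoning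
  X = shift (tail S)
  S≋1+X : S ≋ 1ₛ ⊕ X
  S≋1+X = ≋-reflexive λ { zero → trans unit refl ; (suc n) → sym (ℤ.+-identityˡ _) }
  tailSD≈0 : tail S ⊗ D ≈[ N ] 0ₛ
  tailSD≈0 = ≈[]-trans (⊗-cong[] ≈[]-refl (cancel-0[] N unit (≈[]-weaken (n≤1+n N) eq))) (≋⇒≈[] (R.zeroʳ (tail S)))
  shift0≋0 : shift 0ₛ ≋ 0ₛ
  shift0≋0 = ≋-reflexive λ { zero → refl ; (suc n) → 0ₛ-at n }

⊗-cancel[] : ∀ {N} S {D E} → Unit S → S ⊗ D ≈[ N ] S ⊗ E → D ≈[ N ] E
⊗-cancel[] {N} S {D} {E} unit eq = begin
  D              ≈⟨ ≋⇒≈[] (solve 2 (λ D E → D := (D :- E) :+ E) ≋-refl D E) ⟩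
  D ⊕ ⊝ E ⊕ E    ≈⟨ ⊕-cong[] (cancel-0[] N unit S[D-E]≈0) ≈[]-refl ⟩
  0ₛ ⊕ E         ≈⟨ ≋⇒≈[] (R.+-identityˡ E) ⟩
  E              ∎
  where
  open ≈[]-Reasoning
  S[D-E]≈0 : S ⊗ (D ⊕ ⊝ E) ≈[ N ] 0ₛ
  S[D-E]≈0 = begin
    S ⊗ (D ⊕ ⊝ E)     ≈⟨ ≋⇒≈[] (solve 3 (λ S D E → S :* (D :- E) := S :* D :- S :* E) ≋-refl S D E) ⟩
    S ⊗ D ⊕ ⊝ (S ⊗ E) ≈⟨ ⊕-cong[] eq ≈[]-refl ⟩
    S ⊗ E ⊕ ⊝ (S ⊗ E) ≈⟨ ≋⇒≈[] (R.-‿inverseʳ (S ⊗ E)) ⟩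
    0ₛ ∎

⊗-cancel : ∀ S {D E} → Unit S → S ⊗ D ≋ S ⊗ E → D ≋ E
⊗-cancel S unit eq = ≈[]⇒≋ λ N → ⊗-cancel[] S unit (≋⇒≈[] eq)

-- Infinite products

∏< : ℕ → (ℕ → Series) → Series
∏< zero    u = 1ₛ
∏< (suc n) u = ∏< n u ⊗ u n

∏<-cong[] : ∀ {N u v} n → (∀ i → u i ≈[ N ] v i) → ∏< n u ≈[ N ] ∏< n v
∏<-cong[] zero    p = ≈[]-refl
∏<-cong[] (suc n) p = ⊗-cong[] (∏<-cong[] n p) (p n)

∏<-cong : ∀ {u v} n → (∀ i → u i ≋ v i) → ∏< n u ≋ ∏< n v
∏<-cong n p = ≈[]⇒≋ λ N → ∏<-cong[] n (λ i → ≋⇒≈[] (p i))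

∏<-⊗ : ∀ u v n → ∏< n (λ i → u i ⊗ v i) ≋ ∏< n u ⊗ ∏< n v
∏<-⊗ u v zero    = ≋-sym (R.*-identityˡ 1ₛ)
∏<-⊗ u v (suc n) = ≋-trans (⊗-cong (∏<-⊗ u v n) ≋-refl)
  (solve 4 (λ a b c d → a :* b :* (c :* d) := a :* c :* (b :* d)) ≋-refl (∏< n u) (∏< n v) (u n) (v n))

∏<-+ : ∀ u m n → ∏< (m + n) u ≋ ∏< m u ⊗ ∏< n (λ i → u (m + i))
∏<-+ u m zero    = ≋-trans (≋-reflexive λ k → cong (λ j → ∏< j u k) (+-identityʳ m)) (≋-sym (R.*-identityʳ _))
∏<-+ u m (suc n) = ≋-trans (≋-reflexive λ k → cong (λ j → ∏< j u k) (+-suc m n))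
  (≋-trans (⊗-cong (∏<-+ u m n) ≋-refl) (R.*-assoc _ _ _))

∏<-blocks : ∀ u d N → ∏< (d * N) u ≋ ∏< d (λ r → ∏< N (λ i → u (r + d * i)))
∏<-blocks u d zero    = ≋-trans (≋-reflexive λ k → cong (λ j → ∏< j u k) (*-zeroʳ d)) (≋-sym (ones d))
  where
  ones : ∀ d → ∏< d (λ _ → 1ₛ) ≋ 1ₛ
  ones zero    = ≋-refl
  ones (suc d) = ≋-trans (R.*-identityʳ _) (ones d)
∏<-blocks u d (suc N) = begin
  ∏< (d * suc N) u                                        ≈⟨ (≋-reflexive λ k → cong (λ j → ∏< j u k) (trans (*-suc d N) (+-comm d (d * N)))) ⟩
  ∏< (d * N + d) u                                        ≈⟨ ∏<-+ u (d * N) d ⟩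
  ∏< (d * N) u ⊗ ∏< d (λ r → u (d * N + r))
    ≈⟨ ⊗-cong (∏<-blocks u d N) (∏<-cong d λ r → ≋-reflexive λ k → cong (λ j → u j k) (+-comm (d * N) r)) ⟩
  ∏< d (λ r → ∏< N (λ i → u (r + d * i))) ⊗ ∏< d (λ r → u (r + d * N)) ≈⟨ ≋-sym (∏<-⊗ _ _ d) ⟩
  ∏< d (λ r → ∏< (suc N) (λ i → u (r + d * i))) ∎
  where open ≋-Reasoning

Convergent : (ℕ → Series) → Set
Convergent u = ∀ i → u i ≈[ i ] 1ₛ

-- The coefficient of q^n is taken from the first n + 1 factors; under `Convergent` all later ones
-- are 1 modulo q^(n+1).
Π : (ℕ → Series) → Series
Π u n = ∏< (suc n) u n

∏<-stable : ∀ {u} → Convergent u → ∀ N k → ∏< (k + N) u ≈[ N ] ∏< N u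
∏<-stable     conv N zero    = ≈[]-refl
∏<-stable {u} conv N (suc k) = ≈[]-trans (⊗-cong[] (∏<-stable conv N k) (≈[]-weaken (m≤n+m N k) (conv (k + N))))
  (≋⇒≈[] (R.*-identityʳ (∏< N u)))

Π≈∏< : ∀ {u N M} → Convergent u → N ≤ M → Π u ≈[ N ] ∏< M u
Π≈∏< {u} {N} {M} conv N≤M = below λ {n} n<N →
  subst (λ j → Π u n ≈₇ ∏< j u n) (m∸n+n≡m (≤-trans n<N N≤M))
        (≈₇-sym (∏<-stable conv (suc n) (M ∸ suc n) at< ≤-refl))

Π-unique : ∀ {u S} → Convergent u → (∀ N → S ≈[ N ] ∏< N u) → S ≋ Π u
Π-unique conv p = ≈[]⇒≋ λ N → ≈[]-trans (p N) (≈[]-sym (Π≈∏< conv ≤-refl))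

Π-cong : ∀ {u v} → (∀ i → u i ≋ v i) → Π u ≋ Π v
Π-cong p = pointwise λ n → ∏<-cong (suc n) p at n

Π-unit : ∀ {u} → (∀ i → Unit (u i)) → Unit (Π u)
Π-unit {u} p = ⊗-unit {1ₛ} {u 0} refl (p 0)

convergent-⊗ : ∀ {u v} → Convergent u → Convergent v → Convergent (λ i → u i ⊗ v i)
convergent-⊗ cu cv i = ≈[]-trans (⊗-cong[] (cu i) (cv i)) (≋⇒≈[] (R.*-identityˡ 1ₛ))

Π-⊗ : ∀ {u v} → Convergent u → Convergent v → Π u ⊗ Π v ≋ Π (λ i → u i ⊗ v i)
Π-⊗ {u} {v} cu cv = Π-unique (convergent-⊗ cu cv) λ N →
  ≈[]-trans (⊗-cong[] (Π≈∏< cu ≤-refl) (Π≈∏< cv ≤-refl)) (≋⇒≈[] (≋-sym (∏<-⊗ u v N)))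

-- Factors are sorted by their index modulo d. Modulo q^N the first d N factors suffice on the left
-- and the first N of each class on the right.
Π-blocks : ∀ {u} → Convergent u → ∀ d .{{_ : NonZero d}} → Π u ≋ ∏< d (λ r → Π (λ i → u (r + d * i)))
Π-blocks {u} conv d = ≈[]⇒≋ λ N → ≈[]-trans (Π≈∏< conv (m≤n*m N d)) (≈[]-trans (≋⇒≈[] (∏<-blocks u d N))
  (∏<-cong[] d λ r → ≈[]-sym (Π≈∏< (λ i → ≈[]-weaken (≤-trans (m≤n*m i d) (m≤n+m (d * i) r)) (conv (r + d * i))) ≤-refl)))

-- q-Pochhammer products.

factor : ℤ → ℕ → Series
factor s k = 1ₛ ⊕ const s ⊗ q^ k

factor≈1 : ∀ s {N k} → N ≤ k → factor s k ≈[ N ] 1ₛ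
factor≈1 s N≤k = ≈[]-trans (⊕-cong[] {S = 1ₛ} ≈[]-refl (⊗-cong[] {S = const s} ≈[]-refl (q^≈0 N≤k)))
  (≋⇒≈[] (solve 1 (λ s → con 1ℤ :+ s :* con 0ℤ := con 1ℤ) ≋-refl (const s)))

factor-unit : ∀ s k → Unit (factor s (suc k))
factor-unit s k = cong (ℤ._+_ 1ℤ) (ℤ.*-zeroʳ s)

-- (-s q^k; q^m)_∞
poch : ℤ → ℕ → ℕ → Series
poch s k m = Π (λ i → factor s (k + m * i))

poch-conv : ∀ s k m .{{_ : NonZero m}} → Convergent (λ i → factor s (k + m * i))
poch-conv s k m i = factor≈1 s (≤-trans (m≤n*m i m) (m≤n+m (m * i) k))

poch-unit : ∀ s k m → Unit (poch s (suc k) m)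
poch-unit s k m = Π-unit {λ i → factor s (suc k + m * i)} (λ i → factor-unit s (k + m * i))

poch-blocks : ∀ s k m d .{{_ : NonZero m}} .{{_ : NonZero d}} →
              poch s k m ≋ ∏< d (λ r → poch s (k + m * r) (m * d))
poch-blocks s k m d = ≋-trans (Π-blocks (poch-conv s k m) d)
  (∏<-cong d λ r → Π-cong λ i → ≋-reflexive λ n → cong (λ j → factor s j n) (lemma k m r d i))
  where
  lemma : ∀ k m r d i → k + m * (r + d * i) ≡ k + m * r + m * d * i
  lemma = solve-∀ℕ

dbl-factor : ∀ s k → dbl (factor s k) ≋ factor s (k + k)
dbl-factor s k = ≋-trans (dbl-⊕ 1ₛ (const s ⊗ q^ k)) (⊕-cong (dbl-const 1ℤ)
  (≋-trans (dbl-⊗ (const s) (q^ k)) (⊗-cong (dbl-const s) (dbl-q^ k))))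

dbl-∏< : ∀ u n → dbl (∏< n u) ≋ ∏< n (dbl ∘ u)
dbl-∏< u zero    = dbl-const 1ℤ
dbl-∏< u (suc n) = ≋-trans (dbl-⊗ (∏< n u) (u n)) (⊗-cong (dbl-∏< u n) ≋-refl)

double-index : ∀ k m i → k + m * i + (k + m * i) ≡ k + k + (m + m) * i
double-index = solve-∀ℕ

dbl-poch : ∀ s k m .{{_ : NonZero m}} → dbl (poch s k m) ≋ poch s (k + k) (m + m)
dbl-poch s k m = ≋-trans (Π-unique conv λ N →
    ≈[]-trans (dbl-cong[] (Π≈∏< (poch-conv s k m) ≤-refl)) (≋⇒≈[] (dbl-∏< _ N)))
  (Π-cong λ i → ≋-trans (dbl-factor s (k + m * i)) (≋-reflexive λ n → cong (λ j → factor s j n) (double-index k m i)))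
  where
  conv : Convergent (λ i → dbl (factor s (k + m * i)))
  conv i = ≈[]-trans (dbl-cong[] (poch-conv s k m i)) (≋⇒≈[] (dbl-const 1ℤ))

alt-∏< : ∀ u n → alt (∏< n u) ≋ ∏< n (alt ∘ u)
alt-∏< u zero    = alt-const 1ℤ
alt-∏< u (suc n) = ≋-trans (alt-⊗ (∏< n u) (u n)) (⊗-cong (alt-∏< u n) ≋-refl)

-- An odd first exponent and an even step make all exponents odd, so q ↦ -q flips the sign in every
-- factor.
alt-poch-odd : ∀ s k m .{{_ : NonZero m}} → alt (poch s (suc (k + k)) (m + m)) ≋ poch (ℤ.- s) (suc (k + k)) (m + m)
alt-poch-odd s k m@(suc _) = ≋-trans (Π-unique conv λ N →
    ≈[]-trans (alt-cong[] (Π≈∏< (poch-conv s (suc (k + k)) (m + m)) ≤-refl)) (≋⇒≈[] (alt-∏< _ N)))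
  (Π-cong λ i → ≋-trans (alt-⊕ 1ₛ _) (⊕-cong (alt-const 1ℤ) (≋-trans (alt-⊗ (const s) _)
    (≋-trans (⊗-cong (alt-const s) (alt-odd i)) (sign (q^ (suc (k + k) + (m + m) * i)))))))
  where
  conv : Convergent (λ i → alt (factor s (suc (k + k) + (m + m) * i)))
  conv i = ≈[]-trans (alt-cong[] (poch-conv s (suc (k + k)) (m + m) i)) (≋⇒≈[] (alt-const 1ℤ))
  alt-odd : ∀ i → alt (q^ (suc (k + k) + (m + m) * i)) ≋ ⊝ (q^ (suc (k + k) + (m + m) * i))
  alt-odd i = subst (λ j → alt (q^ suc j) ≋ ⊝ (q^ suc j)) (double-index k m i) (alt-q^odd (k + m * i))
  sign : ∀ x → const s ⊗ ⊝ x ≋ const (ℤ.- s) ⊗ x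
  sign x = ≋-trans (solve 2 (λ s x → s :* :- x := (:- s) :* x) ≋-refl (const s) x)
                   (⊗-cong (≋-reflexive λ { zero → refl ; (suc n) → refl }) ≋-refl)

poch-squares : ∀ k m .{{_ : NonZero m}} → poch 1ℤ k m ⊗ poch -1ℤ k m ≋ poch -1ℤ (k + k) (m + m)
poch-squares k m = ≋-trans (Π-⊗ (poch-conv 1ℤ k m) (poch-conv -1ℤ k m)) (Π-cong λ i → begin
  factor 1ℤ (k + m * i) ⊗ factor -1ℤ (k + m * i)
    ≈⟨ solve 1 (λ x → (con 1ℤ :+ con 1ℤ :* x) :* (con 1ℤ :+ con -1ℤ :* x) := con 1ℤ :+ con -1ℤ :* (x :* x)) ≋-refl (q^ (k + m * i)) ⟩
  1ₛ ⊕ const -1ℤ ⊗ (q^ (k + m * i) ⊗ q^ (k + m * i))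
    ≈⟨ ⊕-cong {1ₛ} ≋-refl (⊗-cong {const -1ℤ} ≋-refl (≋-sym (q^-+ (k + m * i) (k + m * i)))) ⟩
  factor -1ℤ (k + m * i + (k + m * i))
    ≡⟨ cong (factor -1ℤ) (double-index k m i) ⟩
  factor -1ℤ (k + k + (m + m) * i) ∎)
  where open ≋-Reasoning

-- Finite sums and summable families of series.

private variable
  I J : Set

∑ : (I → Series) → List I → Series
∑ t []       = 0ₛ
∑ t (i ∷ is) = t i ⊕ ∑ t is

∑-cong[] : ∀ {N} {t u : I → Series} is → (∀ i → t i ≈[ N ] u i) → ∑ t is ≈[ N ] ∑ u is
∑-cong[] []       p = ≈[]-refl
∑-cong[] (i ∷ is) p = ⊕-cong[] (p i) (∑-cong[] is p)

∑-map : ∀ (t : J → Series) (f : I → J) is → ∑ t (map f is) ≋ ∑ (t ∘ f) is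
∑-map t f []       = ≋-refl
∑-map t f (i ∷ is) = ⊕-cong {t (f i)} ≋-refl (∑-map t f is)

∑-++ : ∀ (t : I → Series) is js → ∑ t (is ++ js) ≋ ∑ t is ⊕ ∑ t js
∑-++ t []       js = ≋-sym (R.+-identityˡ _)
∑-++ t (i ∷ is) js = ≋-trans (⊕-cong {t i} ≋-refl (∑-++ t is js)) (≋-sym (R.+-assoc (t i) (∑ t is) (∑ t js)))

∑-scale : ∀ c (t : I → Series) is → ∑ (λ i → c ⊗ t i) is ≋ c ⊗ ∑ t is
∑-scale c t []       = ≋-sym (R.zeroʳ c)
∑-scale c t (i ∷ is) = ≋-trans (⊕-cong {c ⊗ t i} ≋-refl (∑-scale c t is)) (≋-sym (R.distribˡ c (t i) (∑ t is)))

∑-cartesianProduct : ∀ (t : I → Series) (u : J → Series) is js →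
  ∑ (λ (i , j) → t i ⊗ u j) (cartesianProduct is js) ≋ ∑ t is ⊗ ∑ u js
∑-cartesianProduct t u []       js = ≋-sym (R.zeroˡ (∑ u js))
∑-cartesianProduct t u (i ∷ is) js = begin
  ∑ w (map (i ,_) js ++ cartesianProduct is js)            ≈⟨ ∑-++ w (map (i ,_) js) _ ⟩
  ∑ w (map (i ,_) js) ⊕ ∑ w (cartesianProduct is js)       ≈⟨ ⊕-cong (≋-trans (∑-map w (i ,_) js) (∑-scale (t i) u js)) (∑-cartesianProduct t u is js) ⟩
  t i ⊗ ∑ u js ⊕ ∑ t is ⊗ ∑ u js                           ≈⟨ R.distribʳ (∑ u js) (t i) (∑ t is) ⟨
  (t i ⊕ ∑ t is) ⊗ ∑ u js                                  ∎
  where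
  open ≋-Reasoning
  w : _ → Series
  w (i , j) = t i ⊗ u j

∑-remove : ∀ (t : I → Series) is {x} js → ∑ t (is ++ x ∷ js) ≋ t x ⊕ ∑ t (is ++ js)
∑-remove t is {x} js = begin
  ∑ t (is ++ x ∷ js)            ≈⟨ ∑-++ t is (x ∷ js) ⟩
  ∑ t is ⊕ (t x ⊕ ∑ t js)       ≈⟨ solve 3 (λ a b c → a :+ (b :+ c) := b :+ (a :+ c)) ≋-refl (∑ t is) (t x) (∑ t js) ⟩
  t x ⊕ (∑ t is ⊕ ∑ t js)       ≈⟨ ⊕-cong {t x} ≋-refl (∑-++ t is js) ⟨
  t x ⊕ ∑ t (is ++ js)          ∎
  where open ≋-Reasoning

unique-remove : ∀ is {x : I} {js} → Unique (is ++ x ∷ js) → x ∉ is ++ js × Unique (is ++ js)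
unique-remove []       (x∉ ∷ uniq)  = All.All¬⇒¬Any x∉ , uniq
unique-remove (i ∷ is) (i∉ ∷ uniq) with unique-remove is uniq | All.++⁻ is i∉
... | x∉ , uniq′ | i∉is , i≢x ∷ i∉js =
  (λ { (here refl) → i≢x refl ; (there x∈) → x∉ x∈ }) , All.++⁺ i∉is i∉js ∷ uniq′

∈-remove : ∀ is {x y : I} {js} → y ∈ is ++ x ∷ js → y ≡ x ⊎ y ∈ is ++ js
∈-remove is y∈ with ∈-++⁻ is y∈
... | inj₁ y∈is            = inj₂ (∈-++⁺ˡ y∈is)
... | inj₂ (here y≡x)      = inj₁ y≡x
... | inj₂ (there y∈js)    = inj₂ (∈-++⁺ʳ is y∈js)

∈-add : ∀ is {x y : I} {js} → y ∈ is ++ js → y ∈ is ++ x ∷ js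
∈-add is y∈ with ∈-++⁻ is y∈
... | inj₁ y∈is = ∈-++⁺ˡ y∈is
... | inj₂ y∈js = ∈-++⁺ʳ is (there y∈js)

-- Induction on `is`: a term known to vanish modulo q^N is dropped, any other is located in `js` and
-- cut out of it. Uniqueness of both lists keeps the remainders in correspondence.
∑-unique : ∀ {N} (t : I → Series) {is js} → Unique is → Unique js →
  (∀ {i} → i ∈ is → i ∈ js ⊎ t i ≈[ N ] 0ₛ) → (∀ {j} → j ∈ js → j ∈ is ⊎ t j ≈[ N ] 0ₛ) →
  ∑ t is ≈[ N ] ∑ t js
∑-unique t {[]} {[]} _ _ _ _ = ≈[]-refl
∑-unique t {[]} {j ∷ js} ui (_ ∷ uj) f g = case g (here refl) of λ where
  (inj₂ tj≈0) → ≈[]-trans (≈[]-trans (∑-unique t {[]} {js} ui uj (λ ()) (g ∘ there)) (≋⇒≈[] (≋-sym (R.+-identityˡ _))))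
                          (⊕-cong[] (≈[]-sym tj≈0) (≈[]-refl {x = ∑ t js}))
∑-unique {N = N} t {i ∷ is} {js} (i∉is ∷ ui) uj f g = case f (here refl) of λ where
    (inj₂ ti≈0) → ≈[]-trans (⊕-cong[] ti≈0 ≈[]-refl) (≈[]-trans (≋⇒≈[] (R.+-identityˡ _))
      (∑-unique t ui uj (f ∘ there) λ j∈js → case g j∈js of λ where
        (inj₁ (here refl))  → inj₂ ti≈0
        (inj₁ (there j∈is)) → inj₁ j∈is
        (inj₂ tj≈0)         → inj₂ tj≈0))
    (inj₁ i∈js) → matched i∈js
  where
  matched : i ∈ js → t i ⊕ ∑ t is ≈[ N ] ∑ t js
  matched i∈js with ∈-∃++ i∈js
  ... | as , bs , refl with unique-remove as uj
  ... | i∉ , uj′ = ≈[]-trans (⊕-cong[] (≈[]-refl {x = t i}) (∑-unique t ui uj′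
      (λ j∈is → case f (there j∈is) of λ where
        (inj₁ j∈) → case ∈-remove as j∈ of λ where
          (inj₁ refl) → ⊥-elim (All.All¬⇒¬Any i∉is j∈is)
          (inj₂ j∈′)  → inj₁ j∈′
        (inj₂ tj≈0) → inj₂ tj≈0)
      (λ j∈ → case g (∈-add as j∈) of λ where
        (inj₁ (here refl))  → ⊥-elim (i∉ j∈)
        (inj₁ (there j∈is)) → inj₁ j∈is
        (inj₂ tj≈0)         → inj₂ tj≈0)))
    (≋⇒≈[] (≋-sym (∑-remove t as bs)))

-- S is the sum of the family t: modulo each q^N, all but finitely many
-- terms vanish and the others add up to S.
record HasSum (t : I → Series) (S : Series) : Set where
  constructor hasSum
  field
    approximate : ∀ N → ∃ λ is → Unique is × (∀ i → i ∈ is ⊎ t i ≈[ N ] 0ₛ) × S ≈[ N ] ∑ t is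
open HasSum

HasSum-unique : ∀ {t : I → Series} {S T} → HasSum t S → HasSum t T → S ≋ T
HasSum-unique {t = t} hS hT = ≈[]⇒≋ λ N →
  let is , ui , ci , S≈ = approximate hS N
      js , uj , cj , T≈ = approximate hT N
  in ≈[]-trans S≈ (≈[]-trans (∑-unique t ui uj (λ {i} _ → cj i) (λ {j} _ → ci j)) (≈[]-sym T≈))

HasSum-cong : ∀ {t u : I → Series} {S} → (∀ i → t i ≋ u i) → HasSum t S → HasSum u S
HasSum-cong p h = hasSum λ N →
  let is , ui , ci , S≈ = approximate h N
  in is , ui , (λ i → case ci i of λ where
                  (inj₁ i∈)   → inj₁ i∈
                  (inj₂ ti≈0) → inj₂ (≈[]-trans (≋⇒≈[] (≋-sym (p i))) ti≈0))
        , ≈[]-trans S≈ (∑-cong[] is (≋⇒≈[] ∘ p))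

HasSum-scale : ∀ c {t : I → Series} {S} → HasSum t S → HasSum (λ i → c ⊗ t i) (c ⊗ S)
HasSum-scale c {t} h = hasSum λ N →
  let is , ui , ci , S≈ = approximate h N
  in is , ui , (λ i → case ci i of λ where
                  (inj₁ i∈)   → inj₁ i∈
                  (inj₂ ti≈0) → inj₂ (≈[]-trans (⊗-cong[] ≈[]-refl ti≈0) (≋⇒≈[] (R.zeroʳ c))))
        , ≈[]-trans (⊗-cong[] ≈[]-refl S≈) (≋⇒≈[] (≋-sym (∑-scale c t is)))

HasSum-⊗ : ∀ {t : I → Series} {u : J → Series} {S T} →
           HasSum t S → HasSum u T → HasSum (λ (i , j) → t i ⊗ u j) (S ⊗ T)
HasSum-⊗ {t = t} {u} hS hT = hasSum λ N →
  let is , ui , ci , S≈ = approximate hS N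
      js , uj , cj , T≈ = approximate hT N
  in cartesianProduct is js , Unique.cartesianProduct⁺ ui uj
   , (λ (i , j) → case ci i , cj j of λ where
        (inj₁ i∈   , inj₁ j∈)   → inj₁ (∈-cartesianProduct⁺ i∈ j∈)
        (inj₂ ti≈0 , _)         → inj₂ (≈[]-trans (⊗-cong[] ti≈0 ≈[]-refl) (≋⇒≈[] (R.zeroˡ (u j))))
        (inj₁ _    , inj₂ uj≈0) → inj₂ (≈[]-trans (⊗-cong[] ≈[]-refl uj≈0) (≋⇒≈[] (R.zeroʳ (t i)))))
   , ≈[]-trans (⊗-cong[] S≈ T≈) (≋⇒≈[] (≋-sym (∑-cartesianProduct t u is js)))

HasSum-⊎ : ∀ {t : I → Series} {u : J → Series} {S T} →
           HasSum t S → HasSum u T → HasSum [ t , u ]′ (S ⊕ T)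
HasSum-⊎ {t = t} {u} hS hT = hasSum λ N →
  let is , ui , ci , S≈ = approximate hS N
      js , uj , cj , T≈ = approximate hT N
  in map inj₁ is ++ map inj₂ js
   , Unique.++⁺ (Unique.map⁺ inj₁-injective ui) (Unique.map⁺ inj₂-injective uj) disjoint
   , (λ where
        (inj₁ i) → case ci i of λ where
          (inj₁ i∈) → inj₁ (∈-++⁺ˡ (∈-map⁺ inj₁ i∈))
          (inj₂ z)  → inj₂ z
        (inj₂ j) → case cj j of λ where
          (inj₁ j∈) → inj₁ (∈-++⁺ʳ (map inj₁ is) (∈-map⁺ inj₂ j∈))
          (inj₂ z)  → inj₂ z)
   , ≈[]-trans (⊕-cong[] S≈ T≈) (≋⇒≈[] (≋-sym (≋-trans (∑-++ [ t , u ]′ (map inj₁ is) (map inj₂ js))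
       (⊕-cong (∑-map [ t , u ]′ inj₁ is) (∑-map [ t , u ]′ inj₂ js)))))
  where
  disjoint : ∀ {is : List I} {js : List J} {x} → x ∈ map inj₁ is × x ∈ map inj₂ js → _
  disjoint (x∈ , x∈′) with ∈-map⁻ inj₁ x∈ | ∈-map⁻ inj₂ x∈′
  ... | _ , _ , refl | _ , _ , ()

-- Every change of summation index passes through here. The theta identities use bijections; the
-- partition recurrence uses an injection outside whose image the terms are zero.
HasSum-embed : ∀ (f : I → J) → (∀ {i i′} → f i ≡ f i′ → i ≡ i′) →
  ∀ {t : J → Series} {S} → (∀ j → (∃ λ i → f i ≡ j) ⊎ t j ≋ 0ₛ) → HasSum (t ∘ f) S → HasSum t S
HasSum-embed f inj {t} cover h = hasSum λ N →
  let is , ui , ci , S≈ = approximate h N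
  in map f is , Unique.map⁺ inj ui
   , (λ j → case cover j of λ where
        (inj₂ z)          → inj₂ (≋⇒≈[] z)
        (inj₁ (i , refl)) → case ci i of λ where
          (inj₁ i∈) → inj₁ (∈-map⁺ f i∈)
          (inj₂ z)  → inj₂ z)
   , ≈[]-trans S≈ (≋⇒≈[] (≋-sym (∑-map t f is)))

-- Gaussian binomials and sums over j + l = N.

antidiagonal : ℕ → (ℕ → ℕ → Series) → Series
antidiagonal zero    f = f 0 0
antidiagonal (suc N) f = f 0 (suc N) ⊕ antidiagonal N (f ∘ suc)

antidiagonal-cong[] : ∀ {K f g} N → (∀ j l → j + l ≡ N → f j l ≈[ K ] g j l) →
                      antidiagonal N f ≈[ K ] antidiagonal N g
antidiagonal-cong[] zero    p = p 0 0 refl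
antidiagonal-cong[] (suc N) p =
  ⊕-cong[] (p 0 (suc N) refl) (antidiagonal-cong[] N λ j l eq → p (suc j) l (cong suc eq))

antidiagonal-cong : ∀ {f g} N → (∀ j l → j + l ≡ N → f j l ≋ g j l) →
                    antidiagonal N f ≋ antidiagonal N g
antidiagonal-cong N p = ≈[]⇒≋ λ K → antidiagonal-cong[] N λ j l eq → ≋⇒≈[] (p j l eq)

antidiagonal-snoc : ∀ f N → antidiagonal (suc N) f ≋ antidiagonal N (λ j l → f j (suc l)) ⊕ f (suc N) 0
antidiagonal-snoc f zero    = ≋-refl
antidiagonal-snoc f (suc N) = ≋-trans (⊕-cong {f 0 (suc (suc N))} ≋-refl (antidiagonal-snoc (f ∘ suc) N))
  (≋-sym (R.+-assoc (f 0 (suc (suc N))) (antidiagonal N (λ j l → f (suc j) (suc l))) (f (suc (suc N)) 0)))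

antidiagonal-flip : ∀ f N → antidiagonal N f ≋ antidiagonal N (flip f)
antidiagonal-flip f zero    = ≋-refl
antidiagonal-flip f (suc N) = ≋-trans (R.+-comm (f 0 (suc N)) (antidiagonal N (f ∘ suc)))
  (≋-trans (⊕-cong (antidiagonal-flip (f ∘ suc) N) (≋-refl {f 0 (suc N)}))
           (≋-sym (antidiagonal-snoc (flip f) N)))

antidiagonal-scale : ∀ c f N → antidiagonal N (λ j l → c ⊗ f j l) ≋ c ⊗ antidiagonal N f
antidiagonal-scale c f zero    = ≋-refl
antidiagonal-scale c f (suc N) = ≋-trans (⊕-cong {c ⊗ f 0 (suc N)} ≋-refl (antidiagonal-scale c (f ∘ suc) N))
  (≋-sym (R.distribˡ c _ _))

antidiagonal-⊕ : ∀ f g N → antidiagonal N (λ j l → f j l ⊕ g j l) ≋ antidiagonal N f ⊕ antidiagonal N g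
antidiagonal-⊕ f g zero    = ≋-refl
antidiagonal-⊕ f g (suc N) = ≋-trans (⊕-cong {f 0 (suc N) ⊕ g 0 (suc N)} ≋-refl (antidiagonal-⊕ (f ∘ suc) (g ∘ suc) N))
  (solve 4 (λ a b c d → a :+ b :+ (c :+ d) := a :+ c :+ (b :+ d)) ≋-refl
    (f 0 (suc N)) (g 0 (suc N)) (antidiagonal N (f ∘ suc)) (antidiagonal N (g ∘ suc)))

∑-applyUpTo : ∀ {I : Set} (t : I → Series) f N → ∑ t (applyUpTo f (suc N)) ≋ antidiagonal N (λ j _ → t (f j))
∑-applyUpTo t f zero    = R.+-identityʳ _
∑-applyUpTo t f (suc N) = ⊕-cong {t (f 0)} ≋-refl (∑-applyUpTo t (f ∘ suc) N)

-- gauss j l is the Gaussian binomial [j + l choose j] in the variable q^m.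
module Gaussian (m-1 : ℕ) where

  m : ℕ
  m = suc m-1

  gauss : ℕ → ℕ → Series
  gauss zero    l       = 1ₛ
  gauss (suc j) zero    = 1ₛ
  gauss (suc j) (suc l) = gauss j (suc l) ⊕ q^ (m * suc j) ⊗ gauss (suc j) l

  gauss-0 : ∀ j → gauss j 0 ≋ 1ₛ
  gauss-0 zero    = ≋-refl
  gauss-0 (suc j) = ≋-refl

  fac : ℕ → Series
  fac n = ∏< n (λ i → factor -1ℤ (m + m * i))

  fac-unit : ∀ n → Unit (fac n)
  fac-unit zero    = refl
  fac-unit (suc n) = ⊗-unit {fac n} {factor -1ℤ (m + m * n)} (fac-unit n) (factor-unit -1ℤ (m-1 + m * n))

  -- With a = q^(m(j+1)) and b = q^(m(l+1)), the q-Pascal rule multiplied by the factorials reduces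
  -- to (1 - a) + a (1 - b) = 1 - a b.
  gauss-fac : ∀ j l → gauss j l ⊗ (fac j ⊗ fac l) ≋ fac (j + l)
  gauss-fac zero    l       = solve 1 (λ a → con 1ℤ :* (con 1ℤ :* a) := a) ≋-refl (fac l)
  gauss-fac (suc j) zero    = ≋-trans (solve 1 (λ a → con 1ℤ :* (a :* con 1ℤ) := a) ≋-refl (fac (suc j)))
    (≋-reflexive λ n → cong (λ i → fac i n) (sym (+-identityʳ (suc j))))
  gauss-fac (suc j) (suc l) = begin
    (gauss j (suc l) ⊕ q^ (m * suc j) ⊗ gauss (suc j) l) ⊗ (fac (suc j) ⊗ fac (suc l))
      ≈⟨ ⊗-cong {gauss (suc j) (suc l)} ≋-refl (⊗-cong (fac-suc j) (fac-suc l)) ⟩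
    (gauss j (suc l) ⊕ q^ (m * suc j) ⊗ gauss (suc j) l) ⊗ (fac j ⊗ (1- Qʲ) ⊗ (fac l ⊗ (1- Qˡ)))
      ≈⟨ solve 6 (λ g h a b u v → (g :+ a :* h) :* (u :* (con 1ℤ :+ con -1ℤ :* a) :* (v :* (con 1ℤ :+ con -1ℤ :* b)))
            := (con 1ℤ :+ con -1ℤ :* a) :* (g :* (u :* (v :* (con 1ℤ :+ con -1ℤ :* b))))
               :+ a :* ((con 1ℤ :+ con -1ℤ :* b) :* (h :* (u :* (con 1ℤ :+ con -1ℤ :* a) :* v))))
            ≋-refl (gauss j (suc l)) (gauss (suc j) l) Qʲ Qˡ (fac j) (fac l) ⟩
    (1- Qʲ) ⊗ (gauss j (suc l) ⊗ (fac j ⊗ (fac l ⊗ (1- Qˡ)))) ⊕ Qʲ ⊗ ((1- Qˡ) ⊗ (gauss (suc j) l ⊗ (fac j ⊗ (1- Qʲ) ⊗ fac l)))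
      ≈⟨ ⊕-cong (⊗-cong {1- Qʲ} ≋-refl (≋-trans (⊗-cong {gauss j (suc l)} ≋-refl (⊗-cong {fac j} ≋-refl (≋-sym (fac-suc l)))) (gauss-fac j (suc l))))
                (⊗-cong {Qʲ} ≋-refl (⊗-cong {1- Qˡ} ≋-refl (≋-trans (⊗-cong {gauss (suc j) l} ≋-refl (⊗-cong (≋-sym (fac-suc j)) (≋-refl {fac l}))) (gauss-fac (suc j) l)))) ⟩
    (1- Qʲ) ⊗ fac (j + suc l) ⊕ Qʲ ⊗ ((1- Qˡ) ⊗ fac (suc j + l))
      ≈⟨ ⊕-cong (⊗-cong {1- Qʲ} ≋-refl (≋-reflexive λ n → cong (λ i → fac i n) (+-suc j l))) ≋-refl ⟩
    (1- Qʲ) ⊗ fac (suc (j + l)) ⊕ Qʲ ⊗ ((1- Qˡ) ⊗ fac (suc (j + l)))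
      ≈⟨ solve 3 (λ a b f → (con 1ℤ :+ con -1ℤ :* a) :* f :+ a :* ((con 1ℤ :+ con -1ℤ :* b) :* f)
            := f :* (con 1ℤ :+ con -1ℤ :* (a :* b))) ≋-refl Qʲ Qˡ (fac (suc (j + l))) ⟩
    fac (suc (j + l)) ⊗ (1- (Qʲ ⊗ Qˡ))
      ≈⟨ ⊗-cong {fac (suc (j + l))} ≋-refl (⊕-cong {1ₛ} ≋-refl (⊗-cong {const -1ℤ} ≋-refl
           (≋-trans (≋-sym (q^-+ (m * suc j) (m * suc l))) (≋-reflexive λ n → cong (λ i → (q^ i) n)
             (trans (sym (*-distribˡ-+ m (suc j) (suc l))) (cong (m *_) (+-suc (suc j) l))))))) ⟩
    fac (suc (j + l)) ⊗ (1- (q^ (m * suc (suc j + l))))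
      ≈⟨ fac-suc (suc j + l) ⟨
    fac (suc (suc j + l))
      ≈⟨ (≋-reflexive λ n → cong (λ i → fac i n) (sym (+-suc (suc j) l))) ⟩
    fac (suc j + suc l) ∎
    where
    open ≋-Reasoning
    1-_ : Series → Series
    1- X = 1ₛ ⊕ const -1ℤ ⊗ X
    Qʲ Qˡ : Series
    Qʲ = q^ (m * suc j)
    Qˡ = q^ (m * suc l)
    fac-suc : ∀ n → fac (suc n) ≋ fac n ⊗ (1- (q^ (m * suc n)))
    fac-suc n = ⊗-cong {fac n} ≋-refl (≋-reflexive λ k → cong (λ i → factor -1ℤ i k) (sym (*-suc m n)))

  -- The recursion treats j and l differently, but the factorial formula is symmetric.
  gauss-sym : ∀ j l → gauss j l ≋ gauss l j
  gauss-sym j l = ⊗-cancel (fac j ⊗ fac l) (⊗-unit {fac j} {fac l} (fac-unit j) (fac-unit l)) (begin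
    fac j ⊗ fac l ⊗ gauss j l   ≈⟨ R.*-comm _ _ ⟩
    gauss j l ⊗ (fac j ⊗ fac l) ≈⟨ gauss-fac j l ⟩
    fac (j + l)                 ≡⟨ cong fac (+-comm j l) ⟩
    fac (l + j)                 ≈⟨ gauss-fac l j ⟨
    gauss l j ⊗ (fac l ⊗ fac j) ≈⟨ solve 3 (λ a b c → a :* (b :* c) := c :* b :* a) ≋-refl (gauss l j) (fac l) (fac j) ⟩
    fac j ⊗ fac l ⊗ gauss l j   ∎)
    where open ≋-Reasoning

  -- Once j and l reach N, all three factorials in `gauss-fac` agree with the infinite product P
  -- modulo q^N, so the formula reads gauss · P · P = P.
  gauss-limit : ∀ {N j l} → N ≤ j → N ≤ l → gauss j l ⊗ poch -1ℤ m m ≈[ N ] 1ₛ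
  gauss-limit {N} {j} {l} N≤j N≤l = ⊗-cancel[] P (poch-unit -1ℤ m-1 m) (begin
    P ⊗ (gauss j l ⊗ P)         ≈⟨ ≋⇒≈[] (solve 2 (λ p g → p :* (g :* p) := g :* (p :* p)) ≋-refl P (gauss j l)) ⟩
    gauss j l ⊗ (P ⊗ P)         ≈⟨ ⊗-cong[] (≈[]-refl {x = gauss j l}) (⊗-cong[] (P≈fac N≤j) (P≈fac N≤l)) ⟩
    gauss j l ⊗ (fac j ⊗ fac l) ≈⟨ ≋⇒≈[] (gauss-fac j l) ⟩
    fac (j + l)                 ≈⟨ P≈fac (≤-trans N≤j (m≤m+n j l)) ⟨
    P                           ≈⟨ ≋⇒≈[] (≋-sym (R.*-identityʳ P)) ⟩
    P ⊗ 1ₛ                      ∎)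
    where
    open ≈[]-Reasoning
    P = poch -1ℤ m m
    P≈fac : ∀ {n} → N ≤ n → P ≈[ N ] fac n
    P≈fac = Π≈∏< (poch-conv -1ℤ m m)

  -- The q-Pascal rule, as a recurrence for sums of gauss j l over j + l = N.
  gauss-step : ∀ N (u u′ : ℕ → ℕ → Series) c →
    (∀ j l → u′ (suc j) l ≋ u j l) →
    u′ 0 (suc N) ≋ c ⊗ u 0 N →
    (∀ j l → j + suc l ≡ N → q^ (m * suc j) ⊗ u j (suc l) ≋ c ⊗ u (suc j) l) →
    antidiagonal (suc N) (λ j l → gauss j l ⊗ u′ j l) ≋ (1ₛ ⊕ c) ⊗ antidiagonal N (λ j l → gauss j l ⊗ u j l)
  gauss-step N u u′ c shift-u u′-first exchange = begin
    1ₛ ⊗ u′ 0 (suc N) ⊕ antidiagonal N (λ j l → gauss (suc j) l ⊗ u′ (suc j) l)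
      ≈⟨ ⊕-cong (≋-trans (R.*-identityˡ _) u′-first) (antidiagonal-cong N λ j l _ → pascal j l) ⟩
    c ⊗ u 0 N ⊕ antidiagonal N (λ j l → gauss j l ⊗ u j l ⊕ rest j l)
      ≈⟨ ⊕-cong {c ⊗ u 0 N} ≋-refl (antidiagonal-⊕ _ rest N) ⟩
    c ⊗ u 0 N ⊕ (X ⊕ antidiagonal N rest)
      ≈⟨ solve 3 (λ a b d → a :+ (b :+ d) := b :+ (a :+ d)) ≋-refl (c ⊗ u 0 N) X (antidiagonal N rest) ⟩
    X ⊕ (c ⊗ u 0 N ⊕ antidiagonal N rest)
      ≈⟨ ⊕-cong {X} ≋-refl (collect N exchange) ⟩
    X ⊕ c ⊗ X
      ≈⟨ solve 2 (λ c X → X :+ c :* X := (con 1ℤ :+ c) :* X) ≋-refl c X ⟩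
    (1ₛ ⊕ c) ⊗ X ∎
    where
    open ≋-Reasoning
    X = antidiagonal N (λ j l → gauss j l ⊗ u j l)
    rest : ℕ → ℕ → Series
    -- At l = 0 the Gaussian binomials are 1 and the q-Pascal rule has no second summand.
    rest j zero    = 0ₛ
    rest j (suc l) = gauss (suc j) l ⊗ (q^ (m * suc j) ⊗ u j (suc l))
    pascal : ∀ j l → gauss (suc j) l ⊗ u′ (suc j) l ≋ gauss j l ⊗ u j l ⊕ rest j l
    pascal j zero    = ≋-trans (⊗-cong (≋-sym (gauss-0 j)) (shift-u j 0)) (≋-sym (R.+-identityʳ _))
    pascal j (suc l) = ≋-trans (⊗-cong {gauss (suc j) (suc l)} ≋-refl (shift-u j (suc l)))
      (solve 4 (λ g Q h v → (g :+ Q :* h) :* v := g :* v :+ h :* (Q :* v)) ≋-refl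
        (gauss j (suc l)) (q^ (m * suc j)) (gauss (suc j) l) (u j (suc l)))
    collect : ∀ N → (∀ j l → j + suc l ≡ N → q^ (m * suc j) ⊗ u j (suc l) ≋ c ⊗ u (suc j) l) →
              c ⊗ u 0 N ⊕ antidiagonal N rest ≋ c ⊗ antidiagonal N (λ j l → gauss j l ⊗ u j l)
    collect zero    _        = ≋-trans (R.+-identityʳ _) (⊗-cong {c} ≋-refl (≋-sym (R.*-identityˡ (u 0 0))))
    collect (suc N) exchange = begin
      c ⊗ u 0 (suc N) ⊕ antidiagonal (suc N) rest
        ≈⟨ ⊕-cong {c ⊗ u 0 (suc N)} ≋-refl (≋-trans (antidiagonal-snoc rest N) (R.+-identityʳ _)) ⟩
      c ⊗ u 0 (suc N) ⊕ antidiagonal N (λ j l → rest j (suc l))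
        ≈⟨ ⊕-cong {c ⊗ u 0 (suc N)} ≋-refl (antidiagonal-cong N λ j l eq →
             ≋-trans (⊗-cong {gauss (suc j) l} ≋-refl (exchange j l (trans (+-suc j l) (cong suc eq))))
               (solve 3 (λ g c v → g :* (c :* v) := c :* (g :* v)) ≋-refl (gauss (suc j) l) c (u (suc j) l))) ⟩
      c ⊗ u 0 (suc N) ⊕ antidiagonal N (λ j l → c ⊗ (gauss (suc j) l ⊗ u (suc j) l))
        ≈⟨ ⊕-cong {c ⊗ u 0 (suc N)} ≋-refl (antidiagonal-scale c _ N) ⟩
      c ⊗ u 0 (suc N) ⊕ c ⊗ Z
        ≈⟨ solve 3 (λ c v Z → c :* v :+ c :* Z := c :* (con 1ℤ :* v :+ Z)) ≋-refl c (u 0 (suc N)) Z ⟩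
      c ⊗ (1ₛ ⊗ u 0 (suc N) ⊕ Z) ∎
      where Z = antidiagonal N (λ j l → gauss (suc j) l ⊗ u (suc j) l)

-- Exponents and signs of theta terms.

triangle : ℕ → ℕ
triangle zero    = 0
triangle (suc n) = suc n + triangle n

triangleℤ : ℤ → ℕ
triangleℤ (+ n)    = triangle n
triangleℤ -[1+ n ] = triangle n

double-triangle : ∀ n → + 2 ℤ.* + triangle n ≡ + n ℤ.* (1ℤ ℤ.+ + n)
double-triangle zero    = refl
double-triangle (suc n) = begin
  + 2 ℤ.* (+ suc n ℤ.+ + triangle n)              ≡⟨ ℤ.*-distribˡ-+ (+ 2) (+ suc n) (+ triangle n) ⟩
  + 2 ℤ.* + suc n ℤ.+ + 2 ℤ.* + triangle n        ≡⟨ cong (ℤ._+_ (+ 2 ℤ.* + suc n)) (double-triangle n) ⟩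
  + 2 ℤ.* (1ℤ ℤ.+ + n) ℤ.+ + n ℤ.* (1ℤ ℤ.+ + n)   ≡⟨ lemma (+ n) ⟩
  (1ℤ ℤ.+ + n) ℤ.* (1ℤ ℤ.+ (1ℤ ℤ.+ + n))          ∎
  where
  open ≡-Reasoning
  lemma : ∀ n → + 2 ℤ.* (1ℤ ℤ.+ n) ℤ.+ n ℤ.* (1ℤ ℤ.+ n) ≡ (1ℤ ℤ.+ n) ℤ.* (1ℤ ℤ.+ (1ℤ ℤ.+ n))
  lemma = solve-∀ℤ

double-triangleℤ : ∀ k → + 2 ℤ.* + triangleℤ k ≡ k ℤ.* (1ℤ ℤ.+ k)
double-triangleℤ (+ n)    = double-triangle n
double-triangleℤ -[1+ n ] = trans (double-triangle n) (lemma (+ n))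
  where
  lemma : ∀ n → n ℤ.* (1ℤ ℤ.+ n) ≡ ℤ.- (1ℤ ℤ.+ n) ℤ.* (1ℤ ℤ.+ ℤ.- (1ℤ ℤ.+ n))
  lemma = solve-∀ℤ

-- This is x k(k+1)/2 + y k(k-1)/2, the exponent in Jacobi's triple product. Triangular numbers keep
-- it in ℕ; identities about it are checked over ℤ after doubling and brought back by `halve`.
exponent : ℕ → ℕ → ℤ → ℕ
exponent x y k = x * triangleℤ k + y * triangleℤ (ℤ.- k)

double-exponent : ∀ x y k → + 2 ℤ.* + exponent x y k ≡ (+ x ℤ.+ + y) ℤ.* (k ℤ.* k) ℤ.+ (+ x ℤ.- + y) ℤ.* k
double-exponent x y k = begin
  + 2 ℤ.* (+ (x * s) ℤ.+ + (y * t))                      ≡⟨ cong₂ (λ a b → + 2 ℤ.* (a ℤ.+ b)) (ℤ.pos-* x s) (ℤ.pos-* y t) ⟩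
  + 2 ℤ.* (+ x ℤ.* + s ℤ.+ + y ℤ.* + t)                  ≡⟨ lemma₁ (+ x) (+ y) (+ s) (+ t) ⟩
  + x ℤ.* (+ 2 ℤ.* + s) ℤ.+ + y ℤ.* (+ 2 ℤ.* + t)        ≡⟨ cong₂ (λ a b → + x ℤ.* a ℤ.+ + y ℤ.* b) (double-triangleℤ k) (double-triangleℤ (ℤ.- k)) ⟩
  + x ℤ.* (k ℤ.* (1ℤ ℤ.+ k)) ℤ.+ + y ℤ.* (ℤ.- k ℤ.* (1ℤ ℤ.+ ℤ.- k)) ≡⟨ lemma₂ (+ x) (+ y) k ⟩
  (+ x ℤ.+ + y) ℤ.* (k ℤ.* k) ℤ.+ (+ x ℤ.- + y) ℤ.* k    ∎
  where
  open ≡-Reasoning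
  s = triangleℤ k
  t = triangleℤ (ℤ.- k)
  lemma₁ : ∀ x y s t → + 2 ℤ.* (x ℤ.* s ℤ.+ y ℤ.* t) ≡ x ℤ.* (+ 2 ℤ.* s) ℤ.+ y ℤ.* (+ 2 ℤ.* t)
  lemma₁ = solve-∀ℤ
  lemma₂ : ∀ x y k → x ℤ.* (k ℤ.* (1ℤ ℤ.+ k)) ℤ.+ y ℤ.* (ℤ.- k ℤ.* (1ℤ ℤ.+ ℤ.- k)) ≡
                     (x ℤ.+ y) ℤ.* (k ℤ.* k) ℤ.+ (x ℤ.- y) ℤ.* k
  lemma₂ = solve-∀ℤ

halve : ∀ {a b : ℕ} → + 2 ℤ.* + a ≡ + 2 ℤ.* + b → a ≡ b
halve {a} {b} eq = ℤ.+-injective (ℤ.*-cancelˡ-≡ (+ 2) (+ a) (+ b) eq)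

exponent-step : ∀ x y k a c → + a ≡ + c ℤ.+ ((+ x ℤ.+ + y) ℤ.* k ℤ.+ + x) →
                a + exponent x y k ≡ c + exponent x y (1ℤ ℤ.+ k)
exponent-step x y k a c eq = halve (begin
  + 2 ℤ.* (+ a ℤ.+ + exponent x y k)
    ≡⟨ ℤ.*-distribˡ-+ (+ 2) (+ a) (+ exponent x y k) ⟩
  + 2 ℤ.* + a ℤ.+ + 2 ℤ.* + exponent x y k
    ≡⟨ cong₂ (λ u v → + 2 ℤ.* u ℤ.+ v) eq (double-exponent x y k) ⟩
  + 2 ℤ.* (+ c ℤ.+ ((+ x ℤ.+ + y) ℤ.* k ℤ.+ + x)) ℤ.+ ((+ x ℤ.+ + y) ℤ.* (k ℤ.* k) ℤ.+ (+ x ℤ.- + y) ℤ.* k)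
    ≡⟨ lemma (+ c) (+ x) (+ y) k ⟩
  + 2 ℤ.* + c ℤ.+ ((+ x ℤ.+ + y) ℤ.* ((1ℤ ℤ.+ k) ℤ.* (1ℤ ℤ.+ k)) ℤ.+ (+ x ℤ.- + y) ℤ.* (1ℤ ℤ.+ k))
    ≡⟨ cong (ℤ._+_ (+ 2 ℤ.* + c)) (sym (double-exponent x y (1ℤ ℤ.+ k))) ⟩
  + 2 ℤ.* + c ℤ.+ + 2 ℤ.* + exponent x y (1ℤ ℤ.+ k)
    ≡⟨ sym (ℤ.*-distribˡ-+ (+ 2) (+ c) (+ exponent x y (1ℤ ℤ.+ k))) ⟩
  + 2 ℤ.* (+ c ℤ.+ + exponent x y (1ℤ ℤ.+ k)) ∎)
  where
  open ≡-Reasoning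
  lemma : ∀ c x y k → + 2 ℤ.* (c ℤ.+ ((x ℤ.+ y) ℤ.* k ℤ.+ x)) ℤ.+ ((x ℤ.+ y) ℤ.* (k ℤ.* k) ℤ.+ (x ℤ.- y) ℤ.* k) ≡
          + 2 ℤ.* c ℤ.+ ((x ℤ.+ y) ℤ.* ((1ℤ ℤ.+ k) ℤ.* (1ℤ ℤ.+ k)) ℤ.+ (x ℤ.- y) ℤ.* (1ℤ ℤ.+ k))
  lemma = solve-∀ℤ

∣k∣≤1+triangle : ∀ k → ∣ k ∣ ≤ suc (triangleℤ k)
∣k∣≤1+triangle (+ zero)  = z≤n
∣k∣≤1+triangle (+ suc n) = m≤n⇒m≤1+n (m≤m+n (suc n) (triangle n))
∣k∣≤1+triangle -[1+ n ]  = s≤s (n≤triangle n)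
  where
  n≤triangle : ∀ n → n ≤ triangle n
  n≤triangle zero    = z≤n
  n≤triangle (suc n) = m≤m+n (suc n) (triangle n)

-- This growth leaves only finitely many theta terms modulo q^N. The extra 1 is attained at k = -1
-- with y = 0, where the exponent is 0.
∣k∣≤1+exponent : ∀ x y k .{{_ : NonZero (x + y)}} → ∣ k ∣ ≤ suc (exponent x y k)
∣k∣≤1+exponent (suc x) y k = ≤-trans (∣k∣≤1+triangle k)
  (s≤s (≤-trans (m≤m+n (triangleℤ k) _) (m≤m+n (suc x * triangleℤ k) _)))
∣k∣≤1+exponent zero (suc y) k = subst (_≤ suc (exponent 0 (suc y) k)) (ℤ.∣-i∣≡∣i∣ k) (≤-trans (∣k∣≤1+triangle (ℤ.- k))
  (s≤s (m≤m+n (triangleℤ (ℤ.- k)) (y * triangleℤ (ℤ.- k)))))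

data Sign : ℤ → Set where
  plus  : Sign 1ℤ
  minus : Sign -1ℤ

sign² : ∀ {s} → Sign s → s ℤ.* s ≡ 1ℤ
sign² plus  = refl
sign² minus = refl

infixr 8 _^ℤ_

-- Meant for s = ±1: such s is its own inverse, so ∣ k ∣ may replace k and the exponent law `^ℤ-+`
-- still holds.
_^ℤ_ : ℤ → ℤ → ℤ
s ^ℤ k = s ℤ.^ ∣ k ∣

sign-cancel : ∀ {s} → Sign s → ∀ x → s ℤ.* (s ℤ.* x) ≡ x
sign-cancel {s} sg x = trans (sym (ℤ.*-assoc s s x)) (trans (cong (ℤ._* x) (sign² sg)) (ℤ.*-identityˡ x))

^ℤ-suc : ∀ {s} → Sign s → ∀ k → s ^ℤ (1ℤ ℤ.+ k) ≡ s ℤ.* s ^ℤ k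
^ℤ-suc sg (+ n)          = refl
^ℤ-suc sg -[1+ zero ]    = sym (sign-cancel sg 1ℤ)
^ℤ-suc sg -[1+ suc n ]   = sym (sign-cancel sg _)

^ℤ-+ : ∀ {s} → Sign s → ∀ k l → s ^ℤ (k ℤ.+ l) ≡ s ^ℤ k ℤ.* s ^ℤ l
^ℤ-+ {s} sg (+ zero) l = trans (cong (s ^ℤ_) (ℤ.+-identityˡ l)) (sym (ℤ.*-identityˡ (s ^ℤ l)))
^ℤ-+ {s} sg (+ suc n) l = begin
  s ^ℤ (1ℤ ℤ.+ + n ℤ.+ l)    ≡⟨ cong (s ^ℤ_) (ℤ.+-assoc 1ℤ (+ n) l) ⟩
  s ^ℤ (1ℤ ℤ.+ (+ n ℤ.+ l))  ≡⟨ ^ℤ-suc sg (+ n ℤ.+ l) ⟩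
  s ℤ.* s ^ℤ (+ n ℤ.+ l)     ≡⟨ cong (s ℤ.*_) (^ℤ-+ sg (+ n) l) ⟩
  s ℤ.* (s ^ℤ + n ℤ.* s ^ℤ l) ≡⟨ ℤ.*-assoc s (s ^ℤ + n) (s ^ℤ l) ⟨
  s ℤ.* s ^ℤ + n ℤ.* s ^ℤ l  ∎
  where open ≡-Reasoning
^ℤ-+ {s} sg -[1+ n ] l = begin
  s ^ℤ (-[1+ n ] ℤ.+ l)               ≡⟨ sign-cancel sg _ ⟨
  s ℤ.* (s ℤ.* s ^ℤ (-[1+ n ] ℤ.+ l)) ≡⟨ cong (s ℤ.*_) (sym (^ℤ-suc sg (-[1+ n ] ℤ.+ l))) ⟩
  s ℤ.* s ^ℤ (1ℤ ℤ.+ (-[1+ n ] ℤ.+ l)) ≡⟨ cong (λ z → s ℤ.* s ^ℤ z) (trans (sym (ℤ.+-assoc 1ℤ -[1+ n ] l)) (cong (ℤ._+ l) (lemma n))) ⟩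
  s ℤ.* s ^ℤ (ℤ.- + n ℤ.+ l)          ≡⟨ cong (s ℤ.*_) (neg n) ⟩
  s ℤ.* (s ^ℤ + n ℤ.* s ^ℤ l)         ≡⟨ ℤ.*-assoc s (s ^ℤ + n) (s ^ℤ l) ⟨
  s ^ℤ -[1+ n ] ℤ.* s ^ℤ l            ∎
  where
  open ≡-Reasoning
  lemma : ∀ n → 1ℤ ℤ.+ -[1+ n ] ≡ ℤ.- + n
  lemma zero    = refl
  lemma (suc n) = refl
  neg : ∀ n → s ^ℤ (ℤ.- + n ℤ.+ l) ≡ s ^ℤ + n ℤ.* s ^ℤ l
  neg zero    = ^ℤ-+ sg (+ zero) l
  neg (suc n) = ^ℤ-+ sg -[1+ n ] l

const-cong : ∀ {a b} → a ≡ b → const a ≋ const b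
const-cong refl = ≋-refl

const-* : ∀ a b → const (a ℤ.* b) ≋ const a ⊗ const b
const-* = _-Raw-AlmostCommutative⟶_.*-homo const-morphism

q^-cong : ∀ {a b} → a ≡ b → q^ a ≋ q^ b
q^-cong refl = ≋-refl

θ-term : ℤ → ℕ → ℕ → ℤ → Series
θ-term s x y k = const (s ^ℤ k) ⊗ q^ exponent x y k

θ-term-vanish : ∀ s x y k {N} .{{_ : NonZero (x + y)}} → N < ∣ k ∣ → θ-term s x y k ≈[ N ] 0ₛ
θ-term-vanish s x y k N<∣k∣ = ≈[]-trans
  (⊗-cong[] (≈[]-refl {x = const (s ^ℤ k)}) (q^≈0 (s≤s⁻¹ (≤-trans N<∣k∣ (∣k∣≤1+exponent x y k)))))
  (≋⇒≈[] (R.zeroʳ (const (s ^ℤ k))))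

module _ {s} (sg : Sign s) (x y : ℕ) where

  private
    S : Series
    S = const s

  S²≋1 : ∀ A → S ⊗ (S ⊗ A) ≋ A
  S²≋1 A = ≋-trans (≋-sym (R.*-assoc S S A))
    (≋-trans (⊗-cong (≋-trans (≋-sym (const-* s s)) (const-cong (sign² sg))) ≋-refl) (R.*-identityˡ A))

  -- Consecutive terms have ratio s q^((x+y)k + x). That exponent can be negative, so it is
  -- represented as a difference a - c of natural numbers.
  θ-term-up : ∀ k a c → + a ≡ + c ℤ.+ ((+ x ℤ.+ + y) ℤ.* k ℤ.+ + x) →
              q^ a ⊗ θ-term s x y k ≋ (S ⊗ q^ c) ⊗ θ-term s x y (1ℤ ℤ.+ k)
  θ-term-up k a c eq = begin
    q^ a ⊗ (σ ⊗ q^ exponent x y k)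
      ≈⟨ solve 3 (λ p σ r → p :* (σ :* r) := σ :* (p :* r)) ≋-refl (q^ a) σ (q^ exponent x y k) ⟩
    σ ⊗ (q^ a ⊗ q^ exponent x y k)
      ≈⟨ ⊗-cong (≋-sym (≋-trans (⊗-cong {S} ≋-refl (≋-trans (const-cong (^ℤ-suc sg k)) (const-* s (s ^ℤ k)))) (S²≋1 σ)))
                (≋-trans (≋-sym (q^-+ a (exponent x y k))) (≋-trans (q^-cong (exponent-step x y k a c eq)) (q^-+ c (exponent x y (1ℤ ℤ.+ k))))) ⟩
    (S ⊗ σ′) ⊗ (q^ c ⊗ q^ exponent x y (1ℤ ℤ.+ k))
      ≈⟨ solve 4 (λ S σ′ p r → (S :* σ′) :* (p :* r) := (S :* p) :* (σ′ :* r)) ≋-refl S σ′ (q^ c) (q^ exponent x y (1ℤ ℤ.+ k)) ⟩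
    (S ⊗ q^ c) ⊗ (σ′ ⊗ q^ exponent x y (1ℤ ℤ.+ k)) ∎
    where
    open ≋-Reasoning
    σ σ′ : Series
    σ  = const (s ^ℤ k)
    σ′ = const (s ^ℤ (1ℤ ℤ.+ k))

  θ-term-down : ∀ k a c → + a ≡ + c ℤ.+ ((+ x ℤ.+ + y) ℤ.* k ℤ.+ + x) →
                q^ c ⊗ θ-term s x y (1ℤ ℤ.+ k) ≋ (S ⊗ q^ a) ⊗ θ-term s x y k
  θ-term-down k a c eq = begin
    q^ c ⊗ w′                  ≈⟨ S²≋1 (q^ c ⊗ w′) ⟨
    S ⊗ (S ⊗ (q^ c ⊗ w′))      ≈⟨ ⊗-cong {S} ≋-refl (≋-sym (R.*-assoc S (q^ c) w′)) ⟩
    S ⊗ ((S ⊗ q^ c) ⊗ w′)      ≈⟨ ⊗-cong {S} ≋-refl (≋-sym (θ-term-up k a c eq)) ⟩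
    S ⊗ (q^ a ⊗ w)             ≈⟨ R.*-assoc S (q^ a) w ⟨
    (S ⊗ q^ a) ⊗ w             ∎
    where
    open ≋-Reasoning
    w w′ : Series
    w  = θ-term s x y k
    w′ = θ-term s x y (1ℤ ℤ.+ k)

-- Jacobi's triple product.

θ : ℤ → ℕ → ℕ → Series
θ s x y = poch s x (x + y) ⊗ poch s y (x + y) ⊗ poch -1ℤ (x + y) (x + y)

module _ {s} (sg : Sign s) (x y m-1 : ℕ) (x+y≡m : x + y ≡ suc m-1) where

  open Gaussian m-1

  private
    S : Series
    S = const s

    w : ℤ → Series
    w = θ-term s x y

    +x++y : + x ℤ.+ + y ≡ + m
    +x++y = cong +_ x+y≡m

  a-factor b-factor : ℕ → Series
  a-factor i = factor s (x + m * i)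
  b-factor i = factor s (y + m * i)

  pos-affine : ∀ z i → + (z + m * i) ≡ + z ℤ.+ (+ x ℤ.+ + y) ℤ.* + i
  pos-affine z i = cong (ℤ._+_ (+ z)) (trans (ℤ.pos-* m i) (cong (ℤ._* + i) (sym +x++y)))

  pos-multiple : ∀ i → + (m * i) ≡ (+ x ℤ.+ + y) ℤ.* + i
  pos-multiple i = trans (ℤ.pos-* m i) (cong (ℤ._* + i) (sym +x++y))

  w-cong : ∀ {k l} → k ≡ l → w k ≋ w l
  w-cong refl = ≋-refl

  -- The finite form of Jacobi's identity, built one factor at a time with `gauss-step`. A new
  -- b-factor shifts the summation index; a new a-factor (added while n = 0) needs the reflection j
  -- ↔ l, which `gauss-sym` permits.
  finite-triple-product : ∀ i n → ∏< i a-factor ⊗ ∏< n b-factor ≋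
                          antidiagonal (i + n) (λ j l → gauss j l ⊗ w (+ j ℤ.- + n))
  finite-triple-product zero zero = ≋-trans (R.*-identityˡ 1ₛ) (≋-sym (≋-trans (R.*-identityˡ (w 0ℤ))
    (≋-trans (R.*-identityˡ _) (q^-cong (cong₂ _+_ (*-zeroʳ x) (*-zeroʳ y))))))
  finite-triple-product (suc i) zero = begin
    ∏< i a-factor ⊗ a-factor i ⊗ 1ₛ
      ≈⟨ solve 2 (λ p f → p :* f :* con 1ℤ := f :* (p :* con 1ℤ)) ≋-refl (∏< i a-factor) (a-factor i) ⟩
    a-factor i ⊗ (∏< i a-factor ⊗ 1ₛ)
      ≈⟨ ⊗-cong {a-factor i} ≋-refl (finite-triple-product i zero) ⟩
    a-factor i ⊗ antidiagonal N (λ j l → gauss j l ⊗ w (+ j ℤ.- 0ℤ))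
      ≈⟨ ⊗-cong {a-factor i} ≋-refl (flip-gauss N) ⟩
    a-factor i ⊗ antidiagonal N (λ j l → gauss j l ⊗ w (+ l ℤ.- 0ℤ))
      ≈⟨ gauss-step N u u (S ⊗ q^ (x + m * i)) (λ _ _ → ≋-refl) first exchange ⟨
    antidiagonal (suc N) (λ j l → gauss j l ⊗ w (+ l ℤ.- 0ℤ))
      ≈⟨ flip-gauss (suc N) ⟨
    antidiagonal (suc N) (λ j l → gauss j l ⊗ w (+ j ℤ.- 0ℤ)) ∎
    where
    open ≋-Reasoning
    N = i + 0
    u : ℕ → ℕ → Series
    u j l = w (+ l ℤ.- 0ℤ)
    flip-gauss : ∀ N → antidiagonal N (λ j l → gauss j l ⊗ w (+ j ℤ.- 0ℤ)) ≋
                       antidiagonal N (λ j l → gauss j l ⊗ w (+ l ℤ.- 0ℤ))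
    flip-gauss N = ≋-trans (antidiagonal-flip _ N)
      (antidiagonal-cong N λ j l _ → ⊗-cong (gauss-sym l j) (≋-refl {w (+ l ℤ.- 0ℤ)}))
    first : u 0 (suc N) ≋ (S ⊗ q^ (x + m * i)) ⊗ u 0 N
    first = ≋-trans (≋-sym (R.*-identityˡ (u 0 (suc N)))) (≋-trans (⊗-cong {1ₛ} ≋-refl (w-cong (suc-index N)))
      (θ-term-down sg x y (+ N ℤ.- 0ℤ) (x + m * i) 0
        (trans (pos-affine x i) (trans (lemma (+ x) (+ y) (+ i)) (cong (λ z → 0ℤ ℤ.+ ((+ x ℤ.+ + y) ℤ.* (+ z ℤ.- 0ℤ) ℤ.+ + x)) (sym (+-identityʳ i)))))))
      where
      suc-index : ∀ N → + suc N ℤ.- 0ℤ ≡ 1ℤ ℤ.+ (+ N ℤ.- 0ℤ)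
      suc-index N = ℤ.+-assoc 1ℤ (+ N) 0ℤ
      lemma : ∀ x y i → x ℤ.+ (x ℤ.+ y) ℤ.* i ≡ 0ℤ ℤ.+ ((x ℤ.+ y) ℤ.* (i ℤ.- 0ℤ) ℤ.+ x)
      lemma = solve-∀ℤ
    exchange : ∀ j l → j + suc l ≡ N → q^ (m * suc j) ⊗ u j (suc l) ≋ (S ⊗ q^ (x + m * i)) ⊗ u (suc j) l
    exchange j l eq = ≋-trans (⊗-cong {q^ (m * suc j)} ≋-refl (w-cong (ℤ.+-assoc 1ℤ (+ l) 0ℤ)))
      (θ-term-down sg x y (+ l ℤ.- 0ℤ) (x + m * i) (m * suc j)
        (trans (pos-affine x i) (trans (cong (λ z → + x ℤ.+ (+ x ℤ.+ + y) ℤ.* + z) i≡) (trans (lemma (+ x) (+ y) (+ j) (+ l))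
          (cong (ℤ._+ ((+ x ℤ.+ + y) ℤ.* (+ l ℤ.- 0ℤ) ℤ.+ + x)) (sym (pos-multiple (suc j))))))))
      where
      i≡ : i ≡ suc j + l
      i≡ = trans (sym (+-identityʳ i)) (trans (sym eq) (+-suc j l))
      lemma : ∀ x y j l → x ℤ.+ (x ℤ.+ y) ℤ.* (1ℤ ℤ.+ j ℤ.+ l) ≡
              (x ℤ.+ y) ℤ.* (1ℤ ℤ.+ j) ℤ.+ ((x ℤ.+ y) ℤ.* (l ℤ.- 0ℤ) ℤ.+ x)
      lemma = solve-∀ℤ
  finite-triple-product i (suc n) = begin
    ∏< i a-factor ⊗ (∏< n b-factor ⊗ b-factor n)
      ≈⟨ solve 3 (λ p r f → p :* (r :* f) := f :* (p :* r)) ≋-refl (∏< i a-factor) (∏< n b-factor) (b-factor n) ⟩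
    b-factor n ⊗ (∏< i a-factor ⊗ ∏< n b-factor)
      ≈⟨ ⊗-cong {b-factor n} ≋-refl (finite-triple-product i n) ⟩
    b-factor n ⊗ antidiagonal (i + n) (λ j l → gauss j l ⊗ u j l)
      ≈⟨ gauss-step (i + n) u u′ (S ⊗ q^ (y + m * n)) (λ j l → w-cong (lemma₀ (+ j) (+ n))) first exchange ⟨
    antidiagonal (suc (i + n)) (λ j l → gauss j l ⊗ u′ j l)
      ≡⟨ cong (λ N → antidiagonal N (λ j l → gauss j l ⊗ u′ j l)) (sym (+-suc i n)) ⟩
    antidiagonal (i + suc n) (λ j l → gauss j l ⊗ u′ j l) ∎
    where
    open ≋-Reasoning
    u u′ : ℕ → ℕ → Series
    u  j l = w (+ j ℤ.- + n)
    u′ j l = w (+ j ℤ.- + suc n)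
    lemma₀ : ∀ j n → 1ℤ ℤ.+ j ℤ.- (1ℤ ℤ.+ n) ≡ j ℤ.- n
    lemma₀ = solve-∀ℤ
    lemma₁ : ∀ n → 0ℤ ℤ.- n ≡ 1ℤ ℤ.+ (0ℤ ℤ.- (1ℤ ℤ.+ n))
    lemma₁ = solve-∀ℤ
    lemma₂ : ∀ x y n → 0ℤ ≡ y ℤ.+ (x ℤ.+ y) ℤ.* n ℤ.+ ((x ℤ.+ y) ℤ.* (0ℤ ℤ.- (1ℤ ℤ.+ n)) ℤ.+ x)
    lemma₂ = solve-∀ℤ
    lemma₃ : ∀ x y j n → (x ℤ.+ y) ℤ.* (1ℤ ℤ.+ j) ≡ y ℤ.+ (x ℤ.+ y) ℤ.* n ℤ.+ ((x ℤ.+ y) ℤ.* (j ℤ.- n) ℤ.+ x)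
    lemma₃ = solve-∀ℤ
    first : u′ 0 (suc (i + n)) ≋ (S ⊗ q^ (y + m * n)) ⊗ u 0 (i + n)
    first = ≋-trans (≋-sym (R.*-identityˡ (u′ 0 (suc (i + n))))) (≋-trans
      (θ-term-up sg x y (0ℤ ℤ.- + suc n) 0 (y + m * n)
        (trans (lemma₂ (+ x) (+ y) (+ n)) (cong (ℤ._+ ((+ x ℤ.+ + y) ℤ.* (0ℤ ℤ.- + suc n) ℤ.+ + x)) (sym (pos-affine y n)))))
      (⊗-cong {S ⊗ q^ (y + m * n)} ≋-refl (w-cong (sym (lemma₁ (+ n))))))
    exchange : ∀ j l → j + suc l ≡ i + n → q^ (m * suc j) ⊗ u j (suc l) ≋ (S ⊗ q^ (y + m * n)) ⊗ u (suc j) l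
    exchange j l _ = ≋-trans (θ-term-up sg x y (+ j ℤ.- + n) (m * suc j) (y + m * n)
        (trans (pos-multiple (suc j)) (trans (lemma₃ (+ x) (+ y) (+ j) (+ n))
          (cong (ℤ._+ ((+ x ℤ.+ + y) ℤ.* (+ j ℤ.- + n) ℤ.+ + x)) (sym (pos-affine y n))))))
      (⊗-cong {S ⊗ q^ (y + m * n)} ≋-refl (w-cong (sym (ℤ.+-assoc 1ℤ (+ j) (ℤ.- + n)))))

  private
    P : Series
    P = poch -1ℤ m m

    instance
      x+y-nonZero : NonZero (x + y)
      x+y-nonZero = subst NonZero (sym x+y≡m) _

  -- Taking r = 2N factors of each kind separates two cases: if ∣ j - r ∣ ≤ N, then j and l are both
  -- at least N and `gauss-limit` turns the coefficient into 1; otherwise the theta term itself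
  -- vanishes modulo q^N.
  triple-product-approx : ∀ N → let r = N + N in
    poch s x m ⊗ poch s y m ⊗ P ≈[ N ] antidiagonal (r + r) (λ j l → w (+ j ℤ.- + r))
  triple-product-approx N = begin
    poch s x m ⊗ poch s y m ⊗ P
      ≈⟨ ⊗-cong[] (⊗-cong[] (Π≈∏< (poch-conv s x m) N≤r) (Π≈∏< (poch-conv s y m) N≤r)) (≈[]-refl {x = P}) ⟩
    ∏< r a-factor ⊗ ∏< r b-factor ⊗ P
      ≈⟨ ≋⇒≈[] (≋-trans (R.*-comm _ P) (⊗-cong {P} ≋-refl (finite-triple-product r r))) ⟩
    P ⊗ antidiagonal (r + r) (λ j l → gauss j l ⊗ w (+ j ℤ.- + r))
      ≈⟨ ≋⇒≈[] (≋-sym (antidiagonal-scale P _ (r + r))) ⟩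
    antidiagonal (r + r) (λ j l → P ⊗ (gauss j l ⊗ w (+ j ℤ.- + r)))
      ≈⟨ antidiagonal-cong[] (r + r) term ⟩
    antidiagonal (r + r) (λ j l → w (+ j ℤ.- + r)) ∎
    where
    open ≈[]-Reasoning
    r = N + N
    N≤r : N ≤ r
    N≤r = m≤m+n N N
    term : ∀ j l → j + l ≡ r + r → P ⊗ (gauss j l ⊗ w (+ j ℤ.- + r)) ≈[ N ] w (+ j ℤ.- + r)
    term j l j+l≡ with ∣ + j ℤ.- + r ∣ ≤? N
    ... | no far = ≈[]-trans (⊗-cong[] (≈[]-refl {x = P}) (⊗-cong[] (≈[]-refl {x = gauss j l}) small))
        (≈[]-trans (≋⇒≈[] (solve 2 (λ p g → p :* (g :* con 0ℤ) := con 0ℤ) ≋-refl P (gauss j l))) (≈[]-sym small))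
      where
      small : w (+ j ℤ.- + r) ≈[ N ] 0ₛ
      small = θ-term-vanish s x y (+ j ℤ.- + r) (≰⇒> far)
    ... | yes near = ≈[]-trans (≋⇒≈[] (solve 3 (λ p g v → p :* (g :* v) := g :* p :* v) ≋-refl P (gauss j l) v))
        (≈[]-trans (⊗-cong[] (gauss-limit (+-cancelʳ-≤ N N j N≤j) (+-cancelʳ-≤ N N l N≤l)) ≈[]-refl) (≋⇒≈[] (R.*-identityˡ v)))
      where
      v = w (+ j ℤ.- + r)
      lemma₁ : ∀ j r → r ≡ j ℤ.- (j ℤ.- r)
      lemma₁ = solve-∀ℤ
      lemma₂ : ∀ j l r → j ℤ.+ l ≡ r ℤ.+ r → l ℤ.+ (j ℤ.- r) ≡ r
      lemma₂ j l r eq = trans (lemma₃ j l r) (trans (cong (ℤ._- r) eq) (lemma₄ r))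
        where
        lemma₃ : ∀ j l r → l ℤ.+ (j ℤ.- r) ≡ j ℤ.+ l ℤ.- r
        lemma₃ = solve-∀ℤ
        lemma₄ : ∀ r → r ℤ.+ r ℤ.- r ≡ r
        lemma₄ = solve-∀ℤ
      N≤j : r ≤ j + N
      N≤j = ≤-trans (≤-trans (≤-reflexive (cong ∣_∣ (lemma₁ (+ j) (+ r)))) (ℤ.∣i-j∣≤∣i∣+∣j∣ (+ j) (+ j ℤ.- + r)))
                    (+-monoʳ-≤ j near)
      N≤l : r ≤ l + N
      N≤l = ≤-trans (≤-trans (≤-reflexive (cong ∣_∣ (sym (lemma₂ (+ j) (+ l) (+ r) (cong +_ j+l≡)))))
                             (ℤ.∣i+j∣≤∣i∣+∣j∣ (+ l) (+ j ℤ.- + r)))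
                    (+-monoʳ-≤ l near)

  triple-product′ : HasSum w (poch s x m ⊗ poch s y m ⊗ P)
  triple-product′ = hasSum λ N → let r = N + N in
      applyUpTo (λ j → + j ℤ.- + r) (suc (r + r))
    , Unique.applyUpTo⁺₁ (λ j → + j ℤ.- + r) (suc (r + r)) (λ i<j _ eq → <⇒≢ i<j (ℤ.+-injective (+ℤ-cancelʳ (ℤ.- + r) _ _ eq)))
    , cover N
    , ≈[]-trans (triple-product-approx N) (≋⇒≈[] (≋-sym (∑-applyUpTo w (λ j → + j ℤ.- + r) (r + r))))
    where
    index : ∀ r k → ∣ k ∣ ≤ r → ∃ λ j → j < suc (r + r) × + j ℤ.- + r ≡ k
    index r (+ n) n≤r = n + r , s≤s (+-monoˡ-≤ r n≤r) , lemma (+ n) (+ r)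
      where
      lemma : ∀ n r → n ℤ.+ r ℤ.- r ≡ n
      lemma = solve-∀ℤ
    index r -[1+ n ] n<r with m≤n⇒∃[o]m+o≡n n<r
    ... | o , refl = o , s≤s (≤-trans (m≤n+m o (suc n)) (m≤m+n _ _)) , lemma (+ n) (+ o)
      where
      lemma : ∀ n o → o ℤ.- (1ℤ ℤ.+ n ℤ.+ o) ≡ ℤ.- (1ℤ ℤ.+ n)
      lemma = solve-∀ℤ
    cover : ∀ N k → k ∈ applyUpTo (λ j → + j ℤ.- + (N + N)) (suc (N + N + (N + N))) ⊎ w k ≈[ N ] 0ₛ
    cover N k with ∣ k ∣ ≤? N
    ... | no far   = inj₂ (θ-term-vanish s x y k (≰⇒> far))
    ... | yes near with index (N + N) k (≤-trans near (m≤m+n N N))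
    ...   | j , j< , refl = inj₁ (∈-applyUpTo⁺ (λ j → + j ℤ.- + (N + N)) j<)

triple-product : ∀ {s} → Sign s → ∀ x y .{{_ : NonZero (x + y)}} → HasSum (θ-term s x y) (θ s x y)
triple-product {s} sg x y with x + y in eq
... | suc m-1 = triple-product′ sg x y m-1 eq

-- Re-indexing theta series and their products.

data Parity : ℤ → Set where
  even : ∀ h → Parity (h ℤ.+ h)
  odd  : ∀ h → Parity (1ℤ ℤ.+ (h ℤ.+ h))

parity-suc : ∀ {k} → Parity k → Parity (1ℤ ℤ.+ k)
parity-suc (even h) = odd h
parity-suc (odd h)  = subst Parity (lemma h) (even (1ℤ ℤ.+ h))
  where
  lemma : ∀ h → 1ℤ ℤ.+ h ℤ.+ (1ℤ ℤ.+ h) ≡ 1ℤ ℤ.+ (1ℤ ℤ.+ (h ℤ.+ h))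
  lemma = solve-∀ℤ

parity-neg : ∀ {k} → Parity k → Parity (ℤ.- k)
parity-neg (even h) = subst Parity (lemma h) (even (ℤ.- h))
  where
  lemma : ∀ h → ℤ.- h ℤ.+ ℤ.- h ≡ ℤ.- (h ℤ.+ h)
  lemma = solve-∀ℤ
parity-neg (odd h) = subst Parity (lemma h) (odd (ℤ.- (1ℤ ℤ.+ h)))
  where
  lemma : ∀ h → 1ℤ ℤ.+ (ℤ.- (1ℤ ℤ.+ h) ℤ.+ ℤ.- (1ℤ ℤ.+ h)) ≡ ℤ.- (1ℤ ℤ.+ (h ℤ.+ h))
  lemma = solve-∀ℤ

parity-pos : ∀ n → Parity (+ n)
parity-pos zero    = even 0ℤ
parity-pos (suc n) = parity-suc (parity-pos n)

parityℤ : ∀ k → Parity k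
parityℤ (+ n)    = parity-pos n
parityℤ -[1+ n ] = parity-neg (parity-pos (suc n))

double-injective : ∀ {h h′} → h ℤ.+ h ≡ h′ ℤ.+ h′ → h ≡ h′
double-injective {h} {h′} eq = ℤ.*-cancelˡ-≡ (+ 2) h h′ (trans (lemma h) (trans eq (sym (lemma h′))))
  where
  lemma : ∀ h → + 2 ℤ.* h ≡ h ℤ.+ h
  lemma = solve-∀ℤ

even≢oddℤ : ∀ {h h′} → h ℤ.+ h ≡ 1ℤ ℤ.+ (h′ ℤ.+ h′) → ⊥
even≢oddℤ {h} {h′} eq = even≢odd ∣ h ℤ.- h′ ∣ 0 (trans (sym (ℤ.abs-* (+ 2) (h ℤ.- h′))) (cong ∣_∣ (trans (lemma h h′)
    (trans (cong (ℤ._- (h′ ℤ.+ h′)) eq) (lemma₂ h′)))))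
  where
  lemma : ∀ h h′ → + 2 ℤ.* (h ℤ.- h′) ≡ h ℤ.+ h ℤ.- (h′ ℤ.+ h′)
  lemma = solve-∀ℤ
  lemma₂ : ∀ h′ → 1ℤ ℤ.+ (h′ ℤ.+ h′) ℤ.- (h′ ℤ.+ h′) ≡ 1ℤ
  lemma₂ = solve-∀ℤ

monomial : ℤ → ℕ → Series
monomial c e = const c ⊗ q^ e

monomial-cong : ∀ {c d e f} → c ≡ d → e ≡ f → monomial c e ≋ monomial d f
monomial-cong refl refl = ≋-refl

monomial-⊗ : ∀ c d e f → monomial c e ⊗ monomial d f ≋ monomial (c ℤ.* d) (e + f)
monomial-⊗ c d e f = ≋-trans
  (solve 4 (λ c d x y → c :* x :* (d :* y) := c :* d :* (x :* y)) ≋-refl (const c) (const d) (q^ e) (q^ f))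
  (⊗-cong (≋-sym (const-* c d)) (≋-sym (q^-+ e f)))

1^ℤ : ∀ k → 1ℤ ^ℤ k ≡ 1ℤ
1^ℤ k = ℤ.^-zeroˡ ∣ k ∣

^ℤ-even : ∀ {s} → Sign s → ∀ k → s ^ℤ (k ℤ.+ k) ≡ 1ℤ
^ℤ-even sg k = trans (^ℤ-+ sg k k) (square sg ∣ k ∣)
  where
  square : ∀ {s} → Sign s → ∀ n → s ℤ.^ n ℤ.* s ℤ.^ n ≡ 1ℤ
  square plus  n = cong (λ x → x ℤ.* x) (ℤ.^-zeroˡ n)
  square minus n = trans (sym (ℤ.^-distribˡ-+-* -1ℤ n n)) (trans (cong (λ j → -1ℤ ℤ.^ j) (sym (cong (λ z → n + z) (+-identityʳ n))))
    (trans (sym (ℤ.^-*-assoc -1ℤ 2 n)) (ℤ.^-zeroˡ n)))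

^ℤ-odd : ∀ {s} → Sign s → ∀ k → s ^ℤ (1ℤ ℤ.+ (k ℤ.+ k)) ≡ s
^ℤ-odd {s} sg k = trans (^ℤ-suc sg (k ℤ.+ k)) (trans (cong (s ℤ.*_) (^ℤ-even sg k)) (ℤ.*-identityʳ s))

θ-sym : ∀ s x y → θ s x y ≋ θ s y x
θ-sym s x y = ≋-trans (solve 3 (λ a b c → a :* b :* c := b :* a :* c) ≋-refl (poch s x (x + y)) (poch s y (x + y)) (poch -1ℤ (x + y) (x + y)))
  (≋-reflexive λ n → cong (λ m → (poch s y m ⊗ poch s x m ⊗ poch -1ℤ m m) n) (+-comm x y))

-- Even and odd summation indices are separated. The sign is 1 on the even ones and s on the odd
-- ones. Writing the second parameter as x + g keeps g, the difference of the two, a natural number.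
θ-split : ∀ {s} → Sign s → ∀ x g → let x₂ = x + x ; x₄ = x₂ + x₂ ; g₃ = g + g + g in
  .{{_ : NonZero (x + (x + g))}} .{{_ : NonZero (x₄ + g + (x₄ + g₃))}} .{{_ : NonZero (x₄ + x₄ + g₃ + g)}} →
  θ s x (x + g) ≋ θ 1ℤ (x₄ + g) (x₄ + g₃) ⊕ monomial s x ⊗ θ 1ℤ (x₄ + x₄ + g₃) g
θ-split {s} sg x g = HasSum-unique (triple-product sg x (x + g))
  (HasSum-embed f f-injective cover (HasSum-cong term
    (HasSum-⊎ (triple-product plus (x₄ + g) (x₄ + g₃)) (HasSum-scale (monomial s x) (triple-product plus (x₄ + x₄ + g₃) g)))))
  where
  x₂ = x + x
  x₄ = x₂ + x₂
  g₃ = g + g + g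
  f : ℤ ⊎ ℤ → ℤ
  f (inj₁ k) = k ℤ.+ k
  f (inj₂ k) = 1ℤ ℤ.+ (k ℤ.+ k)
  f-injective : ∀ {k l} → f k ≡ f l → k ≡ l
  f-injective {inj₁ k} {inj₁ l} eq = cong inj₁ (double-injective eq)
  f-injective {inj₁ k} {inj₂ l} eq = ⊥-elim (even≢oddℤ {k} {l} eq)
  f-injective {inj₂ k} {inj₁ l} eq = ⊥-elim (even≢oddℤ {l} {k} (sym eq))
  f-injective {inj₂ k} {inj₂ l} eq = cong inj₂ (double-injective (+ℤ-cancelˡ 1ℤ _ _ eq))
  cover : ∀ j → (∃ λ i → f i ≡ j) ⊎ θ-term s x (x + g) j ≋ 0ₛ
  cover j with parityℤ j
  ... | even h = inj₁ (inj₁ h , refl)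
  ... | odd h  = inj₁ (inj₂ h , refl)
  lemma₁ : ∀ x g k →
    (x ℤ.+ x ℤ.+ (x ℤ.+ x) ℤ.+ g ℤ.+ (x ℤ.+ x ℤ.+ (x ℤ.+ x) ℤ.+ (g ℤ.+ g ℤ.+ g))) ℤ.* (k ℤ.* k)
      ℤ.+ (x ℤ.+ x ℤ.+ (x ℤ.+ x) ℤ.+ g ℤ.- (x ℤ.+ x ℤ.+ (x ℤ.+ x) ℤ.+ (g ℤ.+ g ℤ.+ g))) ℤ.* k ≡
    (x ℤ.+ (x ℤ.+ g)) ℤ.* ((k ℤ.+ k) ℤ.* (k ℤ.+ k)) ℤ.+ (x ℤ.- (x ℤ.+ g)) ℤ.* (k ℤ.+ k)
  lemma₁ = solve-∀ℤ
  lemma₂ : ∀ x g k → + 2 ℤ.* x ℤ.+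
    ((x ℤ.+ x ℤ.+ (x ℤ.+ x) ℤ.+ (x ℤ.+ x ℤ.+ (x ℤ.+ x)) ℤ.+ (g ℤ.+ g ℤ.+ g) ℤ.+ g) ℤ.* (k ℤ.* k)
      ℤ.+ (x ℤ.+ x ℤ.+ (x ℤ.+ x) ℤ.+ (x ℤ.+ x ℤ.+ (x ℤ.+ x)) ℤ.+ (g ℤ.+ g ℤ.+ g) ℤ.- g) ℤ.* k) ≡
    (x ℤ.+ (x ℤ.+ g)) ℤ.* ((1ℤ ℤ.+ (k ℤ.+ k)) ℤ.* (1ℤ ℤ.+ (k ℤ.+ k))) ℤ.+ (x ℤ.- (x ℤ.+ g)) ℤ.* (1ℤ ℤ.+ (k ℤ.+ k))
  lemma₂ = solve-∀ℤ
  exponent₁ : ∀ k → exponent (x₄ + g) (x₄ + g₃) k ≡ exponent x (x + g) (k ℤ.+ k)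
  exponent₁ k = halve (trans (double-exponent (x₄ + g) (x₄ + g₃) k)
    (trans (lemma₁ (+ x) (+ g) k) (sym (double-exponent x (x + g) (k ℤ.+ k)))))
  exponent₂ : ∀ k → x + exponent (x₄ + x₄ + g₃) g k ≡ exponent x (x + g) (1ℤ ℤ.+ (k ℤ.+ k))
  exponent₂ k = halve (trans (ℤ.*-distribˡ-+ (+ 2) (+ x) (+ exponent (x₄ + x₄ + g₃) g k))
    (trans (cong (ℤ._+_ (+ 2 ℤ.* + x)) (double-exponent (x₄ + x₄ + g₃) g k))
      (trans (lemma₂ (+ x) (+ g) k) (sym (double-exponent x (x + g) (1ℤ ℤ.+ (k ℤ.+ k)))))))
  term : ∀ i → [ θ-term 1ℤ (x₄ + g) (x₄ + g₃) , (λ k → monomial s x ⊗ θ-term 1ℤ (x₄ + x₄ + g₃) g k) ]′ i ≋ θ-term s x (x + g) (f i)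
  term (inj₁ k) = monomial-cong (trans (1^ℤ k) (sym (^ℤ-even sg k))) (exponent₁ k)
  term (inj₂ k) = ≋-trans (monomial-⊗ s (1ℤ ^ℤ k) x _)
    (monomial-cong (trans (cong (s ℤ.*_) (1^ℤ k)) (trans (ℤ.*-identityʳ s) (sym (^ℤ-odd sg k)))) (exponent₂ k))

double-sum : ∀ x y k x′ y′ l →
  + 2 ℤ.* + (exponent x y k + exponent x′ y′ l) ≡
  (+ x ℤ.+ + y) ℤ.* (k ℤ.* k) ℤ.+ (+ x ℤ.- + y) ℤ.* k ℤ.+ ((+ x′ ℤ.+ + y′) ℤ.* (l ℤ.* l) ℤ.+ (+ x′ ℤ.- + y′) ℤ.* l)
double-sum x y k x′ y′ l = trans (ℤ.*-distribˡ-+ (+ 2) (+ exponent x y k) (+ exponent x′ y′ l))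
  (cong₂ ℤ._+_ (double-exponent x y k) (double-exponent x′ y′ l))

module Rotation where

  -- The two summands parametrise the pairs with even and with odd coordinate sum.
  rotate : (ℤ × ℤ) ⊎ (ℤ × ℤ) → ℤ × ℤ
  rotate (inj₁ (i , j)) = i ℤ.+ j , i ℤ.- j
  rotate (inj₂ (i , j)) = 1ℤ ℤ.+ (i ℤ.+ j) , i ℤ.- j

  private
    sum≡ : ∀ i j → i ℤ.+ j ℤ.+ (i ℤ.- j) ≡ i ℤ.+ i
    sum≡ = solve-∀ℤ

    sum≡′ : ∀ i j → 1ℤ ℤ.+ (i ℤ.+ j) ℤ.+ (i ℤ.- j) ≡ 1ℤ ℤ.+ (i ℤ.+ i)
    sum≡′ = solve-∀ℤ

  rotate-injective : ∀ {p p′} → rotate p ≡ rotate p′ → p ≡ p′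
  rotate-injective {inj₁ (i , j)} {inj₁ (i′ , j′)} eq with ,-injective eq
  ... | e₁ , e₂ with double-injective {i} {i′} (trans (sym (sum≡ i j)) (trans (cong₂ ℤ._+_ e₁ e₂) (sum≡ i′ j′)))
  ... | refl with +ℤ-cancelˡ i _ _ e₁
  ... | refl = refl
  rotate-injective {inj₁ (i , j)} {inj₂ (i′ , j′)} eq with ,-injective eq
  ... | e₁ , e₂ = ⊥-elim (even≢oddℤ {i} {i′} (trans (sym (sum≡ i j)) (trans (cong₂ ℤ._+_ e₁ e₂) (sum≡′ i′ j′))))
  rotate-injective {inj₂ (i , j)} {inj₁ (i′ , j′)} eq with ,-injective eq
  ... | e₁ , e₂ = ⊥-elim (even≢oddℤ {i′} {i} (trans (sym (sum≡ i′ j′)) (trans (sym (cong₂ ℤ._+_ e₁ e₂)) (sum≡′ i j))))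
  rotate-injective {inj₂ (i , j)} {inj₂ (i′ , j′)} eq with ,-injective eq
  ... | e₁ , e₂ with double-injective {i} {i′} (+ℤ-cancelˡ 1ℤ _ _ (trans (sym (sum≡′ i j)) (trans (cong₂ ℤ._+_ e₁ e₂) (sum≡′ i′ j′))))
  ... | refl with +ℤ-cancelˡ i _ _ (+ℤ-cancelˡ 1ℤ _ _ e₁)
  ... | refl = refl

  rotate-surjective : ∀ p → ∃ λ r → rotate r ≡ p
  rotate-surjective (m , n) = go (parityℤ (m ℤ.+ n)) refl
    where
    go : ∀ {k} → Parity k → k ≡ m ℤ.+ n → ∃ λ r → rotate r ≡ (m , n)
    go (even h) eq = inj₁ (h , m ℤ.- h) , cong₂ _,_ (lemma₁ h m) (trans (lemma₂ h m) (trans (cong (ℤ._- m) eq) (lemma₃ m n)))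
      where
      lemma₁ : ∀ h m → h ℤ.+ (m ℤ.- h) ≡ m
      lemma₁ = solve-∀ℤ
      lemma₂ : ∀ h m → h ℤ.- (m ℤ.- h) ≡ h ℤ.+ h ℤ.- m
      lemma₂ = solve-∀ℤ
      lemma₃ : ∀ m n → m ℤ.+ n ℤ.- m ≡ n
      lemma₃ = solve-∀ℤ
    go (odd h)  eq = inj₂ (h , m ℤ.- 1ℤ ℤ.- h) , cong₂ _,_ (lemma₁ h m) (trans (lemma₂ h m) (trans (cong (ℤ._- m) eq) (lemma₃ m n)))
      where
      lemma₁ : ∀ h m → 1ℤ ℤ.+ (h ℤ.+ (m ℤ.- 1ℤ ℤ.- h)) ≡ m
      lemma₁ = solve-∀ℤ
      lemma₂ : ∀ h m → h ℤ.- (m ℤ.- 1ℤ ℤ.- h) ≡ 1ℤ ℤ.+ (h ℤ.+ h) ℤ.- m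
      lemma₂ = solve-∀ℤ
      lemma₃ : ∀ m n → m ℤ.+ n ℤ.- m ≡ n
      lemma₃ = solve-∀ℤ

open Rotation

-- Both factors have base 2a + g + h, so the quadratic part of the exponent is a multiple of m² +
-- n², which `rotate` diagonalises again. The two parity classes of m + n yield the two products,
-- and the sign s^(m+n) is constant on each.
θ-product : ∀ {s} → Sign s → ∀ a-1 g h → let a = suc a-1 in
  θ s a (a + g + h) ⊗ θ s (a + h) (a + g) ≋
  θ 1ℤ (a + a + h) (a + a + g + g + h) ⊗ θ 1ℤ (a + a + g) (a + a + g + h + h) ⊕
  monomial s a ⊗ (θ 1ℤ (a + a + a + a + g + h + h) g ⊗ θ 1ℤ (a + a + a + a + g + g + h) h)
θ-product {s} sg a-1 g h = HasSum-unique
  (HasSum-⊗ (triple-product sg a (a + g + h)) (triple-product sg (a + h) (a + g)))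
  (HasSum-embed rotate rotate-injective (inj₁ ∘ rotate-surjective) (HasSum-cong term
    (HasSum-⊎ (HasSum-⊗ (triple-product plus x₁ y₁) (triple-product plus x₂ y₂))
              (HasSum-scale (monomial s a) (HasSum-⊗ (triple-product plus x₃ g) (triple-product plus x₄ h))))))
  where
  a = suc a-1
  x₁ = a + a + h
  y₁ = a + a + g + g + h
  x₂ = a + a + g
  y₂ = a + a + g + h + h
  x₃ = a + a + a + a + g + h + h
  x₄ = a + a + a + a + g + g + h
  t : ℤ × ℤ → Series
  t (m , n) = θ-term s a (a + g + h) m ⊗ θ-term s (a + h) (a + g) n
  lemma₁ : ∀ a g h i j →
    (a ℤ.+ a ℤ.+ h ℤ.+ (a ℤ.+ a ℤ.+ g ℤ.+ g ℤ.+ h)) ℤ.* (i ℤ.* i) ℤ.+ (a ℤ.+ a ℤ.+ h ℤ.- (a ℤ.+ a ℤ.+ g ℤ.+ g ℤ.+ h)) ℤ.* i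
    ℤ.+ ((a ℤ.+ a ℤ.+ g ℤ.+ (a ℤ.+ a ℤ.+ g ℤ.+ h ℤ.+ h)) ℤ.* (j ℤ.* j) ℤ.+ (a ℤ.+ a ℤ.+ g ℤ.- (a ℤ.+ a ℤ.+ g ℤ.+ h ℤ.+ h)) ℤ.* j) ≡
    (a ℤ.+ (a ℤ.+ g ℤ.+ h)) ℤ.* ((i ℤ.+ j) ℤ.* (i ℤ.+ j)) ℤ.+ (a ℤ.- (a ℤ.+ g ℤ.+ h)) ℤ.* (i ℤ.+ j)
    ℤ.+ ((a ℤ.+ h ℤ.+ (a ℤ.+ g)) ℤ.* ((i ℤ.- j) ℤ.* (i ℤ.- j)) ℤ.+ (a ℤ.+ h ℤ.- (a ℤ.+ g)) ℤ.* (i ℤ.- j))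
  lemma₁ = solve-∀ℤ
  lemma₂ : ∀ a g h i j → + 2 ℤ.* a ℤ.+ (
    (a ℤ.+ a ℤ.+ a ℤ.+ a ℤ.+ g ℤ.+ h ℤ.+ h ℤ.+ g) ℤ.* (i ℤ.* i) ℤ.+ (a ℤ.+ a ℤ.+ a ℤ.+ a ℤ.+ g ℤ.+ h ℤ.+ h ℤ.- g) ℤ.* i
    ℤ.+ ((a ℤ.+ a ℤ.+ a ℤ.+ a ℤ.+ g ℤ.+ g ℤ.+ h ℤ.+ h) ℤ.* (j ℤ.* j) ℤ.+ (a ℤ.+ a ℤ.+ a ℤ.+ a ℤ.+ g ℤ.+ g ℤ.+ h ℤ.- h) ℤ.* j)) ≡
    (a ℤ.+ (a ℤ.+ g ℤ.+ h)) ℤ.* ((1ℤ ℤ.+ (i ℤ.+ j)) ℤ.* (1ℤ ℤ.+ (i ℤ.+ j))) ℤ.+ (a ℤ.- (a ℤ.+ g ℤ.+ h)) ℤ.* (1ℤ ℤ.+ (i ℤ.+ j))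
    ℤ.+ ((a ℤ.+ h ℤ.+ (a ℤ.+ g)) ℤ.* ((i ℤ.- j) ℤ.* (i ℤ.- j)) ℤ.+ (a ℤ.+ h ℤ.- (a ℤ.+ g)) ℤ.* (i ℤ.- j))
  lemma₂ = solve-∀ℤ
  lemma₃ : ∀ i j → i ℤ.+ j ℤ.+ (i ℤ.- j) ≡ i ℤ.+ i
  lemma₃ = solve-∀ℤ
  lemma₄ : ∀ i j → 1ℤ ℤ.+ (i ℤ.+ j) ℤ.+ (i ℤ.- j) ≡ 1ℤ ℤ.+ (i ℤ.+ i)
  lemma₄ = solve-∀ℤ
  exponent₁ : ∀ i j → exponent x₁ y₁ i + exponent x₂ y₂ j ≡
                      exponent a (a + g + h) (i ℤ.+ j) + exponent (a + h) (a + g) (i ℤ.- j)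
  exponent₁ i j = halve (trans (double-sum x₁ y₁ i x₂ y₂ j) (trans (lemma₁ (+ a) (+ g) (+ h) i j)
    (sym (double-sum a (a + g + h) (i ℤ.+ j) (a + h) (a + g) (i ℤ.- j)))))
  exponent₂ : ∀ i j → a + (exponent x₃ g i + exponent x₄ h j) ≡
                      exponent a (a + g + h) (1ℤ ℤ.+ (i ℤ.+ j)) + exponent (a + h) (a + g) (i ℤ.- j)
  exponent₂ i j = halve (trans (ℤ.*-distribˡ-+ (+ 2) (+ a) (+ (exponent x₃ g i + exponent x₄ h j)))
    (trans (cong (ℤ._+_ (+ 2 ℤ.* + a)) (double-sum x₃ g i x₄ h j)) (trans (lemma₂ (+ a) (+ g) (+ h) i j)
      (sym (double-sum a (a + g + h) (1ℤ ℤ.+ (i ℤ.+ j)) (a + h) (a + g) (i ℤ.- j))))))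
  ones : ∀ i j → 1ℤ ^ℤ i ℤ.* 1ℤ ^ℤ j ≡ 1ℤ
  ones i j = cong₂ ℤ._*_ (1^ℤ i) (1^ℤ j)
  term : ∀ p → [ (λ (i , j) → θ-term 1ℤ x₁ y₁ i ⊗ θ-term 1ℤ x₂ y₂ j)
               , (λ (i , j) → monomial s a ⊗ (θ-term 1ℤ x₃ g i ⊗ θ-term 1ℤ x₄ h j)) ]′ p ≋ t (rotate p)
  term (inj₁ (i , j)) = ≋-trans (monomial-⊗ (1ℤ ^ℤ i) (1ℤ ^ℤ j) (exponent x₁ y₁ i) (exponent x₂ y₂ j)) (≋-trans
    (monomial-cong (trans (ones i j) (trans (sym (^ℤ-even sg i)) (trans (cong (s ^ℤ_) (sym (lemma₃ i j))) (^ℤ-+ sg (i ℤ.+ j) (i ℤ.- j))))) (exponent₁ i j))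
    (≋-sym (monomial-⊗ (s ^ℤ (i ℤ.+ j)) (s ^ℤ (i ℤ.- j)) (exponent a (a + g + h) (i ℤ.+ j)) (exponent (a + h) (a + g) (i ℤ.- j)))))
  term (inj₂ (i , j)) = ≋-trans (⊗-cong {monomial s a} ≋-refl (monomial-⊗ (1ℤ ^ℤ i) (1ℤ ^ℤ j) (exponent x₃ g i) (exponent x₄ h j)))
    (≋-trans (monomial-⊗ s (1ℤ ^ℤ i ℤ.* 1ℤ ^ℤ j) a (exponent x₃ g i + exponent x₄ h j)) (≋-trans
    (monomial-cong (trans (cong (s ℤ.*_) (ones i j)) (trans (ℤ.*-identityʳ s) (trans (sym (^ℤ-odd sg i))
      (trans (cong (s ^ℤ_) (sym (lemma₄ i j))) (^ℤ-+ sg (1ℤ ℤ.+ (i ℤ.+ j)) (i ℤ.- j)))))) (exponent₂ i j))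
    (≋-sym (monomial-⊗ (s ^ℤ (1ℤ ℤ.+ (i ℤ.+ j))) (s ^ℤ (i ℤ.- j)) (exponent a (a + g + h) (1ℤ ℤ.+ (i ℤ.+ j))) (exponent (a + h) (a + g) (i ℤ.- j))))))

-- Multiplication by a cube root of unity in ℤ[ω] matches the two ways of
-- writing the elements of odd norm.
module Eisenstein where

  -- Here 6 form + 1 = (3n - 1)² + 3 (2k - n)², the norm of (3n - 1) + (2k - n)√-3. Hence the form
  -- is never negative and the absolute value in `term` changes nothing.
  form : ℤ → ℤ → ℤ
  form n k = + 2 ℤ.* (k ℤ.* k) ℤ.- + 2 ℤ.* (k ℤ.* n) ℤ.+ + 2 ℤ.* (n ℤ.* n) ℤ.- n

  term : ℤ × ℤ → Series
  term (n , k) = monomial 1ℤ ∣ form n k ∣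

  term-from : ∀ d x y k x′ y′ l n m →
    + 2 ℤ.* + d ℤ.+ ((+ x ℤ.+ + y) ℤ.* (k ℤ.* k) ℤ.+ (+ x ℤ.- + y) ℤ.* k
      ℤ.+ ((+ x′ ℤ.+ + y′) ℤ.* (l ℤ.* l) ℤ.+ (+ x′ ℤ.- + y′) ℤ.* l)) ≡ + 2 ℤ.* form n m →
    monomial 1ℤ d ⊗ (θ-term 1ℤ x y k ⊗ θ-term 1ℤ x′ y′ l) ≋ term (n , m)
  term-from d x y k x′ y′ l n m eq = ≋-trans
    (⊗-cong {monomial 1ℤ d} ≋-refl (monomial-⊗ (1ℤ ^ℤ k) (1ℤ ^ℤ l) (exponent x y k) (exponent x′ y′ l)))
    (≋-trans (monomial-⊗ 1ℤ (1ℤ ^ℤ k ℤ.* 1ℤ ^ℤ l) d e)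
      (monomial-cong (cong (1ℤ ℤ.*_) (cong₂ ℤ._*_ (1^ℤ k) (1^ℤ l)))
        (cong ∣_∣ (ℤ.*-cancelˡ-≡ (+ 2) (+ (d + e)) (form n m)
          (trans (ℤ.*-distribˡ-+ (+ 2) (+ d) (+ e)) (trans (cong (ℤ._+_ (+ 2 ℤ.* + d)) (double-sum x y k x′ y′ l)) eq))))))
    where e = exponent x y k + exponent x′ y′ l

  -- The first summand covers the elements whose rational part 3n - 1 is odd, the second those where
  -- it is even.
  halves : (ℤ × ℤ) ⊎ (ℤ × ℤ) → ℤ × ℤ
  halves (inj₁ (m , n)) = n ℤ.+ n , m ℤ.+ n
  halves (inj₂ (m , n)) = 1ℤ ℤ.+ (n ℤ.+ n) , 1ℤ ℤ.+ (m ℤ.+ n)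

  halves-injective : ∀ {p p′} → halves p ≡ halves p′ → p ≡ p′
  halves-injective {inj₁ (m , n)} {inj₁ (m′ , n′)} eq with ,-injective eq
  ... | e₁ , e₂ with double-injective {n} {n′} e₁
  ... | refl with +ℤ-cancelʳ n m m′ e₂
  ... | refl = refl
  halves-injective {inj₁ (m , n)} {inj₂ (m′ , n′)} eq = ⊥-elim (even≢oddℤ {n} {n′} (proj₁ (,-injective eq)))
  halves-injective {inj₂ (m , n)} {inj₁ (m′ , n′)} eq = ⊥-elim (even≢oddℤ {n′} {n} (sym (proj₁ (,-injective eq))))
  halves-injective {inj₂ (m , n)} {inj₂ (m′ , n′)} eq with ,-injective eq
  ... | e₁ , e₂ with double-injective {n} {n′} (+ℤ-cancelˡ 1ℤ _ _ e₁)
  ... | refl with +ℤ-cancelʳ n m m′ (+ℤ-cancelˡ 1ℤ _ _ e₂)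
  ... | refl = refl

  halves-surjective : ∀ p → ∃ λ r → halves r ≡ p
  halves-surjective (n , k) with parityℤ n
  ... | even h = inj₁ (k ℤ.- h , h) , cong (h ℤ.+ h ,_) (lemma k h)
    where
    lemma : ∀ k h → k ℤ.- h ℤ.+ h ≡ k
    lemma = solve-∀ℤ
  ... | odd h  = inj₂ (k ℤ.- 1ℤ ℤ.- h , h) , cong (1ℤ ℤ.+ (h ℤ.+ h) ,_) (lemma k h)
    where
    lemma : ∀ k h → 1ℤ ℤ.+ (k ℤ.- 1ℤ ℤ.- h ℤ.+ h) ≡ k
    lemma = solve-∀ℤ

  -- The term (i , j) of θ(1,3) θ(1,2) belongs to (6j - 1 + (4i - 1)√-3)/2. For odd j it is
  -- multiplied by (1 + √-3)/2, for even j by (1 - √-3)/2 and then conjugated. In each case the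
  -- other unit would not lead into ℤ[√-3].
  turn : ∀ {j} → Parity j → ℤ → ℤ
  turn (even h) i = i ℤ.+ h
  turn (odd h)  i = h ℤ.+ 1ℤ ℤ.- i

  turn-injective : ∀ {j} (p : Parity j) {i i′} → turn p i ≡ turn p i′ → i ≡ i′
  turn-injective (even h) {i} {i′} eq = +ℤ-cancelʳ h i i′ eq
  turn-injective (odd h)  {i} {i′} eq = ℤ.neg-injective (+ℤ-cancelˡ (h ℤ.+ 1ℤ) (ℤ.- i) (ℤ.- i′) eq)

  turn-surjective : ∀ {j} (p : Parity j) n → ∃ λ i → turn p i ≡ n
  turn-surjective (even h) n = n ℤ.- h , lemma n h
    where
    lemma : ∀ n h → n ℤ.- h ℤ.+ h ≡ n
    lemma = solve-∀ℤ
  turn-surjective (odd h) n = h ℤ.+ 1ℤ ℤ.- n , lemma n h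
    where
    lemma : ∀ n h → h ℤ.+ 1ℤ ℤ.- (h ℤ.+ 1ℤ ℤ.- n) ≡ n
    lemma = solve-∀ℤ

  rotate₆ : ℤ × ℤ → ℤ × ℤ
  rotate₆ (i , j) = turn (parityℤ j) i , j

  rotate₆-injective : ∀ {p p′} → rotate₆ p ≡ rotate₆ p′ → p ≡ p′
  rotate₆-injective {i , j} {i′ , j′} eq with proj₂ (,-injective eq)
  ... | refl = cong (_, j) (turn-injective (parityℤ j) (proj₁ (,-injective eq)))

  rotate₆-surjective : ∀ p → ∃ λ r → rotate₆ r ≡ p
  rotate₆-surjective (n , j) = let i , eq = turn-surjective (parityℤ j) n in (i , j) , cong (_, j) eq

  identity : θ 1ℤ 2 2 ⊗ θ 1ℤ 4 8 ⊕ monomial 1ℤ 1 ⊗ (θ 1ℤ 4 0 ⊗ θ 1ℤ 10 2) ≋ θ 1ℤ 1 3 ⊗ θ 1ℤ 1 2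
  identity = HasSum-unique {t = term}
    (HasSum-embed halves halves-injective (inj₁ ∘ halves-surjective) (HasSum-cong halves-term
      (HasSum-⊎ (HasSum-⊗ (triple-product plus 2 2) (triple-product plus 4 8))
                (HasSum-scale (monomial 1ℤ 1) (HasSum-⊗ (triple-product plus 4 0) (triple-product plus 10 2))))))
    (HasSum-embed rotate₆ rotate₆-injective (inj₁ ∘ rotate₆-surjective) (HasSum-cong (λ (i , j) → rotate₆-term i j (parityℤ j))
      (HasSum-⊗ (triple-product plus 1 3) (triple-product plus 1 2))))
    where
    lemma₁ : ∀ m n → + 2 ℤ.* 0ℤ ℤ.+ (+ 4 ℤ.* (m ℤ.* m) ℤ.+ 0ℤ ℤ.* m ℤ.+ (+ 12 ℤ.* (n ℤ.* n) ℤ.+ -[1+ 3 ] ℤ.* n)) ≡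
      + 2 ℤ.* (+ 2 ℤ.* ((m ℤ.+ n) ℤ.* (m ℤ.+ n)) ℤ.- + 2 ℤ.* ((m ℤ.+ n) ℤ.* (n ℤ.+ n)) ℤ.+ + 2 ℤ.* ((n ℤ.+ n) ℤ.* (n ℤ.+ n)) ℤ.- (n ℤ.+ n))
    lemma₁ = solve-∀ℤ
    lemma₂ : ∀ m n → + 2 ℤ.* 1ℤ ℤ.+ (+ 4 ℤ.* (m ℤ.* m) ℤ.+ + 4 ℤ.* m ℤ.+ (+ 12 ℤ.* (n ℤ.* n) ℤ.+ + 8 ℤ.* n)) ≡
      + 2 ℤ.* (+ 2 ℤ.* ((1ℤ ℤ.+ (m ℤ.+ n)) ℤ.* (1ℤ ℤ.+ (m ℤ.+ n))) ℤ.- + 2 ℤ.* ((1ℤ ℤ.+ (m ℤ.+ n)) ℤ.* (1ℤ ℤ.+ (n ℤ.+ n)))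
        ℤ.+ + 2 ℤ.* ((1ℤ ℤ.+ (n ℤ.+ n)) ℤ.* (1ℤ ℤ.+ (n ℤ.+ n))) ℤ.- (1ℤ ℤ.+ (n ℤ.+ n)))
    lemma₂ = solve-∀ℤ
    lemma₃ : ∀ i h → + 2 ℤ.* 0ℤ ℤ.+ (+ 4 ℤ.* (i ℤ.* i) ℤ.+ -[1+ 1 ] ℤ.* i ℤ.+ (+ 3 ℤ.* ((h ℤ.+ h) ℤ.* (h ℤ.+ h)) ℤ.+ -1ℤ ℤ.* (h ℤ.+ h))) ≡
      + 2 ℤ.* (+ 2 ℤ.* ((h ℤ.+ h) ℤ.* (h ℤ.+ h)) ℤ.- + 2 ℤ.* ((h ℤ.+ h) ℤ.* (i ℤ.+ h)) ℤ.+ + 2 ℤ.* ((i ℤ.+ h) ℤ.* (i ℤ.+ h)) ℤ.- (i ℤ.+ h))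
    lemma₃ = solve-∀ℤ
    lemma₄ : ∀ i h → + 2 ℤ.* 0ℤ ℤ.+ (+ 4 ℤ.* (i ℤ.* i) ℤ.+ -[1+ 1 ] ℤ.* i
        ℤ.+ (+ 3 ℤ.* ((1ℤ ℤ.+ (h ℤ.+ h)) ℤ.* (1ℤ ℤ.+ (h ℤ.+ h))) ℤ.+ -1ℤ ℤ.* (1ℤ ℤ.+ (h ℤ.+ h)))) ≡
      + 2 ℤ.* (+ 2 ℤ.* ((1ℤ ℤ.+ (h ℤ.+ h)) ℤ.* (1ℤ ℤ.+ (h ℤ.+ h))) ℤ.- + 2 ℤ.* ((1ℤ ℤ.+ (h ℤ.+ h)) ℤ.* (h ℤ.+ 1ℤ ℤ.- i))
        ℤ.+ + 2 ℤ.* ((h ℤ.+ 1ℤ ℤ.- i) ℤ.* (h ℤ.+ 1ℤ ℤ.- i)) ℤ.- (h ℤ.+ 1ℤ ℤ.- i))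
    lemma₄ = solve-∀ℤ
    drop-one : ∀ {S T} → monomial 1ℤ 0 ⊗ S ≋ T → S ≋ T
    drop-one {S} = ≋-trans (solve 1 (λ s → s := con 1ℤ :* con 1ℤ :* s) ≋-refl S)
    halves-term : ∀ p → [ (λ (m , n) → θ-term 1ℤ 2 2 m ⊗ θ-term 1ℤ 4 8 n)
                        , (λ (m , n) → monomial 1ℤ 1 ⊗ (θ-term 1ℤ 4 0 m ⊗ θ-term 1ℤ 10 2 n)) ]′ p ≋ term (halves p)
    halves-term (inj₁ (m , n)) = drop-one (term-from 0 2 2 m 4 8 n (n ℤ.+ n) (m ℤ.+ n) (lemma₁ m n))
    halves-term (inj₂ (m , n)) = term-from 1 4 0 m 10 2 n (1ℤ ℤ.+ (n ℤ.+ n)) (1ℤ ℤ.+ (m ℤ.+ n)) (lemma₂ m n)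
    rotate₆-term : ∀ i j (p : Parity j) → θ-term 1ℤ 1 3 i ⊗ θ-term 1ℤ 1 2 j ≋ term (turn p i , j)
    rotate₆-term i j (even h) = drop-one (term-from 0 1 3 i 1 2 (h ℤ.+ h) (i ℤ.+ h) (h ℤ.+ h) (lemma₃ i h))
    rotate₆-term i j (odd h)  = drop-one (term-from 0 1 3 i 1 2 (1ℤ ℤ.+ (h ℤ.+ h)) (h ℤ.+ 1ℤ ℤ.- i) (1ℤ ℤ.+ (h ℤ.+ h)) (lemma₄ i h))

-- A norm-form theta series and its 2-dissection.

dbl-θ : ∀ s x y .{{_ : NonZero (x + y)}} → dbl (θ s x y) ≋ θ s (x + x) (y + y)
dbl-θ s x y = ≋-trans (dbl-⊗ (poch s x m ⊗ poch s y m) (poch -1ℤ m m))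
  (≋-trans (⊗-cong (≋-trans (dbl-⊗ (poch s x m) (poch s y m)) (⊗-cong (dbl-poch s x m) (dbl-poch s y m))) (dbl-poch -1ℤ m m))
    (≋-reflexive λ n → cong (λ k → (poch s (x + x) k ⊗ poch s (y + y) k ⊗ poch -1ℤ k k) n) (lemma x y)))
  where
  m = x + y
  lemma : ∀ x y → x + y + (x + y) ≡ x + x + (y + y)
  lemma = solve-∀ℕ

-- K s is the theta series of the norm form of ℤ[√-3] on a coset, twisted by
-- a parity character; Y₀(q²) is its part of odd norm.
K : ℤ → Series
K s = θ s 1 1 ⊗ θ s 1 5

Y₀ : Series
Y₀ = θ 1ℤ 1 3 ⊗ θ 1ℤ 1 2

-- Chosen so that q E(q⁴) is the odd part of `K 1ℤ`. As E differs from `K 1ℤ` only by a multiple of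
-- Y₀(q²), the dissection of `K 1ℤ` becomes a fixed-point equation for E.
E : Series
E = K 1ℤ ⊕ const (+ 2) ⊗ dbl Y₀

-- Both theta factors are split by parity. In the terms with an even power of q, s² = 1 removes the
-- sign and `Eisenstein.identity` at q² merges two products into one; the cross terms are q s times
-- a series in q⁴.
K-dissection : ∀ {s} → Sign s → K s ≋ dbl Y₀ ⊕ const s ⊗ q ⊗ dbl (dbl E)
K-dissection {s} sg = begin
  θ s 1 1 ⊗ θ s 1 5
    ≈⟨ ⊗-cong (θ-split sg 1 0) (θ-split sg 1 4) ⟩
  (a ⊕ S ⊗ q ⊗ b) ⊗ (c ⊕ S ⊗ q ⊗ d)
    ≈⟨ solve 6 (λ S q a b c d → (a :+ S :* q :* b) :* (c :+ S :* q :* d) :=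
         a :* c :+ (S :* S) :* (q :* q) :* (b :* d) :+ S :* q :* (a :* d :+ b :* c)) ≋-refl S q a b c d ⟩
  a ⊗ c ⊕ S ⊗ S ⊗ (q ⊗ q) ⊗ (b ⊗ d) ⊕ S ⊗ q ⊗ (a ⊗ d ⊕ b ⊗ c)
    ≈⟨ ⊕-cong (≋-trans (⊕-cong (≋-refl {a ⊗ c}) (⊗-cong (⊗-cong S² (≋-sym (q^-+ 1 1))) (≋-refl {b ⊗ d}))) even-part) (⊗-cong {S ⊗ q} ≋-refl odd-part) ⟩
  dbl Y₀ ⊕ S ⊗ q ⊗ dbl (dbl E) ∎
  where
  open ≋-Reasoning
  S a b c d : Series
  S = const s
  a = θ 1ℤ 4 4
  b = θ 1ℤ 8 0
  c = θ 1ℤ 8 16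
  d = θ 1ℤ 20 4
  S² : S ⊗ S ≋ 1ₛ
  S² = ≋-trans (≋-sym (const-* s s)) (const-cong (sign² sg))
  even-part : a ⊗ c ⊕ 1ₛ ⊗ q^ 2 ⊗ (b ⊗ d) ≋ dbl Y₀
  even-part = begin
    a ⊗ c ⊕ 1ₛ ⊗ q^ 2 ⊗ (b ⊗ d)
      ≈⟨ ⊕-cong (≋-sym (≋-trans (dbl-⊗ (θ 1ℤ 2 2) (θ 1ℤ 4 8)) (⊗-cong (dbl-θ 1ℤ 2 2) (dbl-θ 1ℤ 4 8))))
           (≋-sym (≋-trans (dbl-⊗ (monomial 1ℤ 1) (θ 1ℤ 4 0 ⊗ θ 1ℤ 10 2)) (⊗-cong
             (≋-trans (dbl-⊗ 1ₛ q) (⊗-cong (dbl-const 1ℤ) (dbl-q^ 1)))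
             (≋-trans (dbl-⊗ (θ 1ℤ 4 0) (θ 1ℤ 10 2)) (⊗-cong (dbl-θ 1ℤ 4 0) (dbl-θ 1ℤ 10 2)))))) ⟩
    dbl (θ 1ℤ 2 2 ⊗ θ 1ℤ 4 8) ⊕ dbl (monomial 1ℤ 1 ⊗ (θ 1ℤ 4 0 ⊗ θ 1ℤ 10 2))
      ≈⟨ dbl-⊕ _ (monomial 1ℤ 1 ⊗ (θ 1ℤ 4 0 ⊗ θ 1ℤ 10 2)) ⟨
    dbl (θ 1ℤ 2 2 ⊗ θ 1ℤ 4 8 ⊕ monomial 1ℤ 1 ⊗ (θ 1ℤ 4 0 ⊗ θ 1ℤ 10 2))
      ≈⟨ dbl-cong Eisenstein.identity ⟩
    dbl Y₀ ∎
  dbl²-θ : ∀ x y .{{_ : NonZero (x + y)}} .{{_ : NonZero (x + x + (y + y))}} →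
           dbl (dbl (θ 1ℤ x y)) ≋ θ 1ℤ (x + x + (x + x)) (y + y + (y + y))
  dbl²-θ x y = ≋-trans (dbl-cong (dbl-θ 1ℤ x y)) (dbl-θ 1ℤ (x + x) (y + y))
  -- With a parameter 0 the even and odd halves coincide; the 2 is the factor 1 + q^0 of the
  -- infinite product.
  double-θ : θ 1ℤ 2 0 ≋ const (+ 2) ⊗ θ 1ℤ 2 6
  double-θ = begin
    θ 1ℤ 2 0                                  ≈⟨ θ-sym 1ℤ 2 0 ⟩
    θ 1ℤ 0 2                                  ≈⟨ θ-split plus 0 2 ⟩
    θ 1ℤ 2 6 ⊕ 1ₛ ⊗ 1ₛ ⊗ θ 1ℤ 6 2            ≈⟨ ⊕-cong {θ 1ℤ 2 6} ≋-refl (⊗-cong {1ₛ ⊗ 1ₛ} ≋-refl (θ-sym 1ℤ 6 2)) ⟩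
    θ 1ℤ 2 6 ⊕ 1ₛ ⊗ 1ₛ ⊗ θ 1ℤ 2 6
      ≈⟨ solve 1 (λ a → a :+ con 1ℤ :* con 1ℤ :* a := con (+ 2) :* a) ≋-refl (θ 1ℤ 2 6) ⟩
    const (+ 2) ⊗ θ 1ℤ 2 6 ∎
  odd-part : a ⊗ d ⊕ b ⊗ c ≋ dbl (dbl E)
  odd-part = begin
    a ⊗ d ⊕ b ⊗ c
      ≈⟨ ⊕-cong (⊗-cong {a} ≋-refl (θ-sym 1ℤ 20 4)) ≋-refl ⟩
    a ⊗ θ 1ℤ 4 20 ⊕ b ⊗ c
      ≈⟨ ⊕-cong (≋-sym (≋-trans (dbl²-⊗ (θ 1ℤ 1 1) (θ 1ℤ 1 5)) (⊗-cong (dbl²-θ 1 1) (dbl²-θ 1 5))))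
                (≋-sym (≋-trans (dbl²-⊗ (θ 1ℤ 2 0) (θ 1ℤ 2 4)) (⊗-cong (dbl²-θ 2 0) (dbl²-θ 2 4)))) ⟩
    dbl (dbl (K 1ℤ)) ⊕ dbl (dbl (θ 1ℤ 2 0 ⊗ θ 1ℤ 2 4))
      ≈⟨ ≋-trans (dbl-cong (dbl-⊕ (K 1ℤ) _)) (dbl-⊕ (dbl (K 1ℤ)) _) ⟨
    dbl (dbl (K 1ℤ ⊕ θ 1ℤ 2 0 ⊗ θ 1ℤ 2 4))
      ≈⟨ dbl-cong (dbl-cong (⊕-cong {K 1ℤ} ≋-refl (begin
        θ 1ℤ 2 0 ⊗ θ 1ℤ 2 4                  ≈⟨ ⊗-cong double-θ ≋-refl ⟩
        const (+ 2) ⊗ θ 1ℤ 2 6 ⊗ θ 1ℤ 2 4    ≈⟨ R.*-assoc (const (+ 2)) (θ 1ℤ 2 6) (θ 1ℤ 2 4) ⟩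
        const (+ 2) ⊗ (θ 1ℤ 2 6 ⊗ θ 1ℤ 2 4)
          ≈⟨ ⊗-cong {const (+ 2)} ≋-refl (≋-sym (≋-trans (dbl-⊗ (θ 1ℤ 1 3) (θ 1ℤ 1 2)) (⊗-cong (dbl-θ 1ℤ 1 3) (dbl-θ 1ℤ 1 2)))) ⟩
        const (+ 2) ⊗ dbl Y₀ ∎))) ⟩
    dbl (dbl E) ∎

-- Products sorted by residue modulo 6.

euler : ℕ → ℕ → Series
euler = poch -1ℤ

euler₂ : ∀ k m .{{_ : NonZero m}} → euler k m ≋ euler (k + m * 0) (m * 2) ⊗ euler (k + m * 1) (m * 2)
euler₂ k m = ≋-trans (poch-blocks -1ℤ k m 2) (⊗-cong (R.*-identityˡ (euler (k + m * 0) (m * 2))) ≋-refl)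

euler₃ : ∀ k m .{{_ : NonZero m}} →
  euler k m ≋ euler (k + m * 0) (m * 3) ⊗ euler (k + m * 1) (m * 3) ⊗ euler (k + m * 2) (m * 3)
euler₃ k m = ≋-trans (poch-blocks -1ℤ k m 3)
  (⊗-cong (⊗-cong (R.*-identityˡ (euler (k + m * 0) (m * 3))) ≋-refl) ≋-refl)

-- The factors of f₁ by residue modulo 6: `T` for ±1, `G` for ±2, `X` for 3, `Φ` for 0. Lower case
-- means q replaced by q². Since G = t g and Φ = x f are already series in q², only `T` and `X` mix
-- parities.
T G X Φ t g x f : Series
T = euler 1 6 ⊗ euler 5 6
G = euler 2 6 ⊗ euler 4 6
X = euler 3 6
Φ = euler 6 6
t = dbl T
g = dbl G
x = dbl X
f = dbl Φ

t-euler : t ≋ euler 2 12 ⊗ euler 10 12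
t-euler = ≋-trans (dbl-⊗ (euler 1 6) (euler 5 6)) (⊗-cong (dbl-poch -1ℤ 1 6) (dbl-poch -1ℤ 5 6))

g-euler : g ≋ euler 4 12 ⊗ euler 8 12
g-euler = ≋-trans (dbl-⊗ (euler 2 6) (euler 4 6)) (⊗-cong (dbl-poch -1ℤ 2 6) (dbl-poch -1ℤ 4 6))

x-euler : x ≋ euler 6 12
x-euler = dbl-poch -1ℤ 3 6

f-euler : f ≋ euler 12 12
f-euler = dbl-poch -1ℤ 6 6

G≋tg : G ≋ t ⊗ g
G≋tg = ≋-trans (⊗-cong (euler₂ 2 6) (euler₂ 4 6)) (≋-trans
  (solve 4 (λ a b c d → a :* b :* (c :* d) := a :* d :* (c :* b)) ≋-refl (euler 2 12) (euler 8 12) (euler 4 12) (euler 10 12))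
  (≋-sym (⊗-cong t-euler g-euler)))

Φ≋xf : Φ ≋ x ⊗ f
Φ≋xf = ≋-trans (euler₂ 6 6) (≋-sym (⊗-cong x-euler f-euler))

T-unit : Unit T
T-unit = ⊗-unit {euler 1 6} {euler 5 6} (poch-unit -1ℤ 0 6) (poch-unit -1ℤ 4 6)

G-unit : Unit G
G-unit = ⊗-unit {euler 2 6} {euler 4 6} (poch-unit -1ℤ 1 6) (poch-unit -1ℤ 3 6)

X-unit : Unit X
X-unit = poch-unit -1ℤ 2 6

Φ-unit : Unit Φ
Φ-unit = poch-unit -1ℤ 5 6

-- Weierstrass' three-term relation for the base q^12, obtained as the
-- Plücker relation among the coefficients in θ-product.
weierstrass : θ -1ℤ 2 10 ⊗ θ -1ℤ 6 6 ⊗ (θ -1ℤ 3 9 ⊗ θ -1ℤ 3 9) ≋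
              θ -1ℤ 1 11 ⊗ θ -1ℤ 5 7 ⊗ (θ -1ℤ 4 8 ⊗ θ -1ℤ 4 8 ⊕ q ⊗ (θ -1ℤ 2 10 ⊗ θ -1ℤ 2 10))
weierstrass = begin
  θ -1ℤ 2 10 ⊗ θ -1ℤ 6 6 ⊗ (θ -1ℤ 3 9 ⊗ θ -1ℤ 3 9)
    ≈⟨ ⊗-cong (≋-trans (θ-product minus 1 4 4) (⊕-cong {β ⊗ β} ≋-refl (⊗-cong (⊗-cong {N} ≋-refl q²) (⊗-cong γ′ γ′))))
              (≋-trans (θ-product minus 2 6 0) (⊕-cong {α ⊗ δ} ≋-refl (⊗-cong (⊗-cong {N} ≋-refl q³) (⊗-cong α′ (≋-refl {ζ}))))) ⟩
  (β ⊗ β ⊕ N ⊗ (q ⊗ q) ⊗ (γ ⊗ γ)) ⊗ (α ⊗ δ ⊕ N ⊗ (q ⊗ (q ⊗ q)) ⊗ (α ⊗ ζ))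
    ≈⟨ solve 6 (λ q α β γ δ ζ →
         (β :* β :+ con -1ℤ :* (q :* q) :* (γ :* γ)) :* (α :* δ :+ con -1ℤ :* (q :* (q :* q)) :* (α :* ζ)) :=
         (α :* β :+ con -1ℤ :* q :* (α :* γ)) :*
           ((β :* δ :+ con -1ℤ :* (q :* (q :* (q :* q))) :* (γ :* ζ)) :+ q :* (γ :* δ :+ con -1ℤ :* (q :* q) :* (β :* ζ))))
         ≋-refl q α β γ δ ζ ⟩
  (α ⊗ β ⊕ N ⊗ q ⊗ (α ⊗ γ)) ⊗ ((β ⊗ δ ⊕ N ⊗ (q ⊗ (q ⊗ (q ⊗ q))) ⊗ (γ ⊗ ζ)) ⊕ q ⊗ (γ ⊗ δ ⊕ N ⊗ (q ⊗ q) ⊗ (β ⊗ ζ)))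
    ≈⟨ ⊗-cong (≋-sym (≋-trans (θ-product minus 0 6 4) (⊕-cong {α ⊗ β} ≋-refl (⊗-cong {N ⊗ q} ≋-refl (⊗-cong α′ γ′)))))
         (⊕-cong (≋-sym (≋-trans (θ-product minus 3 4 0) (⊕-cong {β ⊗ δ} ≋-refl (⊗-cong (⊗-cong {N} ≋-refl q⁴) (⊗-cong γ′ (≋-refl {ζ}))))))
           (⊗-cong {q} ≋-refl (≋-sym (≋-trans (θ-product minus 1 8 0) (⊕-cong {γ ⊗ δ} ≋-refl (⊗-cong (⊗-cong {N} ≋-refl q²) (⊗-cong (θ-sym 1ℤ 16 8) (≋-refl {ζ})))))))) ⟩
  θ -1ℤ 1 11 ⊗ θ -1ℤ 5 7 ⊗ (θ -1ℤ 4 8 ⊗ θ -1ℤ 4 8 ⊕ q ⊗ (θ -1ℤ 2 10 ⊗ θ -1ℤ 2 10)) ∎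
  where
  open ≋-Reasoning
  N α β γ δ ζ : Series
  N = const -1ℤ
  α = θ 1ℤ 6 18
  β = θ 1ℤ 8 16
  γ = θ 1ℤ 4 20
  δ = θ 1ℤ 12 12
  ζ = θ 1ℤ 24 0
  q² : q^ 2 ≋ q ⊗ q
  q² = q^-+ 1 1
  q³ : q^ 3 ≋ q ⊗ (q ⊗ q)
  q³ = ≋-trans (q^-+ 1 2) (⊗-cong {q} ≋-refl q²)
  q⁴ : q^ 4 ≋ q ⊗ (q ⊗ (q ⊗ q))
  q⁴ = ≋-trans (q^-+ 1 3) (⊗-cong {q} ≋-refl q³)
  α′ : θ 1ℤ 18 6 ≋ α
  α′ = θ-sym 1ℤ 18 6
  γ′ : θ 1ℤ 20 4 ≋ γ
  γ′ = θ-sym 1ℤ 20 4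

-- This is `weierstrass` with its theta functions written as products: both sides then carry f⁴,
-- which cancels.
relation-a : T ⊗ (g ⊗ g ⊕ q ⊗ (t ⊗ t)) ≋ t ⊗ (X ⊗ X) ⊗ (x ⊗ x)
relation-a = ⊗-cancel (f ⊗ f ⊗ (f ⊗ f)) f⁴-unit (begin
  f ⊗ f ⊗ (f ⊗ f) ⊗ (T ⊗ (g ⊗ g ⊕ q ⊗ (t ⊗ t)))
    ≈⟨ solve 5 (λ f T g t q → f :* f :* (f :* f) :* (T :* (g :* g :+ q :* (t :* t))) :=
         T :* f :* f :* ((g :* f) :* (g :* f) :+ q :* ((t :* f) :* (t :* f)))) ≋-refl f T g t q ⟩
  T ⊗ f ⊗ f ⊗ ((g ⊗ f) ⊗ (g ⊗ f) ⊕ q ⊗ ((t ⊗ f) ⊗ (t ⊗ f)))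
    ≈⟨ ⊗-cong (≋-sym θ₁θ₅) (⊕-cong (≋-sym (⊗-cong θ₄ θ₄)) (⊗-cong {q} ≋-refl (≋-sym (⊗-cong θ₂ θ₂)))) ⟩
  θ -1ℤ 1 11 ⊗ θ -1ℤ 5 7 ⊗ (θ -1ℤ 4 8 ⊗ θ -1ℤ 4 8 ⊕ q ⊗ (θ -1ℤ 2 10 ⊗ θ -1ℤ 2 10))
    ≈⟨ weierstrass ⟨
  θ -1ℤ 2 10 ⊗ θ -1ℤ 6 6 ⊗ (θ -1ℤ 3 9 ⊗ θ -1ℤ 3 9)
    ≈⟨ ⊗-cong (⊗-cong θ₂ θ₆) (⊗-cong θ₃ θ₃) ⟩
  t ⊗ f ⊗ (x ⊗ x ⊗ f) ⊗ ((X ⊗ f) ⊗ (X ⊗ f))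
    ≈⟨ solve 4 (λ t f x X → t :* f :* (x :* x :* f) :* ((X :* f) :* (X :* f)) := f :* f :* (f :* f) :* (t :* (X :* X) :* (x :* x)))
         ≋-refl t f x X ⟩
  f ⊗ f ⊗ (f ⊗ f) ⊗ (t ⊗ (X ⊗ X) ⊗ (x ⊗ x)) ∎)
  where
  open ≋-Reasoning
  f⁴-unit : Unit (f ⊗ f ⊗ (f ⊗ f))
  f⁴-unit = ⊗-unit {f ⊗ f} {f ⊗ f} (⊗-unit {f} {f} Φ-unit Φ-unit) (⊗-unit {f} {f} Φ-unit Φ-unit)
  θ₁θ₅ : θ -1ℤ 1 11 ⊗ θ -1ℤ 5 7 ≋ T ⊗ f ⊗ f
  θ₁θ₅ = ≋-trans (solve 5 (λ a b c d e → a :* b :* e :* (c :* d :* e) := a :* d :* (c :* b) :* e :* e) ≋-refl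
      (euler 1 12) (euler 11 12) (euler 5 12) (euler 7 12) (euler 12 12))
    (⊗-cong (⊗-cong (≋-sym (⊗-cong (euler₂ 1 6) (euler₂ 5 6))) (≋-sym f-euler)) (≋-sym f-euler))
  θ₂ : θ -1ℤ 2 10 ≋ t ⊗ f
  θ₂ = ⊗-cong (≋-sym t-euler) (≋-sym f-euler)
  θ₃ : θ -1ℤ 3 9 ≋ X ⊗ f
  θ₃ = ⊗-cong (≋-sym (euler₂ 3 6)) (≋-sym f-euler)
  θ₄ : θ -1ℤ 4 8 ≋ g ⊗ f
  θ₄ = ⊗-cong (≋-sym g-euler) (≋-sym f-euler)
  θ₆ : θ -1ℤ 6 6 ≋ x ⊗ x ⊗ f
  θ₆ = ⊗-cong (⊗-cong (≋-sym x-euler) (≋-sym x-euler)) (≋-sym f-euler)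

-- Since T X = (q; q²)_∞, pairing (1 + z)(1 - z) = 1 - z² turns θ(1,3) T X into (q²; q²)_∞ = G Φ. In
-- the same way θ(1,2) T becomes (q³; q³)_∞ = X Φ.
Y₀-product : Y₀ ⊗ (T ⊗ T) ≋ G ⊗ (Φ ⊗ Φ)
Y₀-product = ⊗-cancel X X-unit (begin
  X ⊗ (θ 1ℤ 1 3 ⊗ θ 1ℤ 1 2 ⊗ (T ⊗ T))
    ≈⟨ solve 4 (λ X a b T → X :* (a :* b :* (T :* T)) := a :* (T :* X) :* (b :* T)) ≋-refl X (θ 1ℤ 1 3) (θ 1ℤ 1 2) T ⟩
  θ 1ℤ 1 3 ⊗ (T ⊗ X) ⊗ (θ 1ℤ 1 2 ⊗ T)
    ≈⟨ ⊗-cong θ₁₃ θ₁₂ ⟩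
  G ⊗ Φ ⊗ (X ⊗ Φ)
    ≈⟨ solve 3 (λ G Φ X → G :* Φ :* (X :* Φ) := X :* (G :* (Φ :* Φ))) ≋-refl G Φ X ⟩
  X ⊗ (G ⊗ (Φ ⊗ Φ)) ∎)
  where
  open ≋-Reasoning
  θ₁₃ : θ 1ℤ 1 3 ⊗ (T ⊗ X) ≋ G ⊗ Φ
  θ₁₃ = begin
    poch 1ℤ 1 4 ⊗ poch 1ℤ 3 4 ⊗ euler 4 4 ⊗ (euler 1 6 ⊗ euler 5 6 ⊗ euler 3 6)
      ≈⟨ ⊗-cong {poch 1ℤ 1 4 ⊗ poch 1ℤ 3 4 ⊗ euler 4 4} ≋-refl (≋-trans
           (solve 3 (λ a b c → a :* b :* c := a :* c :* b) ≋-refl (euler 1 6) (euler 5 6) (euler 3 6))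
           (≋-trans (≋-sym (euler₃ 1 2)) (euler₂ 1 2))) ⟩
    poch 1ℤ 1 4 ⊗ poch 1ℤ 3 4 ⊗ euler 4 4 ⊗ (euler 1 4 ⊗ euler 3 4)
      ≈⟨ solve 5 (λ a b e c d → a :* b :* e :* (c :* d) := (a :* c) :* (b :* d) :* e) ≋-refl
           (poch 1ℤ 1 4) (poch 1ℤ 3 4) (euler 4 4) (euler 1 4) (euler 3 4) ⟩
    (poch 1ℤ 1 4 ⊗ euler 1 4) ⊗ (poch 1ℤ 3 4 ⊗ euler 3 4) ⊗ euler 4 4
      ≈⟨ ⊗-cong (⊗-cong (poch-squares 1 4) (poch-squares 3 4)) (≋-refl {euler 4 4}) ⟩
    euler 2 8 ⊗ euler 6 8 ⊗ euler 4 4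
      ≈⟨ ⊗-cong (≋-sym (euler₂ 2 4)) (≋-refl {euler 4 4}) ⟩
    euler 2 4 ⊗ euler 4 4
      ≈⟨ euler₂ 2 2 ⟨
    euler 2 2
      ≈⟨ euler₃ 2 2 ⟩
    euler 2 6 ⊗ euler 4 6 ⊗ euler 6 6 ∎
  θ₁₂ : θ 1ℤ 1 2 ⊗ T ≋ X ⊗ Φ
  θ₁₂ = ⊗-cancel G G-unit (begin
    G ⊗ (poch 1ℤ 1 3 ⊗ poch 1ℤ 2 3 ⊗ euler 3 3 ⊗ T)
      ≈⟨ solve 7 (λ g₂ g₄ a b c t₁ t₅ → g₂ :* g₄ :* (a :* b :* c :* (t₁ :* t₅)) := (a :* (t₁ :* g₄)) :* (b :* (g₂ :* t₅)) :* c) ≋-refl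
           (euler 2 6) (euler 4 6) (poch 1ℤ 1 3) (poch 1ℤ 2 3) (euler 3 3) (euler 1 6) (euler 5 6) ⟩
    (poch 1ℤ 1 3 ⊗ (euler 1 6 ⊗ euler 4 6)) ⊗ (poch 1ℤ 2 3 ⊗ (euler 2 6 ⊗ euler 5 6)) ⊗ euler 3 3
      ≈⟨ ⊗-cong (⊗-cong (≋-trans (⊗-cong {poch 1ℤ 1 3} ≋-refl (≋-sym (euler₂ 1 3))) (poch-squares 1 3))
                        (≋-trans (⊗-cong {poch 1ℤ 2 3} ≋-refl (≋-sym (euler₂ 2 3))) (poch-squares 2 3))) (euler₂ 3 3) ⟩
    euler 2 6 ⊗ euler 4 6 ⊗ (euler 3 6 ⊗ euler 6 6) ∎)

dbl-Y₀ : dbl Y₀ ⊗ (t ⊗ t) ≋ g ⊗ (f ⊗ f)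
dbl-Y₀ = begin
  dbl Y₀ ⊗ (dbl T ⊗ dbl T)   ≈⟨ ≋-trans (dbl-⊗ Y₀ (T ⊗ T)) (⊗-cong {dbl Y₀} ≋-refl (dbl-⊗ T T)) ⟨
  dbl (Y₀ ⊗ (T ⊗ T))         ≈⟨ dbl-cong Y₀-product ⟩
  dbl (G ⊗ (Φ ⊗ Φ))          ≈⟨ ≋-trans (dbl-⊗ G (Φ ⊗ Φ)) (⊗-cong {g} ≋-refl (dbl-⊗ Φ Φ)) ⟩
  g ⊗ (f ⊗ f)                ∎
  where open ≋-Reasoning

K-product : K -1ℤ ≋ (T ⊗ X) ⊗ (T ⊗ X) ⊗ (G ⊗ Φ) ⊗ (T ⊗ Φ)
K-product = ⊗-cong (⊗-cong (⊗-cong e₁₂ e₁₂) (euler₃ 2 2)) (≋-refl {T ⊗ Φ})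
  where
  e₁₂ : euler 1 2 ≋ T ⊗ X
  e₁₂ = ≋-trans (euler₃ 1 2) (solve 3 (λ a b c → a :* b :* c := a :* c :* b) ≋-refl (euler 1 6) (euler 3 6) (euler 5 6))

-- A ↦ B + q A(q⁴) is contracting, hence has at most one fixed point.
fixed-point-unique : ∀ {A A′ B} → A ≋ B ⊕ q ⊗ dbl (dbl A) → A′ ≋ B ⊕ q ⊗ dbl (dbl A′) → A ≋ A′
fixed-point-unique {A} {A′} {B} fix fix′ = ≈[]⇒≋ go
  where
  open ≈[]-Reasoning
  go : ∀ N → A ≈[ N ] A′
  go zero    = below λ ()
  go (suc N) = begin
    A                      ≈⟨ ≋⇒≈[] fix ⟩
    B ⊕ q ⊗ dbl (dbl A)    ≈⟨ ≋⇒≈[] (⊕-cong {B} ≋-refl (q-⊗ (dbl (dbl A)))) ⟩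
    B ⊕ shift (dbl (dbl A)) ≈⟨ ⊕-cong[] (≈[]-refl {x = B}) (shift-cong[] (dbl-cong[] (dbl-cong[] (go N)))) ⟩
    B ⊕ shift (dbl (dbl A′)) ≈⟨ ≋⇒≈[] (⊕-cong {B} ≋-refl (≋-sym (q-⊗ (dbl (dbl A′))))) ⟩
    B ⊕ q ⊗ dbl (dbl A′)   ≈⟨ ≋⇒≈[] (≋-sym fix′) ⟩
    A′                     ∎

-- C = f₃³ / f₁
module Cubic (C : Series) (C-def : C ⊗ (T ⊗ G) ≋ X ⊗ X ⊗ (Φ ⊗ Φ)) where

  dbl²-C : dbl (dbl C) ⊗ g ≋ f ⊗ f
  dbl²-C = begin
    dbl (dbl C) ⊗ g
      ≈⟨ ⊗-cong {dbl (dbl C)} ≋-refl (≋-sym (≋-trans (dbl²-⊗ T G) (≋-trans (≋-sym (dbl-⊗ t g)) (dbl-cong (≋-sym G≋tg))))) ⟩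
    dbl (dbl C) ⊗ dbl (dbl (T ⊗ G))
      ≈⟨ dbl²-⊗ C (T ⊗ G) ⟨
    dbl (dbl (C ⊗ (T ⊗ G)))
      ≈⟨ dbl-cong (dbl-cong (≋-trans C-def (solve 2 (λ X Φ → X :* X :* (Φ :* Φ) := (X :* Φ) :* (X :* Φ)) ≋-refl X Φ))) ⟩
    dbl (dbl ((X ⊗ Φ) ⊗ (X ⊗ Φ)))
      ≈⟨ dbl²-⊗ (X ⊗ Φ) (X ⊗ Φ) ⟩
    dbl (dbl (X ⊗ Φ)) ⊗ dbl (dbl (X ⊗ Φ))
      ≈⟨ ⊗-cong XΦ XΦ ⟩
    f ⊗ f ∎
    where
    open ≋-Reasoning
    XΦ : dbl (dbl (X ⊗ Φ)) ≋ f
    XΦ = ≋-trans (dbl²-⊗ X Φ) (≋-trans (≋-sym (dbl-⊗ x f)) (dbl-cong (≋-sym Φ≋xf)))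

  -- In quotient form Y₀(q²) = g f² / t² and C(q⁴) = f² / g. Clearing the denominators with T t² g
  -- leaves f² times `relation-a`.
  C-dissection : C ≋ dbl Y₀ ⊕ q ⊗ dbl (dbl C)
  C-dissection = ⊗-cancel (T ⊗ (t ⊗ t) ⊗ g)
    (⊗-unit {T ⊗ (t ⊗ t)} {g} (⊗-unit {T} {t ⊗ t} T-unit (⊗-unit {t} {t} T-unit T-unit)) G-unit) (begin
    T ⊗ (t ⊗ t) ⊗ g ⊗ C
      ≈⟨ solve 4 (λ T t g C → T :* (t :* t) :* g :* C := t :* (C :* (T :* (t :* g)))) ≋-refl T t g C ⟩
    t ⊗ (C ⊗ (T ⊗ (t ⊗ g)))
      ≈⟨ ⊗-cong {t} ≋-refl (≋-trans (⊗-cong {C} ≋-refl (⊗-cong {T} ≋-refl (≋-sym G≋tg)))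
           (≋-trans C-def (⊗-cong {X ⊗ X} ≋-refl (⊗-cong Φ≋xf Φ≋xf)))) ⟩
    t ⊗ (X ⊗ X ⊗ ((x ⊗ f) ⊗ (x ⊗ f)))
      ≈⟨ solve 4 (λ t X x f → t :* (X :* X :* ((x :* f) :* (x :* f))) := f :* f :* (t :* (X :* X) :* (x :* x))) ≋-refl t X x f ⟩
    f ⊗ f ⊗ (t ⊗ (X ⊗ X) ⊗ (x ⊗ x))
      ≈⟨ ⊗-cong {f ⊗ f} ≋-refl (≋-sym relation-a) ⟩
    f ⊗ f ⊗ (T ⊗ (g ⊗ g ⊕ q ⊗ (t ⊗ t)))
      ≈⟨ solve 5 (λ f T g t q → f :* f :* (T :* (g :* g :+ q :* (t :* t))) := T :* g :* (g :* (f :* f)) :+ T :* q :* (t :* t) :* (f :* f))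
           ≋-refl f T g t q ⟩
    T ⊗ g ⊗ (g ⊗ (f ⊗ f)) ⊕ T ⊗ q ⊗ (t ⊗ t) ⊗ (f ⊗ f)
      ≈⟨ ⊕-cong (⊗-cong {T ⊗ g} ≋-refl (≋-sym dbl-Y₀)) (⊗-cong {T ⊗ q ⊗ (t ⊗ t)} ≋-refl (≋-sym dbl²-C)) ⟩
    T ⊗ g ⊗ (dbl Y₀ ⊗ (t ⊗ t)) ⊕ T ⊗ q ⊗ (t ⊗ t) ⊗ (dbl (dbl C) ⊗ g)
      ≈⟨ solve 6 (λ T g Y t q C → T :* g :* (Y :* (t :* t)) :+ T :* q :* (t :* t) :* (C :* g) := T :* (t :* t) :* g :* (Y :+ q :* C))
           ≋-refl T g (dbl Y₀) t q (dbl (dbl C)) ⟩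
    T ⊗ (t ⊗ t) ⊗ g ⊗ (dbl Y₀ ⊕ q ⊗ dbl (dbl C)) ∎)
    where open ≋-Reasoning

  -- Both sides satisfy A = 3 Y₀(q²) + q A(q⁴): for E this is `K-dissection` at sign 1 plus the
  -- extra 2 Y₀(q²), for C three times `C-dissection`.
  E≋3C : E ≋ const (+ 3) ⊗ C
  E≋3C = fixed-point-unique {B = const (+ 3) ⊗ dbl Y₀}
    (≋-trans (⊕-cong (K-dissection plus) ≋-refl)
      (solve 3 (λ Y q E → Y :+ con 1ℤ :* q :* E :+ con (+ 2) :* Y := con (+ 3) :* Y :+ q :* E) ≋-refl (dbl Y₀) q (dbl (dbl E))))
    (≋-trans (⊗-cong {const (+ 3)} ≋-refl C-dissection)
      (≋-trans (solve 4 (λ k Y q C → k :* (Y :+ q :* C) := k :* Y :+ q :* (k :* C)) ≋-refl (const (+ 3)) (dbl Y₀) q (dbl (dbl C)))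
        (⊕-cong {const (+ 3) ⊗ dbl Y₀} ≋-refl (⊗-cong {q} ≋-refl
          (≋-sym (≋-trans (dbl²-⊗ (const (+ 3)) C) (⊗-cong (≋-trans (dbl-cong (dbl-const (+ 3))) (dbl-const (+ 3))) (≋-refl {dbl (dbl C)}))))))))

  dbl²-E : dbl (dbl E) ⊗ g ≋ const (+ 3) ⊗ (f ⊗ f)
  dbl²-E = begin
    dbl (dbl E) ⊗ g
      ≈⟨ ⊗-cong (≋-trans (dbl-cong (dbl-cong E≋3C)) (≋-trans (dbl²-⊗ (const (+ 3)) C)
           (⊗-cong (≋-trans (dbl-cong (dbl-const (+ 3))) (dbl-const (+ 3))) (≋-refl {dbl (dbl C)})))) (≋-refl {g}) ⟩
    const (+ 3) ⊗ dbl (dbl C) ⊗ g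
      ≈⟨ R.*-assoc (const (+ 3)) (dbl (dbl C)) g ⟩
    const (+ 3) ⊗ (dbl (dbl C) ⊗ g)
      ≈⟨ ⊗-cong {const (+ 3)} ≋-refl dbl²-C ⟩
    const (+ 3) ⊗ (f ⊗ f) ∎
    where open ≋-Reasoning

  -- The dissection of K(-1) reads K(-1) = g f² / t² - 3 q f² / g. Multiplied by g t² and compared
  -- with the product for K(-1), it gives the relation after cancelling f².
  relation-b : g ⊗ g ⊕ ⊝ (const (+ 3) ⊗ (q ⊗ (t ⊗ t))) ≋ T ⊗ T ⊗ T ⊗ (X ⊗ X) ⊗ (t ⊗ t ⊗ t) ⊗ (g ⊗ g) ⊗ (x ⊗ x)
  relation-b = ⊗-cancel (f ⊗ f) (⊗-unit {f} {f} Φ-unit Φ-unit) (begin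
    f ⊗ f ⊗ (g ⊗ g ⊕ ⊝ (const (+ 3) ⊗ (q ⊗ (t ⊗ t))))
      ≈⟨ solve 4 (λ f g t q → f :* f :* (g :* g :- con (+ 3) :* (q :* (t :* t))) :=
           g :* (g :* (f :* f)) :+ con -1ℤ :* q :* (t :* t) :* (con (+ 3) :* (f :* f))) ≋-refl f g t q ⟩
    g ⊗ (g ⊗ (f ⊗ f)) ⊕ const -1ℤ ⊗ q ⊗ (t ⊗ t) ⊗ (const (+ 3) ⊗ (f ⊗ f))
      ≈⟨ ⊕-cong (⊗-cong {g} ≋-refl (≋-sym dbl-Y₀)) (⊗-cong {const -1ℤ ⊗ q ⊗ (t ⊗ t)} ≋-refl (≋-sym dbl²-E)) ⟩
    g ⊗ (dbl Y₀ ⊗ (t ⊗ t)) ⊕ const -1ℤ ⊗ q ⊗ (t ⊗ t) ⊗ (dbl (dbl E) ⊗ g)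
      ≈⟨ solve 5 (λ g Y t q E → g :* (Y :* (t :* t)) :+ con -1ℤ :* q :* (t :* t) :* (E :* g) := g :* (t :* t) :* (Y :+ con -1ℤ :* q :* E))
           ≋-refl g (dbl Y₀) t q (dbl (dbl E)) ⟩
    g ⊗ (t ⊗ t) ⊗ (dbl Y₀ ⊕ const -1ℤ ⊗ q ⊗ dbl (dbl E))
      ≈⟨ ⊗-cong {g ⊗ (t ⊗ t)} ≋-refl (≋-trans (≋-sym (K-dissection minus)) (≋-trans K-product
           (⊗-cong (⊗-cong {(T ⊗ X) ⊗ (T ⊗ X)} ≋-refl (⊗-cong G≋tg Φ≋xf)) (⊗-cong {T} ≋-refl Φ≋xf)))) ⟩
    g ⊗ (t ⊗ t) ⊗ ((T ⊗ X) ⊗ (T ⊗ X) ⊗ (t ⊗ g ⊗ (x ⊗ f)) ⊗ (T ⊗ (x ⊗ f)))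
      ≈⟨ solve 6 (λ g t T X x f → g :* (t :* t) :* ((T :* X) :* (T :* X) :* (t :* g :* (x :* f)) :* (T :* (x :* f))) :=
           f :* f :* (T :* T :* T :* (X :* X) :* (t :* t :* t) :* (g :* g) :* (x :* x))) ≋-refl g t T X x f ⟩
    f ⊗ f ⊗ (T ⊗ T ⊗ T ⊗ (X ⊗ X) ⊗ (t ⊗ t ⊗ t) ⊗ (g ⊗ g) ⊗ (x ⊗ x)) ∎)
    where open ≋-Reasoning

-- Separating parities.

alt-at-even : ∀ S n → alt S (n + n) ≡ S (n + n)
alt-at-odd  : ∀ S n → alt S (suc (n + n)) ≡ ℤ.- S (suc (n + n))
alt-at-even S zero    = refl
alt-at-even S (suc n) = trans (cong ℤ.-_ (trans (cong (alt (tail S)) (+-suc n n)) (alt-at-odd (tail S) n)))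
  (trans (ℤ.neg-involutive _) (cong (tail S) (sym (+-suc n n))))
alt-at-odd S n = cong ℤ.-_ (alt-at-even (tail S) n)

-- 2 has the inverse 4 modulo 7: a = 4 (a + a) - 7 a.
self-negative : ∀ {a} → a ≈₇ ℤ.- a → a ≈₇ 0ℤ
self-negative {a} (differBy k eq) = differBy (+ 4 ℤ.* k ℤ.- a) (begin
  a                                                   ≡⟨ lemma₁ a ⟩
  + 4 ℤ.* (a ℤ.+ a) ℤ.- + 7 ℤ.* a                     ≡⟨ cong (λ z → + 4 ℤ.* (a ℤ.+ z) ℤ.- + 7 ℤ.* a) eq ⟩
  + 4 ℤ.* (a ℤ.+ (ℤ.- a ℤ.+ + 7 ℤ.* k)) ℤ.- + 7 ℤ.* a ≡⟨ lemma₂ a k ⟩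
  0ℤ ℤ.+ + 7 ℤ.* (+ 4 ℤ.* k ℤ.- a)                    ∎)
  where
  open ≡-Reasoning
  lemma₁ : ∀ a → a ≡ + 4 ℤ.* (a ℤ.+ a) ℤ.- + 7 ℤ.* a
  lemma₁ = solve-∀ℤ
  lemma₂ : ∀ a k → + 4 ℤ.* (a ℤ.+ (ℤ.- a ℤ.+ + 7 ℤ.* k)) ℤ.- + 7 ℤ.* a ≡ 0ℤ ℤ.+ + 7 ℤ.* (+ 4 ℤ.* k ℤ.- a)
  lemma₂ = solve-∀ℤ

even-series : ∀ {S} → alt S ≋ S → ∀ n → S (suc (n + n)) ≈₇ 0ℤ
even-series {S} eq n = self-negative (≈₇-trans (≈₇-sym (eq at suc (n + n))) (≈₇-reflexive (alt-at-odd S n)))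

odd-series : ∀ {S} → alt S ≋ ⊝ S → ∀ n → S (n + n) ≈₇ 0ℤ
odd-series {S} eq n = self-negative (≈₇-trans (≈₇-reflexive (sym (alt-at-even S n))) (eq at (n + n)))

-- All exponents in `T` are odd, so the conjugate differs by signs and (1 + z)(1 - z) = 1 - z²
-- applies factor by factor.
alt-T : alt T ⊗ T ≋ t
alt-T = begin
  alt T ⊗ T
    ≈⟨ ⊗-cong (≋-trans (alt-⊗ (euler 1 6) (euler 5 6)) (⊗-cong (alt-poch-odd -1ℤ 0 3) (alt-poch-odd -1ℤ 2 3))) (≋-refl {T}) ⟩
  poch 1ℤ 1 6 ⊗ poch 1ℤ 5 6 ⊗ (euler 1 6 ⊗ euler 5 6)
    ≈⟨ solve 4 (λ a b c d → a :* b :* (c :* d) := a :* c :* (b :* d)) ≋-refl (poch 1ℤ 1 6) (poch 1ℤ 5 6) (euler 1 6) (euler 5 6) ⟩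
  poch 1ℤ 1 6 ⊗ euler 1 6 ⊗ (poch 1ℤ 5 6 ⊗ euler 5 6)
    ≈⟨ ⊗-cong (poch-squares 1 6) (poch-squares 5 6) ⟩
  euler 2 12 ⊗ euler 10 12
    ≈⟨ t-euler ⟨
  t ∎
  where open ≋-Reasoning

alt-X : alt X ⊗ X ≋ x
alt-X = ≋-trans (⊗-cong (alt-poch-odd -1ℤ 1 3) (≋-refl {X})) (≋-trans (poch-squares 3 6) (≋-sym x-euler))

alt-q : alt q ≋ ⊝ q
alt-q = alt-q^odd 0

-- The series F and F° and their dissections.

f₁ f₃ : Series
f₁ = euler 1 1
f₃ = euler 3 3

f₃-product : f₃ ≋ X ⊗ Φ
f₃-product = euler₂ 3 3

f₁-product : f₁ ≋ T ⊗ G ⊗ (X ⊗ Φ)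
f₁-product = ≋-trans (euler₃ 1 1) (≋-trans (⊗-cong (⊗-cong (euler₂ 1 3) (euler₂ 2 3)) (euler₂ 3 3))
  (solve 5 (λ a b c d y → a :* b :* (c :* d) :* y := a :* d :* (c :* b) :* y) ≋-refl
    (euler 1 6) (euler 4 6) (euler 2 6) (euler 5 6) (euler 3 6 ⊗ euler 6 6)))

-- Spelled out as products, so that the ring solver can evaluate them.
_² _⁴ _⁵ _⁶ : Series → Series
A ² = A ⊗ A
A ⁴ = A ² ⊗ A ²
A ⁵ = A ⁴ ⊗ A
A ⁶ = A ⁴ ⊗ A ²

F F° : Series
F  = f₁ ⁵ ⊗ f₃
F° = f₁ ⊗ f₃ ⁵

²-cong : ∀ {A B} → A ≋ B → A ² ≋ B ²
²-cong p = ⊗-cong p p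

⁵-cong : ∀ {A B} → A ≋ B → A ⁵ ≋ B ⁵
⁵-cong p = ⊗-cong (²-cong (²-cong p)) p

⁶-cong : ∀ {A B} → A ≋ B → A ⁶ ≋ B ⁶
⁶-cong p = ⊗-cong (²-cong (²-cong p)) (²-cong p)

dbl-² : ∀ A → dbl (A ²) ≋ (dbl A) ²
dbl-² A = dbl-⊗ A A

dbl-⁵ : ∀ A → dbl (A ⁵) ≋ (dbl A) ⁵
dbl-⁵ A = ≋-trans (dbl-⊗ (A ⁴) A) (⊗-cong (≋-trans (dbl-² (A ²)) (²-cong (dbl-² A))) ≋-refl)

dbl-⁶ : ∀ A → dbl (A ⁶) ≋ (dbl A) ⁶
dbl-⁶ A = ≋-trans (dbl-⊗ (A ⁴) (A ²)) (⊗-cong (≋-trans (dbl-² (A ²)) (²-cong (dbl-² A))) (dbl-² A))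

F-product : F ≋ (T ⊗ G) ⁵ ⊗ (X ⊗ Φ) ⁶
F-product = ≋-trans (⊗-cong (⁵-cong f₁-product) f₃-product)
  (solve 2 (λ a b → let c = a :* b ; c² = c :* c ; c⁴ = c² :* c² ; a² = a :* a ; a⁴ = a² :* a² ; b² = b :* b ; b⁴ = b² :* b² in
     c⁴ :* c :* b := a⁴ :* a :* (b⁴ :* b²)) ≋-refl (T ⊗ G) (X ⊗ Φ))

F°-product : F° ≋ T ⊗ G ⊗ (X ⊗ Φ) ⁶
F°-product = ≋-trans (⊗-cong f₁-product (⁵-cong f₃-product))
  (solve 2 (λ a b → let b² = b :* b ; b⁴ = b² :* b² in a :* b :* (b⁴ :* b) := a :* (b⁴ :* b²)) ≋-refl (T ⊗ G) (X ⊗ Φ))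

dbl-TG : dbl (t ⊗ g) ≋ g
dbl-TG = dbl-cong (≋-sym G≋tg)

dbl-xf : dbl (x ⊗ f) ≋ f
dbl-xf = dbl-cong (≋-sym Φ≋xf)

dbl-F : dbl F ≋ (t ⊗ g) ⁵ ⊗ (x ⊗ f) ⁶
dbl-F = ≋-trans (dbl-cong F-product) (≋-trans (dbl-⊗ ((T ⊗ G) ⁵) ((X ⊗ Φ) ⁶))
  (⊗-cong (≋-trans (dbl-⁵ (T ⊗ G)) (⁵-cong (dbl-⊗ T G))) (≋-trans (dbl-⁶ (X ⊗ Φ)) (⁶-cong (dbl-⊗ X Φ)))))

dbl-F° : dbl F° ≋ t ⊗ g ⊗ (x ⊗ f) ⁶
dbl-F° = ≋-trans (dbl-cong F°-product) (≋-trans (dbl-⊗ (T ⊗ G) ((X ⊗ Φ) ⁶))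
  (⊗-cong (dbl-⊗ T G) (≋-trans (dbl-⁶ (X ⊗ Φ)) (⁶-cong (dbl-⊗ X Φ)))))

dbl²-F : dbl (dbl F) ≋ g ⁵ ⊗ f ⁶
dbl²-F = ≋-trans (dbl-cong dbl-F) (≋-trans (dbl-⊗ ((t ⊗ g) ⁵) ((x ⊗ f) ⁶))
  (⊗-cong (≋-trans (dbl-⁵ (t ⊗ g)) (⁵-cong dbl-TG)) (≋-trans (dbl-⁶ (x ⊗ f)) (⁶-cong dbl-xf))))

dbl²-F° : dbl (dbl F°) ≋ g ⊗ f ⁶
dbl²-F° = ≋-trans (dbl-cong dbl-F°) (≋-trans (dbl-⊗ (t ⊗ g) ((x ⊗ f) ⁶))
  (⊗-cong dbl-TG (≋-trans (dbl-⁶ (x ⊗ f)) (⁶-cong dbl-xf))))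

t-unit : Unit t
t-unit = T-unit

g-unit : Unit g
g-unit = G-unit

⊝-alt : ∀ S → alt (⊝ S) ≋ ⊝ alt S
⊝-alt S = ≋-reflexive (go S)
  where
  go : ∀ S n → alt (⊝ S) n ≡ ℤ.- alt S n
  go S zero    = refl
  go S (suc n) = cong ℤ.-_ (go (tail S) n)

alt-affine : ∀ c → alt (g ² ⊕ const c ⊗ (q ⊗ t ²)) ≋ g ² ⊕ ⊝ (const c ⊗ (q ⊗ t ²))
alt-affine c = ≋-trans (alt-⊕ (g ²) (const c ⊗ (q ⊗ t ²))) (⊕-cong
  (≋-trans (alt-⊗ g g) (²-cong (alt-dbl G)))
  (≋-trans (≋-trans (alt-⊗ (const c) (q ⊗ t ²)) (⊗-cong (alt-const c) (≋-trans (alt-⊗ q (t ²))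
      (⊗-cong alt-q (≋-trans (alt-⊗ t t) (²-cong (alt-dbl T)))))))
    (solve 3 (λ c q t → c :* (:- q :* t) := :- (c :* (q :* t))) ≋-refl (const c) q (t ²))))

-- The product of `relation-a` with its conjugate under q ↦ -q. The pairs of conjugate `T` and `X`
-- collapse to t and x, and one t cancels.
relation-a² : g ⁴ ⊕ ⊝ (q ² ⊗ t ⁴) ≋ t ⊗ x ⁶
relation-a² = ⊗-cancel t t-unit (begin
  t ⊗ (g ⁴ ⊕ ⊝ (q ² ⊗ t ⁴))
    ≈⟨ ⊗-cong (≋-sym alt-T) ≋-refl ⟩
  alt T ⊗ T ⊗ (g ⁴ ⊕ ⊝ (q ² ⊗ t ⁴))
    ≈⟨ solve 5 (λ T′ T g q t → let g² = g :* g ; t² = t :* t in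
         T′ :* T :* (g² :* g² :- (q :* q) :* (t² :* t²)) := (T′ :* (g² :- con 1ℤ :* (q :* t²))) :* (T :* (g² :+ q :* t²)))
         ≋-refl (alt T) T g q t ⟩
  (alt T ⊗ (g ² ⊕ ⊝ (const 1ℤ ⊗ (q ⊗ t ²)))) ⊗ (T ⊗ (g ² ⊕ q ⊗ t ²))
    ≈⟨ ⊗-cong alt-a relation-a ⟩
  (t ⊗ (alt X) ² ⊗ x ²) ⊗ (t ⊗ X ² ⊗ x ²)
    ≈⟨ solve 4 (λ t X′ X x → let x² = x :* x in (t :* (X′ :* X′) :* x²) :* (t :* (X :* X) :* x²) :=
         t :* (t :* ((x² :* x²) :* ((X′ :* X) :* (X′ :* X))))) ≋-refl t (alt X) X x ⟩
  t ⊗ (t ⊗ (x ⁴ ⊗ (alt X ⊗ X) ²))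
    ≈⟨ ⊗-cong {t} ≋-refl (⊗-cong {t} ≋-refl (⊗-cong {x ⁴} ≋-refl (²-cong alt-X))) ⟩
  t ⊗ (t ⊗ x ⁶) ∎)
  where
  open ≋-Reasoning
  alt-a : alt T ⊗ (g ² ⊕ ⊝ (const 1ℤ ⊗ (q ⊗ t ²))) ≋ t ⊗ (alt X) ² ⊗ x ²
  alt-a = begin
    alt T ⊗ (g ² ⊕ ⊝ (const 1ℤ ⊗ (q ⊗ t ²)))
      ≈⟨ ⊗-cong {alt T} ≋-refl (≋-sym (alt-affine 1ℤ)) ⟩
    alt T ⊗ alt (g ² ⊕ const 1ℤ ⊗ (q ⊗ t ²))
      ≈⟨ alt-⊗ T (g ² ⊕ const 1ℤ ⊗ (q ⊗ t ²)) ⟨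
    alt (T ⊗ (g ² ⊕ const 1ℤ ⊗ (q ⊗ t ²)))
      ≈⟨ alt-cong (≋-trans (⊗-cong {T} ≋-refl (⊕-cong {g ²} ≋-refl (R.*-identityˡ (q ⊗ t ²)))) relation-a) ⟩
    alt (t ⊗ X ² ⊗ x ²)
      ≈⟨ ≋-trans (alt-⊗ (t ⊗ X ²) (x ²)) (⊗-cong (≋-trans (alt-⊗ t (X ²)) (⊗-cong (alt-dbl T) (alt-⊗ X X)))
           (≋-trans (alt-⊗ x x) (²-cong (alt-dbl X)))) ⟩
    t ⊗ (alt X) ² ⊗ x ² ∎

module Recurrence (C : Series) (C-def : C ⊗ (T ⊗ G) ≋ X ⊗ X ⊗ (Φ ⊗ Φ)) where

  open Cubic C C-def

  -- The conjugate product of `relation-b`: the three pairs of `T` give t³ and the two pairs of `X`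
  -- give x².
  relation-b² : g ⁴ ⊕ ⊝ (const (+ 9) ⊗ (q ² ⊗ t ⁴)) ≋ t ⁴ ⊗ t ⁵ ⊗ g ⁴ ⊗ x ⁶
  relation-b² = begin
    g ⁴ ⊕ ⊝ (const (+ 9) ⊗ (q ² ⊗ t ⁴))
      ≈⟨ solve 3 (λ g q t → let g² = g :* g ; t² = t :* t in g² :* g² :- con (+ 9) :* ((q :* q) :* (t² :* t²)) :=
           (g² :- :- (con (+ 3) :* (q :* t²))) :* (g² :- con (+ 3) :* (q :* t²))) ≋-refl g q t ⟩
    (g ² ⊕ ⊝ (⊝ (const (+ 3) ⊗ (q ⊗ t ²)))) ⊗ (g ² ⊕ ⊝ (const (+ 3) ⊗ (q ⊗ t ²)))
      ≈⟨ ⊗-cong alt-b relation-b ⟩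
    ((alt T ⊗ alt T ⊗ alt T) ⊗ (alt X) ² ⊗ (t ⊗ t ⊗ t) ⊗ g ² ⊗ x ²) ⊗ (T ⊗ T ⊗ T ⊗ X ² ⊗ (t ⊗ t ⊗ t) ⊗ g ² ⊗ x ²)
      ≈⟨ solve 7 (λ T′ T X′ X t g x → let g² = g :* g ; x² = x :* x ; t³ = t :* t :* t ; a = T′ :* T ; b = X′ :* X in
           ((T′ :* T′ :* T′) :* (X′ :* X′) :* t³ :* g² :* x²) :* (T :* T :* T :* (X :* X) :* t³ :* g² :* x²) :=
           a :* a :* a :* (b :* b) :* (t³ :* t³) :* (g² :* g²) :* (x² :* x²)) ≋-refl (alt T) T (alt X) X t g x ⟩
    TT ⊗ TT ⊗ TT ⊗ (XX ⊗ XX) ⊗ ((t ⊗ t ⊗ t) ⊗ (t ⊗ t ⊗ t)) ⊗ g ⁴ ⊗ x ⁴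
      ≈⟨ ⊗-cong (⊗-cong (⊗-cong (⊗-cong (⊗-cong (⊗-cong alt-T alt-T) alt-T) (²-cong alt-X)) ≋-refl) (≋-refl {g ⁴})) (≋-refl {x ⁴}) ⟩
    t ⊗ t ⊗ t ⊗ x ² ⊗ ((t ⊗ t ⊗ t) ⊗ (t ⊗ t ⊗ t)) ⊗ g ⁴ ⊗ x ⁴
      ≈⟨ solve 3 (λ t g x → let x² = x :* x ; t² = t :* t ; t³ = t² :* t ; t⁴ = t² :* t² in
           t³ :* x² :* (t³ :* t³) :* g :* (x² :* x²) := t⁴ :* (t⁴ :* t) :* g :* (x² :* x² :* x²)) ≋-refl t (g ⁴) x ⟩
    t ⁴ ⊗ t ⁵ ⊗ g ⁴ ⊗ x ⁶ ∎
    where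
    open ≋-Reasoning
    TT XX : Series
    TT = alt T ⊗ T
    XX = alt X ⊗ X
    as-affine : ∀ S → g ² ⊕ ⊝ (const (+ 3) ⊗ S) ≋ g ² ⊕ const (ℤ.- + 3) ⊗ S
    as-affine S = solve 2 (λ g S → g :- con (+ 3) :* S := g :+ con (ℤ.- + 3) :* S) ≋-refl (g ²) S
    alt-b : g ² ⊕ ⊝ (⊝ (const (+ 3) ⊗ (q ⊗ t ²))) ≋ (alt T ⊗ alt T ⊗ alt T) ⊗ (alt X) ² ⊗ (t ⊗ t ⊗ t) ⊗ g ² ⊗ x ²
    alt-b = begin
      g ² ⊕ ⊝ (⊝ (const (+ 3) ⊗ (q ⊗ t ²)))
        ≈⟨ solve 2 (λ g S → g :- :- (con (+ 3) :* S) := g :- con (ℤ.- + 3) :* S) ≋-refl (g ²) (q ⊗ t ²) ⟩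
      g ² ⊕ ⊝ (const (ℤ.- + 3) ⊗ (q ⊗ t ²))
        ≈⟨ alt-affine (ℤ.- + 3) ⟨
      alt (g ² ⊕ const (ℤ.- + 3) ⊗ (q ⊗ t ²))
        ≈⟨ alt-cong (≋-trans (≋-sym (as-affine (q ⊗ t ²))) relation-b) ⟩
      alt (T ⊗ T ⊗ T ⊗ X ² ⊗ (t ⊗ t ⊗ t) ⊗ g ² ⊗ x ²)
        ≈⟨ ≋-trans (alt-⊗ (T ⊗ T ⊗ T ⊗ X ² ⊗ (t ⊗ t ⊗ t) ⊗ g ²) (x ²)) (⊗-cong
             (≋-trans (alt-⊗ (T ⊗ T ⊗ T ⊗ X ² ⊗ (t ⊗ t ⊗ t)) (g ²)) (⊗-cong
               (≋-trans (alt-⊗ (T ⊗ T ⊗ T ⊗ X ²) (t ⊗ t ⊗ t)) (⊗-cong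
                 (≋-trans (alt-⊗ (T ⊗ T ⊗ T) (X ²)) (⊗-cong (≋-trans (alt-⊗ (T ⊗ T) T) (⊗-cong (alt-⊗ T T) ≋-refl)) (alt-⊗ X X)))
                 (≋-trans (alt-⊗ (t ⊗ t) t) (⊗-cong (≋-trans (alt-⊗ t t) (²-cong (alt-dbl T))) (alt-dbl T)))))
               (≋-trans (alt-⊗ g g) (²-cong (alt-dbl G)))))
             (≋-trans (alt-⊗ x x) (²-cong (alt-dbl X)))) ⟩
      (alt T ⊗ alt T ⊗ alt T) ⊗ (alt X) ² ⊗ (t ⊗ t ⊗ t) ⊗ g ² ⊗ x ² ∎

  private
    u v : Series
    u = g ² ⊕ ⊝ (const (+ 3) ⊗ (q ⊗ t ²))
    v = g ² ⊕ q ⊗ t ²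

  -- F contains T⁵ and X⁶. As u carries T³ X² and v carries X² / T, the combination u² v has exactly
  -- these powers; everything else is a series in q².
  F-cubic : t ² ⊗ F ≋ g ⊗ f ⁶ ⊗ (u ² ⊗ v)
  F-cubic = ⊗-cancel T T-unit (begin
    T ⊗ (t ² ⊗ F)
      ≈⟨ ⊗-cong {T} ≋-refl (⊗-cong {t ²} ≋-refl (≋-trans F-product (⊗-cong (⁵-cong (⊗-cong {T} ≋-refl G≋tg)) (⁶-cong (⊗-cong {X} ≋-refl Φ≋xf))))) ⟩
    T ⊗ (t ² ⊗ ((T ⊗ (t ⊗ g)) ⁵ ⊗ (X ⊗ (x ⊗ f)) ⁶))
      ≈⟨ solve 6 (λ T t g X x f → let a = T :* (t :* g) ; a² = a :* a ; b = X :* (x :* f) ; b² = b :* b ; f² = f :* f ; p = T :* T :* T :* (X :* X) :* (t :* t :* t) :* (g :* g) :* (x :* x) in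
           T :* (t :* t :* (a² :* a² :* a :* (b² :* b² :* b²))) := g :* (f² :* f² :* f²) :* (p :* p :* (t :* (X :* X) :* (x :* x))))
           ≋-refl T t g X x f ⟩
    g ⊗ f ⁶ ⊗ ((T ⊗ T ⊗ T ⊗ X ² ⊗ (t ⊗ t ⊗ t) ⊗ g ² ⊗ x ²) ² ⊗ (t ⊗ X ² ⊗ x ²))
      ≈⟨ ⊗-cong {g ⊗ f ⁶} ≋-refl (⊗-cong (²-cong (≋-sym relation-b)) (≋-sym relation-a)) ⟩
    g ⊗ f ⁶ ⊗ (u ² ⊗ (T ⊗ v))
      ≈⟨ solve 4 (λ a u T v → a :* (u :* (T :* v)) := T :* (a :* (u :* v))) ≋-refl (g ⊗ f ⁶) (u ²) T v ⟩
    T ⊗ (g ⊗ f ⁶ ⊗ (u ² ⊗ v)) ∎)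
    where open ≋-Reasoning

  -- The same count for F°, which contains T and X⁶: these are the powers in u v².
  F°-cubic : t ⁴ ⊗ g ⊗ F° ≋ f ⁶ ⊗ (u ⊗ v ²)
  F°-cubic = ⊗-cancel (T ⊗ T) (⊗-unit {T} {T} T-unit T-unit) (begin
    T ⊗ T ⊗ (t ⁴ ⊗ g ⊗ F°)
      ≈⟨ ⊗-cong {T ⊗ T} ≋-refl (⊗-cong {t ⁴ ⊗ g} ≋-refl (≋-trans F°-product (⊗-cong (⊗-cong {T} ≋-refl G≋tg) (⁶-cong (⊗-cong {X} ≋-refl Φ≋xf))))) ⟩
    T ⊗ T ⊗ (t ⁴ ⊗ g ⊗ (T ⊗ (t ⊗ g) ⊗ (X ⊗ (x ⊗ f)) ⁶))
      ≈⟨ solve 6 (λ T t g X x f → let t² = t :* t ; b = X :* (x :* f) ; b² = b :* b ; f² = f :* f ; p = T :* T :* T :* (X :* X) :* (t :* t :* t) :* (g :* g) :* (x :* x) ; r = t :* (X :* X) :* (x :* x) in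
           T :* T :* (t² :* t² :* g :* (T :* (t :* g) :* (b² :* b² :* b²))) := f² :* f² :* f² :* (p :* (r :* r)))
           ≋-refl T t g X x f ⟩
    f ⁶ ⊗ ((T ⊗ T ⊗ T ⊗ X ² ⊗ (t ⊗ t ⊗ t) ⊗ g ² ⊗ x ²) ⊗ (t ⊗ X ² ⊗ x ²) ²)
      ≈⟨ ⊗-cong {f ⁶} ≋-refl (⊗-cong (≋-sym relation-b) (²-cong (≋-sym relation-a))) ⟩
    f ⁶ ⊗ (u ⊗ (T ⊗ v) ²)
      ≈⟨ solve 4 (λ a u T v → a :* (u :* ((T :* v) :* (T :* v))) := T :* T :* (a :* (u :* (v :* v)))) ≋-refl (f ⁶) u T v ⟩
    T ⊗ T ⊗ (f ⁶ ⊗ (u ⊗ v ²)) ∎)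
    where open ≋-Reasoning

  alt-t² : alt (t ²) ≋ t ²
  alt-t² = ≋-trans (alt-⊗ t t) (²-cong (alt-dbl T))

  alt-g² : alt (g ²) ≋ g ²
  alt-g² = ≋-trans (alt-⊗ g g) (²-cong (alt-dbl G))

  -- Used with S′ = S and S′ = ⊝ S: the parity of A ⊗ S is the parity of S.
  alt-quotient : ∀ {A S M M′} → Unit A → alt A ≋ A → A ⊗ S ≋ M → alt M ≋ M′ → ∀ S′ → A ⊗ S′ ≋ M′ → alt S ≋ S′
  alt-quotient {A} {S} {M} {M′} unit even-A eq altM S′ eq′ = ⊗-cancel A unit (begin
    A ⊗ alt S        ≈⟨ ⊗-cong (≋-sym even-A) ≋-refl ⟩
    alt A ⊗ alt S    ≈⟨ alt-⊗ A S ⟨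
    alt (A ⊗ S)      ≈⟨ alt-cong eq ⟩
    alt M            ≈⟨ altM ⟩
    M′               ≈⟨ eq′ ⟨
    A ⊗ S′           ∎)
    where open ≋-Reasoning

  -- Half of the dissection: q times this series at q² will be the odd part of F. `F°-even` is the
  -- analogue for the even part of F°.
  F-odd : Series
  F-odd = const (+ 4) ⊗ dbl F ⊕ ⊝ (const (+ 9) ⊗ F°)

  F°-even : Series
  F°-even = F ⊕ const (+ 4) ⊗ (q ⊗ dbl F°)

  dbl-F-odd : dbl F-odd ≋ g ⊗ f ⁶ ⊗ (const (+ 9) ⊗ (q ² ⊗ t ⁴) ⊕ ⊝ (const (+ 5) ⊗ g ⁴))
  dbl-F-odd = begin
    dbl (const (+ 4) ⊗ dbl F ⊕ ⊝ (const (+ 9) ⊗ F°))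
      ≈⟨ dbl-cong (solve 2 (λ a b → con (+ 4) :* a :- con (+ 9) :* b := con (+ 4) :* a :+ con (ℤ.- + 9) :* b) ≋-refl (dbl F) F°) ⟩
    dbl (const (+ 4) ⊗ dbl F ⊕ const (ℤ.- + 9) ⊗ F°)
      ≈⟨ ≋-trans (dbl-⊕ (const (+ 4) ⊗ dbl F) (const (ℤ.- + 9) ⊗ F°)) (⊕-cong
           (≋-trans (dbl-⊗ (const (+ 4)) (dbl F)) (⊗-cong (dbl-const (+ 4)) dbl²-F))
           (≋-trans (dbl-⊗ (const (ℤ.- + 9)) F°) (⊗-cong (dbl-const (ℤ.- + 9)) dbl-F°))) ⟩
    const (+ 4) ⊗ (g ⁵ ⊗ f ⁶) ⊕ const (ℤ.- + 9) ⊗ (t ⊗ g ⊗ (x ⊗ f) ⁶)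
      ≈⟨ solve 4 (λ g f t x → let f² = f :* f ; f⁶ = f² :* f² :* f² ; x² = x :* x ; x⁶ = x² :* x² :* x² ; b = x :* f ; b² = b :* b ; g² = g :* g ; g⁴ = g² :* g² in
           con (+ 4) :* (g⁴ :* g :* f⁶) :+ con (ℤ.- + 9) :* (t :* g :* (b² :* b² :* b²)) := g :* f⁶ :* (con (+ 4) :* g⁴ :- con (+ 9) :* (t :* x⁶)))
           ≋-refl g f t x ⟩
    g ⊗ f ⁶ ⊗ (const (+ 4) ⊗ g ⁴ ⊕ ⊝ (const (+ 9) ⊗ (t ⊗ x ⁶)))
      ≈⟨ ⊗-cong {g ⊗ f ⁶} ≋-refl (⊕-cong {const (+ 4) ⊗ g ⁴} ≋-refl (⊝-cong (⊗-cong {const (+ 9)} ≋-refl (≋-sym relation-a²)))) ⟩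
    g ⊗ f ⁶ ⊗ (const (+ 4) ⊗ g ⁴ ⊕ ⊝ (const (+ 9) ⊗ (g ⁴ ⊕ ⊝ (q ² ⊗ t ⁴))))
      ≈⟨ ⊗-cong {g ⊗ f ⁶} ≋-refl (solve 2 (λ a b → con (+ 4) :* a :- con (+ 9) :* (a :- b) := con (+ 9) :* b :- con (+ 5) :* a) ≋-refl (g ⁴) (q ² ⊗ t ⁴)) ⟩
    g ⊗ f ⁶ ⊗ (const (+ 9) ⊗ (q ² ⊗ t ⁴) ⊕ ⊝ (const (+ 5) ⊗ g ⁴)) ∎
    where open ≋-Reasoning

  dbl-F°-even : dbl F°-even ≋ g ⊗ f ⁶ ⊗ (t ⁵ ⊗ g ⁴ ⊗ x ⁶ ⊕ const (+ 4) ⊗ q ²)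
  dbl-F°-even = begin
    dbl (F ⊕ const (+ 4) ⊗ (q ⊗ dbl F°))
      ≈⟨ ≋-trans (dbl-⊕ F (const (+ 4) ⊗ (q ⊗ dbl F°))) (⊕-cong dbl-F
           (≋-trans (dbl-⊗ (const (+ 4)) (q ⊗ dbl F°)) (⊗-cong (dbl-const (+ 4))
             (≋-trans (dbl-⊗ q (dbl F°)) (⊗-cong (≋-trans (dbl-q^ 1) (q^-+ 1 1)) dbl²-F°))))) ⟩
    (t ⊗ g) ⁵ ⊗ (x ⊗ f) ⁶ ⊕ const (+ 4) ⊗ (q ² ⊗ (g ⊗ f ⁶))
      ≈⟨ solve 5 (λ t g x f q → let a = t :* g ; a² = a :* a ; b = x :* f ; b² = b :* b ; f² = f :* f ; t² = t :* t ; g² = g :* g ; x² = x :* x in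
           a² :* a² :* a :* (b² :* b² :* b²) :+ con (+ 4) :* (q :* q :* (g :* (f² :* f² :* f²))) :=
           g :* (f² :* f² :* f²) :* (t² :* t² :* t :* (g² :* g²) :* (x² :* x² :* x²) :+ con (+ 4) :* (q :* q))) ≋-refl t g x f q ⟩
    g ⊗ f ⁶ ⊗ (t ⁵ ⊗ g ⁴ ⊗ x ⁶ ⊕ const (+ 4) ⊗ q ²) ∎
    where open ≋-Reasoning

  private
    Even : Series → Set
    Even S = alt S ≋ S

    even-⊗ : ∀ {A B} → Even A → Even B → Even (A ⊗ B)
    even-⊗ {A} {B} p r = ≋-trans (alt-⊗ A B) (⊗-cong p r)

    even-⊕ : ∀ {A B} → Even A → Even B → Even (A ⊕ B)
    even-⊕ {A} {B} p r = ≋-trans (alt-⊕ A B) (⊕-cong p r)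

    even-f⁶ : Even (f ⁶)
    even-f⁶ = even-⊗ {f ⁴} {f ²} (even-⊗ {f ²} {f ²} (even-⊗ {f} {f} (alt-dbl Φ) (alt-dbl Φ)) (even-⊗ {f} {f} (alt-dbl Φ) (alt-dbl Φ))) (even-⊗ {f} {f} (alt-dbl Φ) (alt-dbl Φ))

    even-q² : Even (q ²)
    even-q² = ≋-trans (alt-⊗ q q) (≋-trans (²-cong alt-q) (solve 1 (λ q → :- q :* :- q := q :* q) ≋-refl q))

    even-t⁴ : Even (t ⁴)
    even-t⁴ = even-⊗ {t ²} {t ²} alt-t² alt-t²

    even-g⁴ : Even (g ⁴)
    even-g⁴ = even-⊗ {g ²} {g ²} alt-g² alt-g²

    even-g⁴+3q²t⁴ : Even (g ⁴ ⊕ const (+ 3) ⊗ (q ² ⊗ t ⁴))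
    even-g⁴+3q²t⁴ = even-⊕ {g ⁴} {const (+ 3) ⊗ (q ² ⊗ t ⁴)} even-g⁴
      (even-⊗ {const (+ 3)} {q ² ⊗ t ⁴} (alt-const (+ 3)) (even-⊗ {q ²} {t ⁴} even-q² even-t⁴))

  -- Parity may be tested after multiplying by t². With a = g² and b = q t², u² v = a³ - 5 a² b + 3
  -- a b² + 9 b³; the terms odd in b are those computed in `dbl-F-odd`, and a³ + 3 a b² remains.
  F-even-part : alt (F ⊕ ⊝ (q ⊗ dbl F-odd)) ≋ F ⊕ ⊝ (q ⊗ dbl F-odd)
  F-even-part = alt-quotient (⊗-unit {t} {t} t-unit t-unit) alt-t² quotient even-M S quotient
    where
    open ≋-Reasoning
    S M : Series
    S = F ⊕ ⊝ (q ⊗ dbl F-odd)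
    M = g ⊗ f ⁶ ⊗ (g ² ⊗ (g ⁴ ⊕ const (+ 3) ⊗ (q ² ⊗ t ⁴)))
    even-M : Even M
    even-M = even-⊗ {g ⊗ f ⁶} {g ² ⊗ (g ⁴ ⊕ const (+ 3) ⊗ (q ² ⊗ t ⁴))} (even-⊗ {g} {f ⁶} (alt-dbl G) even-f⁶)
      (even-⊗ {g ²} {g ⁴ ⊕ const (+ 3) ⊗ (q ² ⊗ t ⁴)} alt-g² even-g⁴+3q²t⁴)
    quotient : t ² ⊗ S ≋ M
    quotient = begin
      t ² ⊗ (F ⊕ ⊝ (q ⊗ dbl F-odd))
        ≈⟨ solve 4 (λ a F q d → a :* (F :- q :* d) := a :* F :- a :* q :* d) ≋-refl (t ²) F q (dbl F-odd) ⟩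
      t ² ⊗ F ⊕ ⊝ (t ² ⊗ q ⊗ dbl F-odd)
        ≈⟨ ⊕-cong F-cubic (⊝-cong (⊗-cong {t ² ⊗ q} ≋-refl dbl-F-odd)) ⟩
      g ⊗ f ⁶ ⊗ (u ² ⊗ v) ⊕ ⊝ (t ² ⊗ q ⊗ (g ⊗ f ⁶ ⊗ (const (+ 9) ⊗ (q ² ⊗ t ⁴) ⊕ ⊝ (const (+ 5) ⊗ g ⁴))))
        ≈⟨ solve 4 (λ a g q t → let g² = g :* g ; t² = t :* t ; u = g² :- con (+ 3) :* (q :* t²) ; v = g² :+ q :* t² in
             a :* (u :* u :* v) :- t² :* q :* (a :* (con (+ 9) :* (q :* q :* (t² :* t²)) :- con (+ 5) :* (g² :* g²))) :=
             a :* (g² :* (g² :* g² :+ con (+ 3) :* (q :* q :* (t² :* t²))))) ≋-refl (g ⊗ f ⁶) g q t ⟩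
      M ∎

  -- Here u v² = a³ - a² b - 5 a b² - 3 b³ with a = g² and b = q t². By `relation-b²`, the even
  -- terms a (a² - 5 b²) = a ((a² - 9 b²) + 4 b²) match `F°-even`, leaving -b (a² + 3 b²).
  F°-odd-part : alt (F° ⊕ ⊝ dbl F°-even) ≋ ⊝ (F° ⊕ ⊝ dbl F°-even)
  F°-odd-part = alt-quotient (⊗-unit {t ⁴} {g} (⊗-unit {t ²} {t ²} (⊗-unit {t} {t} t-unit t-unit) (⊗-unit {t} {t} t-unit t-unit)) g-unit)
    (even-⊗ {t ⁴} {g} even-t⁴ (alt-dbl G)) quotient odd-M (⊝ S)
    (≋-trans (solve 2 (λ a S → a :* :- S := :- (a :* S)) ≋-refl (t ⁴ ⊗ g) S) (⊝-cong quotient))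
    where
    open ≋-Reasoning
    S W M : Series
    S = F° ⊕ ⊝ dbl F°-even
    W = f ⁶ ⊗ (t ² ⊗ (g ⁴ ⊕ const (+ 3) ⊗ (q ² ⊗ t ⁴)))
    M = (⊝ q) ⊗ W
    even-W : Even W
    even-W = even-⊗ {f ⁶} {t ² ⊗ (g ⁴ ⊕ const (+ 3) ⊗ (q ² ⊗ t ⁴))} even-f⁶
      (even-⊗ {t ²} {g ⁴ ⊕ const (+ 3) ⊗ (q ² ⊗ t ⁴)} alt-t² even-g⁴+3q²t⁴)
    odd-M : alt M ≋ ⊝ M
    odd-M = ≋-trans (alt-⊗ (⊝ q) W) (≋-trans (⊗-cong (≋-trans (⊝-alt q) (⊝-cong alt-q)) even-W)
      (solve 2 (λ q W → (:- :- q) :* W := :- ((:- q) :* W)) ≋-refl q W))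
    quotient : t ⁴ ⊗ g ⊗ S ≋ M
    quotient = begin
      t ⁴ ⊗ g ⊗ (F° ⊕ ⊝ dbl F°-even)
        ≈⟨ solve 3 (λ a F d → a :* (F :- d) := a :* F :- a :* d) ≋-refl (t ⁴ ⊗ g) F° (dbl F°-even) ⟩
      t ⁴ ⊗ g ⊗ F° ⊕ ⊝ (t ⁴ ⊗ g ⊗ dbl F°-even)
        ≈⟨ ⊕-cong F°-cubic (⊝-cong (⊗-cong {t ⁴ ⊗ g} ≋-refl dbl-F°-even)) ⟩
      f ⁶ ⊗ (u ⊗ v ²) ⊕ ⊝ (t ⁴ ⊗ g ⊗ (g ⊗ f ⁶ ⊗ (t ⁵ ⊗ g ⁴ ⊗ x ⁶ ⊕ const (+ 4) ⊗ q ²)))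
        ≈⟨ ⊕-cong {f ⁶ ⊗ (u ⊗ v ²)} ≋-refl (⊝-cong (≋-trans
             (solve 7 (λ t⁴ t⁵ g h f y p → t⁴ :* g :* (g :* f :* (t⁵ :* h :* y :+ con (+ 4) :* p)) :=
                g :* g :* f :* (t⁴ :* t⁵ :* h :* y :+ con (+ 4) :* (p :* t⁴))) ≋-refl (t ⁴) (t ⁵) g (g ⁴) (f ⁶) (x ⁶) (q ²))
             (⊗-cong {g ² ⊗ f ⁶} ≋-refl (⊕-cong (≋-sym relation-b²) (≋-refl {const (+ 4) ⊗ (q ² ⊗ t ⁴)}))))) ⟩
      f ⁶ ⊗ (u ⊗ v ²) ⊕ ⊝ (g ² ⊗ f ⁶ ⊗ (g ⁴ ⊕ ⊝ (const (+ 9) ⊗ (q ² ⊗ t ⁴)) ⊕ const (+ 4) ⊗ (q ² ⊗ t ⁴)))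
        ≈⟨ solve 4 (λ a g q t → let g² = g :* g ; t² = t :* t ; w = q :* q :* (t² :* t²) ; u = g² :- con (+ 3) :* (q :* t²) ; v = g² :+ q :* t² in
             a :* (u :* (v :* v)) :- g² :* a :* (g² :* g² :- con (+ 9) :* w :+ con (+ 4) :* w) :=
             (:- q) :* (a :* (t² :* (g² :* g² :+ con (+ 3) :* w)))) ≋-refl (f ⁶) g q t ⟩
      M ∎

  difference-zero : ∀ {a b} → a ℤ.+ ℤ.- b ≈₇ 0ℤ → a ≈₇ b
  difference-zero {a} {b} p = ≈₇-trans (≈₇-reflexive (lemma a b)) (≈₇-trans (+-cong₇ p (≈₇-refl {b})) (≈₇-reflexive (ℤ.+-identityˡ b)))
    where
    lemma : ∀ a b → a ≡ a ℤ.+ ℤ.- b ℤ.+ b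
    lemma = solve-∀ℤ

  q-⊗-suc : ∀ S n → (q ⊗ S) (suc n) ≈₇ S n
  q-⊗-suc S n = q-⊗ S at suc n

  F-at-odd : ∀ n → F (suc (n + n)) ≈₇ + 4 ℤ.* dbl F n ℤ.- + 9 ℤ.* F° n
  F-at-odd n = ≈₇-trans (difference-zero (even-series F-even-part n))
    (≈₇-trans (q-⊗-suc (dbl F-odd) (n + n)) (≈₇-reflexive (trans (dbl-even F-odd n)
      (cong₂ (λ a b → a ℤ.- b) (const-⊗ (+ 4) (dbl F) n) (const-⊗ (+ 9) F° n)))))

  F°-at-even : ∀ n → F° (n + n) ≈₇ F n ℤ.+ + 4 ℤ.* (q ⊗ dbl F°) n
  F°-at-even n = ≈₇-trans (difference-zero (odd-series F°-odd-part n))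
    (≈₇-reflexive (trans (dbl-even F°-even n) (cong (ℤ._+_ (F n)) (const-⊗ (+ 4) (q ⊗ dbl F°) n))))

  -- The dissections express F at 4 N + 1 through F at N and F° at n, and F at N through `dbl F` and
  -- F° at n. Eliminating F° at n gives the recurrence.
  F-recurrence : ∀ n → let N = suc (n + n) in
                 F (suc (N + N + (N + N))) ≈₇ ℤ.- F N ℤ.- + 16 ℤ.* dbl F n
  F-recurrence n = ≈₇-trans (F-at-odd (N + N)) (≈₇-trans
    (+-cong₇ (≈₇-reflexive (cong (+ 4 ℤ.*_) (dbl-even F N)))
             (-‿cong₇ (*-cong₇ (≈₇-refl {+ 9}) (≈₇-trans (F°-at-even N)
                (+-cong₇ (≈₇-refl {F N}) (*-cong₇ (≈₇-refl {+ 4}) q-dbl-F°))))))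
    (combine (F N) (dbl F n) (F° n) (F-at-odd n)))
    where
    N = suc (n + n)
    q-dbl-F° : (q ⊗ dbl F°) N ≈₇ F° n
    q-dbl-F° = ≈₇-trans (q-⊗-suc (dbl F°) (n + n)) (≈₇-reflexive (dbl-even F° n))
    combine : ∀ a z y → a ≈₇ + 4 ℤ.* z ℤ.- + 9 ℤ.* y →
              + 4 ℤ.* a ℤ.- + 9 ℤ.* (a ℤ.+ + 4 ℤ.* y) ≈₇ ℤ.- a ℤ.- + 16 ℤ.* z
    combine a z y (differBy k refl) = differBy (ℤ.- (+ 4 ℤ.* k)) (lemma z y k)
      where
      lemma : ∀ z y k → let a = + 4 ℤ.* z ℤ.- + 9 ℤ.* y ℤ.+ + 7 ℤ.* k in
        + 4 ℤ.* a ℤ.- + 9 ℤ.* (a ℤ.+ + 4 ℤ.* y) ≡ ℤ.- a ℤ.- + 16 ℤ.* z ℤ.+ + 7 ℤ.* (ℤ.- (+ 4 ℤ.* k))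
      lemma = solve-∀ℤ

  F-recurrence₁ : ∀ n → F (suc (4 * suc (4 * n))) ≈₇ ℤ.- F (suc (4 * n)) ℤ.- + 16 ℤ.* F n
  F-recurrence₁ n = subst₂ (λ i j → F i ≈₇ ℤ.- F j ℤ.- + 16 ℤ.* F n) (index₁ n) (index₂ n)
    (≈₇-trans (F-recurrence (n + n)) (≈₇-reflexive (cong (λ z → ℤ.- F (suc (n + n + (n + n))) ℤ.- + 16 ℤ.* z) (dbl-even F n))))
    where
    index₁ : ∀ n → let N = suc (n + n + (n + n)) in suc (N + N + (N + N)) ≡ suc (4 * suc (4 * n))
    index₁ = solve-∀ℕ
    index₂ : ∀ n → suc (n + n + (n + n)) ≡ suc (4 * n)
    index₂ = solve-∀ℕ

  -- For N = 4 n + 3 the `dbl F` term is read at an odd index and vanishes.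
  F-recurrence₂ : ∀ n → F (suc (4 * (4 * n + 3))) ≈₇ ℤ.- F (4 * n + 3)
  F-recurrence₂ n = subst₂ (λ i j → F i ≈₇ ℤ.- F j) (index₁ n) (index₂ n)
    (≈₇-trans (F-recurrence (suc (n + n))) (≈₇-reflexive (trans
      (cong (λ z → ℤ.- F N ℤ.- + 16 ℤ.* z) (dbl-odd F n)) (ℤ.+-identityʳ (ℤ.- F N)))))
    where
    N = suc (suc (n + n) + suc (n + n))
    index₁ : ∀ n → let N = suc (suc (n + n) + suc (n + n)) in suc (N + N + (N + N)) ≡ suc (4 * (4 * n + 3))
    index₁ = solve-∀ℕ
    index₂ : ∀ n → suc (suc (n + n) + suc (n + n)) ≡ 4 * n + 3
    index₂ = solve-∀ℕ

-- Generating functions of regular partitions.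

only : ∀ {P : Set} → Dec P → Series → Series
only P? S = if does P? then S else 0ₛ

only-yes : ∀ {P : Set} (P? : Dec P) {S} → P → only P? S ≡ S
only-yes P? {S} p = cong (if_then S else 0ₛ) (dec-true P? p)

only-no : ∀ {P : Set} (P? : Dec P) {S} → ¬ P → only P? S ≡ 0ₛ
only-no P? {S} ¬p = cong (if_then S else 0ₛ) (dec-false P? ¬p)

only-⇔ : ∀ {P Q : Set} → P ⇔ Q → (P? : Dec P) (Q? : Dec Q) {S : Series} → only P? S ≡ only Q? S
only-⇔ P⇔Q P? Q? {S} = cong (if_then S else 0ₛ) (does-⇔ P⇔Q P? Q?)

only-vanish : ∀ {P : Set} (P? : Dec P) {N S} → S ≈[ N ] 0ₛ → only P? S ≈[ N ] 0ₛ
only-vanish P? p with does P?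
... | true  = p
... | false = ≈[]-refl

only-⊗ : ∀ {P Q : Set} (P? : Dec P) (Q? : Dec Q) S T → only P? S ⊗ only Q? T ≋ only (P? ×-dec Q?) (S ⊗ T)
only-⊗ P? Q? S T with does P? | does Q?
... | true  | true  = ≋-refl
... | true  | false = R.zeroʳ S
... | false | _     = R.zeroˡ _

weight : List ℕ → Series
weight ps = q^ sum ps

-- The weight bound alone admits infinitely many lists of a given sum, since zeros can be inserted.
-- Support on partitions makes `boundedLists` exhaustive.
record Graded (t : List ℕ → Series) : Set where
  field
    high      : ∀ ps → t ps ≈[ sum ps ] 0ₛ
    supported : ∀ ps → IsPartition ps ⊎ t ps ≋ 0ₛ
open Graded

total : (List ℕ → Series) → Series
total t n = ∑ t (boundedLists n n) n

graded-cover : ∀ {t} → Graded t → ∀ N ps → ps ∈ boundedLists N N ⊎ t ps ≈[ suc N ] 0ₛ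
graded-cover gr N ps with sum ps ≤? N | supported gr ps
... | yes sum≤N | inj₁ part = inj₁ (∈-boundedLists-partition part sum≤N)
... | _         | inj₂ t≋0  = inj₂ (≋⇒≈[] t≋0)
... | no sum≰N  | _         = inj₂ (≈[]-weaken (≰⇒> sum≰N) (high gr ps))

total≈∑ : ∀ {t} → Graded t → ∀ N → total t ≈[ suc N ] ∑ t (boundedLists N N)
total≈∑ {t} gr N = below λ {n} n<1+N →
  ∑-unique {N = suc n} t (boundedLists-unique n n) (boundedLists-unique N N)
    (λ {ps} _ → case graded-cover gr N ps of λ where
      (inj₁ ps∈) → inj₁ ps∈
      (inj₂ z)   → inj₂ (≈[]-weaken n<1+N z))
    (λ {ps} _ → graded-cover gr n ps) at< ≤-refl

total-HasSum : ∀ {t} → Graded t → HasSum t (total t)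
total-HasSum gr = hasSum λ N →
    boundedLists N N , boundedLists-unique N N
  , (λ ps → case graded-cover gr N ps of λ where
       (inj₁ ps∈) → inj₁ ps∈
       (inj₂ z)   → inj₂ (≈[]-weaken (n≤1+n N) z))
  , ≈[]-weaken (n≤1+n N) (total≈∑ gr N)

total-cong[] : ∀ {t u} N → (∀ ps → t ps ≈[ N ] u ps) → total t ≈[ N ] total u
total-cong[] N p = below λ {n} n<N → ∑-cong[] (boundedLists n n) p at< n<N

total-cong : ∀ {t u} → (∀ ps → t ps ≋ u ps) → total t ≋ total u
total-cong p = ≈[]⇒≋ λ N → total-cong[] N (λ ps → ≋⇒≈[] (p ps))

total-⊕ : ∀ t u → total (λ ps → t ps ⊕ u ps) ≋ total t ⊕ total u
total-⊕ t u = pointwise λ n → ∑-⊕ (boundedLists n n) at n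
  where
  ∑-⊕ : ∀ is → ∑ (λ ps → t ps ⊕ u ps) is ≋ ∑ t is ⊕ ∑ u is
  ∑-⊕ []       = ≋-sym (R.+-identityˡ 0ₛ)
  ∑-⊕ (i ∷ is) = ≋-trans (⊕-cong {t i ⊕ u i} ≋-refl (∑-⊕ is))
    (solve 4 (λ a b c d → a :+ b :+ (c :+ d) := a :+ c :+ (b :+ d)) ≋-refl (t i) (u i) (∑ t is) (∑ u is))

-- Each part bounds the next one, so the parts are in decreasing order.
RegularUpTo : ℕ → ℕ → List ℕ → Set
RegularUpTo l k []       = ⊤
RegularUpTo l k (p ∷ ps) = p > 0 × p ≤ k × l ∤ p × RegularUpTo l p ps

regularUpTo? : ∀ l k ps → Dec (RegularUpTo l k ps)
regularUpTo? l k []       = yes tt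
regularUpTo? l k (p ∷ ps) = p >? 0 ×-dec p ≤? k ×-dec ¬? (l ∣? p) ×-dec regularUpTo? l p ps

regularUpTo⇒regular : ∀ {l k} ps → RegularUpTo l k ps → IsRegularPartition l ps
regularUpTo⇒regular []           _ = ([] , []) , []
regularUpTo⇒regular (p ∷ [])     (p>0 , _ , l∤p , _) = ([-] , p>0 ∷ []) , l∤p ∷ []
regularUpTo⇒regular (p ∷ r ∷ ps) (p>0 , _ , l∤p , rest) with regularUpTo⇒regular (r ∷ ps) rest
... | (linked , pos) , reg = (proj₁ (proj₂ rest) ∷ linked , p>0 ∷ pos) , l∤p ∷ reg

regular⇒regularUpTo : ∀ {l k} ps → All (_≤ k) ps → IsRegularPartition l ps → RegularUpTo l k ps
regular⇒regularUpTo []           _             _ = tt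
regular⇒regularUpTo (p ∷ [])     (p≤k ∷ _) ((_ , p>0 ∷ _) , l∤p ∷ _) = p>0 , p≤k , l∤p , tt
regular⇒regularUpTo (p ∷ r ∷ ps) (p≤k ∷ _) ((p≥r ∷ linked , p>0 ∷ pos) , l∤p ∷ reg)
  with regular⇒regularUpTo (r ∷ ps) (p≥r ∷ All.map (λ s≤r → ≤-trans s≤r p≥r) (below-head linked)) ((linked , pos) , reg)
  where
  below-head : ∀ {r ps} → Linked _≥_ (r ∷ ps) → All (_≤ r) ps
  below-head [-]            = []
  below-head (r≥s ∷ linked) = r≥s ∷ All.map (λ u≤s → ≤-trans u≤s r≥s) (below-head linked)
... | rest = p>0 , p≤k , l∤p , rest

regularUpTo-step : ∀ {l k ps} → RegularUpTo l k ps → RegularUpTo l (suc k) ps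
regularUpTo-step {ps = []}    _ = tt
regularUpTo-step {ps = _ ∷ _} (p>0 , p≤k , rest) = p>0 , m≤n⇒m≤1+n p≤k , rest

term≤ : ℕ → ℕ → List ℕ → Series
term≤ l k ps = only (regularUpTo? l k ps) (weight ps)

term : ℕ → List ℕ → Series
term l ps = only (isRegularPartition? l ps) (weight ps)

term≤-graded : ∀ l k → Graded (term≤ l k)
term≤-graded l k .high ps = only-vanish (regularUpTo? l k ps) (q^≈0 ≤-refl)
term≤-graded l k .supported ps with regularUpTo? l k ps
... | yes reg = inj₁ (proj₁ (regularUpTo⇒regular ps reg))
... | no ¬reg = inj₂ ≋-refl

term-graded : ∀ l → Graded (term l)
term-graded l .high ps = only-vanish (isRegularPartition? l ps) (q^≈0 ≤-refl)
term-graded l .supported ps = case isRegularPartition? l ps of λ where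
  (yes reg) → inj₁ (proj₁ reg)
  (no ¬reg) → inj₂ (≡⇒≋ (only-no (isRegularPartition? l ps) ¬reg))

Regulars≤ : ℕ → ℕ → Series
Regulars≤ l k = total (term≤ l k)

Regulars : ℕ → Series
Regulars l = total (term l)

regulars≤-zero : ∀ l → Regulars≤ l 0 ≋ 1ₛ
regulars≤-zero l = HasSum-unique (total-HasSum (term≤-graded l 0)) (hasSum λ N →
  [] ∷ [] , [] ∷ [] , cover N , ≋⇒≈[] (≋-sym (R.+-identityʳ 1ₛ)))
  where
  cover : ∀ N ps → ps ∈ [] ∷ [] ⊎ term≤ l 0 ps ≈[ N ] 0ₛ
  cover N []       = inj₁ (here refl)
  cover N (p ∷ ps) = inj₂ (≋⇒≈[] (≡⇒≋ (only-no (regularUpTo? l 0 (p ∷ ps))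
    λ { (p>0 , p≤0 , _) → <⇒≱ p>0 p≤0 })))

regulars≤-divisible : ∀ {l k} → l ∣ suc k → Regulars≤ l (suc k) ≋ Regulars≤ l k
regulars≤-divisible {l} {k} l∣k = total-cong λ ps → ≡⇒≋ (only-⇔ (mk⇔ (back ps) regularUpTo-step) (regularUpTo? l (suc k) ps) (regularUpTo? l k ps))
  where
  back : ∀ ps → RegularUpTo l (suc k) ps → RegularUpTo l k ps
  back []       _ = tt
  back (p ∷ ps) (p>0 , p≤1+k , l∤p , rest) = p>0 , ≤-pred (≤∧≢⇒< p≤1+k (λ { refl → l∤p l∣k })) , l∤p , rest

-- Either all parts are at most k, or the largest part is k + 1. In the second case removing it
-- leaves an arbitrary regular partition with parts at most k + 1, possibly containing k + 1 again.
regulars≤-indivisible : ∀ {l k} → l ∤ suc k → Regulars≤ l (suc k) ≋ Regulars≤ l k ⊕ q^ suc k ⊗ Regulars≤ l (suc k)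
regulars≤-indivisible {l} {k} l∤k = ≋-trans (total-cong split) (≋-trans (total-⊕ (term≤ l k) headed)
  (⊕-cong {Regulars≤ l k} ≋-refl (HasSum-unique (total-HasSum headed-graded)
    (HasSum-embed (suc k ∷_) (proj₂ ∘ ∷-injective) cover
      (HasSum-cong (λ ps → ≡⇒≋ (sym (headed-suc ps))) (HasSum-scale (q^ suc k) (total-HasSum (term≤-graded l (suc k)))))))))
  where
  headed : List ℕ → Series
  headed []       = 0ₛ
  headed (p ∷ ps) = only (p ≟ suc k) (q^ suc k ⊗ term≤ l (suc k) ps)
  headed-suc : ∀ ps → headed (suc k ∷ ps) ≡ q^ suc k ⊗ term≤ l (suc k) ps
  headed-suc ps = only-yes (suc k ≟ suc k) refl
  cover : ∀ ps → (∃ λ rs → suc k ∷ rs ≡ ps) ⊎ headed ps ≋ 0ₛ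
  cover []       = inj₂ ≋-refl
  cover (p ∷ ps) = case p ≟ suc k of λ where
    (yes refl) → inj₁ (ps , refl)
    (no p≢)    → inj₂ (≡⇒≋ (only-no (p ≟ suc k) p≢))
  weight-⊗ : ∀ ps → q^ suc k ⊗ weight ps ≋ weight (suc k ∷ ps)
  weight-⊗ ps = ≋-sym (q^-+ (suc k) (sum ps))
  headed≋ : ∀ ps → headed (suc k ∷ ps) ≋ term≤ l (suc k) (suc k ∷ ps)
  headed≋ ps = ≋-trans (≡⇒≋ (headed-suc ps)) (case regularUpTo? l (suc k) ps of λ where
    (yes reg) → ≋-trans (⊗-cong {q^ suc k} ≋-refl (≡⇒≋ (only-yes (regularUpTo? l (suc k) ps) reg))) (≋-trans (weight-⊗ ps)
      (≡⇒≋ (sym (only-yes (regularUpTo? l (suc k) (suc k ∷ ps)) (z<s , ≤-refl , l∤k , reg)))))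
    (no ¬reg) → ≋-trans (⊗-cong {q^ suc k} ≋-refl (≡⇒≋ (only-no (regularUpTo? l (suc k) ps) ¬reg))) (≋-trans (R.zeroʳ (q^ suc k))
      (≡⇒≋ (sym (only-no (regularUpTo? l (suc k) (suc k ∷ ps)) λ (_ , _ , _ , reg) → ¬reg reg)))))
  split : ∀ ps → term≤ l (suc k) ps ≋ term≤ l k ps ⊕ headed ps
  split []       = ≋-sym (R.+-identityʳ 1ₛ)
  split (p ∷ ps) = case p ≟ suc k of λ where
    (yes refl) → ≋-trans (≋-sym (headed≋ ps)) (≋-trans (≋-sym (R.+-identityˡ (headed (suc k ∷ ps))))
      (⊕-cong {u = headed (suc k ∷ ps)} (≡⇒≋ (sym (only-no (regularUpTo? l k (suc k ∷ ps)) λ { (_ , 1+k≤k , _) → 1+n≰n 1+k≤k }))) ≋-refl))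
    (no p≢) → ≋-trans (≡⇒≋ (only-⇔ (mk⇔ (λ (p>0 , p≤ , rest) → p>0 , ≤-pred (≤∧≢⇒< p≤ p≢) , rest) (regularUpTo-step {ps = p ∷ ps}))
        (regularUpTo? l (suc k) (p ∷ ps)) (regularUpTo? l k (p ∷ ps))))
      (≋-trans (≋-sym (R.+-identityʳ (term≤ l k (p ∷ ps)))) (⊕-cong {term≤ l k (p ∷ ps)} ≋-refl (≡⇒≋ (sym (only-no (p ≟ suc k) p≢)))))
  headed-graded : Graded headed
  headed-graded .high []       = ≈[]-refl
  headed-graded .high (p ∷ ps) = case p ≟ suc k of λ where
    (yes refl) → ≈[]-trans (≋⇒≈[] (headed≋ ps)) (high (term≤-graded l (suc k)) (suc k ∷ ps))
    (no p≢)    → ≋⇒≈[] (≡⇒≋ (only-no (p ≟ suc k) p≢))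
  headed-graded .supported []       = inj₂ ≋-refl
  headed-graded .supported (p ∷ ps) = case p ≟ suc k of λ where
    (yes refl) → case supported (term≤-graded l (suc k)) (suc k ∷ ps) of λ where
      (inj₁ part) → inj₁ part
      (inj₂ z)    → inj₂ (≋-trans (headed≋ ps) z)
    (no p≢)    → inj₂ (≡⇒≋ (only-no (p ≟ suc k) p≢))

module _ (l : ℕ) where

  indivisible divisible : ℕ → Series
  indivisible i = if does (l ∣? suc i) then 1ₛ else factor -1ℤ (suc i)
  divisible   i = if does (l ∣? suc i) then factor -1ℤ (suc i) else 1ₛ

  indivisible-conv : Convergent indivisible
  indivisible-conv i with does (l ∣? suc i)
  ... | true  = ≈[]-refl
  ... | false = factor≈1 -1ℤ (n≤1+n i)

  divisible-conv : Convergent divisible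
  divisible-conv i with does (l ∣? suc i)
  ... | true  = factor≈1 -1ℤ (n≤1+n i)
  ... | false = ≈[]-refl

  f₁-factors : f₁ ≋ Π indivisible ⊗ Π divisible
  f₁-factors = ≋-sym (≋-trans (Π-⊗ indivisible-conv divisible-conv) (Π-cong λ i →
      ≋-trans (combine i) (≡⇒≋ (cong (λ j → factor -1ℤ (suc j)) (sym (+-identityʳ i))))))
    where
    combine : ∀ i → indivisible i ⊗ divisible i ≋ factor -1ℤ (suc i)
    combine i with does (l ∣? suc i)
    ... | true  = R.*-identityˡ (factor -1ℤ (suc i))
    ... | false = R.*-identityʳ (factor -1ℤ (suc i))

  regulars≤-product : ∀ k → Regulars≤ l k ⊗ ∏< k indivisible ≋ 1ₛ
  regulars≤-product zero = ≋-trans (R.*-identityʳ (Regulars≤ l 0)) (regulars≤-zero l)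
  regulars≤-product (suc k) = ≋-trans (solve 3 (λ r p i → r :* (p :* i) := r :* i :* p) ≋-refl (Regulars≤ l (suc k)) (∏< k indivisible) (indivisible k))
    (≋-trans (⊗-cong step (≋-refl {∏< k indivisible})) (regulars≤-product k))
    where
    step : Regulars≤ l (suc k) ⊗ indivisible k ≋ Regulars≤ l k
    step with l ∣? suc k
    ... | yes l∣k = ≋-trans (R.*-identityʳ (Regulars≤ l (suc k))) (regulars≤-divisible l∣k)
    ... | no l∤k  = begin
      W ⊗ factor -1ℤ (suc k)
        ≈⟨ solve 2 (λ w q → w :* (con 1ℤ :+ con -1ℤ :* q) := w :- q :* w) ≋-refl W (q^ suc k) ⟩
      W ⊕ ⊝ (q^ suc k ⊗ W)
        ≈⟨ ⊕-cong (regulars≤-indivisible l∤k) (≋-refl {⊝ (q^ suc k ⊗ W)}) ⟩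
      Regulars≤ l k ⊕ q^ suc k ⊗ W ⊕ ⊝ (q^ suc k ⊗ W)
        ≈⟨ solve 2 (λ a b → a :+ b :- b := a) ≋-refl (Regulars≤ l k) (q^ suc k ⊗ W) ⟩
      Regulars≤ l k ∎
      where
      open ≋-Reasoning
      W = Regulars≤ l (suc k)

  regulars-approx : ∀ N → Regulars l ≈[ N ] Regulars≤ l N
  regulars-approx N = total-cong[] N λ ps → case sum ps ≤? N of λ where
    (yes sum≤N) → ≋⇒≈[] (≡⇒≋ (only-⇔
      (mk⇔ (regular⇒regularUpTo ps (All.map (λ p≤ → ≤-trans p≤ sum≤N) (parts≤sum ps))) (regularUpTo⇒regular ps))
      (isRegularPartition? l ps) (regularUpTo? l N ps)))
    (no sum≰N)  → ≈[]-trans (≈[]-weaken (<⇒≤ (≰⇒> sum≰N)) (high (term-graded l) ps))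
                            (≈[]-sym (≈[]-weaken (<⇒≤ (≰⇒> sum≰N)) (high (term≤-graded l N) ps)))

  regulars-product : Regulars l ⊗ Π indivisible ≋ 1ₛ
  regulars-product = ≈[]⇒≋ λ N → ≈[]-trans (⊗-cong[] (regulars-approx N) (Π≈∏< indivisible-conv ≤-refl)) (≋⇒≈[] (regulars≤-product N))

  regulars-f₁ : Regulars l ⊗ f₁ ≋ Π divisible
  regulars-f₁ = begin
    Regulars l ⊗ f₁                                ≈⟨ ⊗-cong {Regulars l} ≋-refl f₁-factors ⟩
    Regulars l ⊗ (Π indivisible ⊗ Π divisible)     ≈⟨ R.*-assoc (Regulars l) (Π indivisible) (Π divisible) ⟨
    Regulars l ⊗ Π indivisible ⊗ Π divisible       ≈⟨ ⊗-cong regulars-product (≋-refl {Π divisible}) ⟩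
    1ₛ ⊗ Π divisible                               ≈⟨ R.*-identityˡ (Π divisible) ⟩
    Π divisible                                    ∎
    where open ≋-Reasoning

∏<-ones : ∀ {u} n → (∀ i → i < n → u i ≋ 1ₛ) → ∏< n u ≋ 1ₛ
∏<-ones zero    p = ≋-refl
∏<-ones (suc n) p = ≋-trans (⊗-cong (∏<-ones n λ i i<n → p i (m≤n⇒m≤1+n i<n)) (p n ≤-refl)) (R.*-identityʳ 1ₛ)

-- Factor i carries exponent i + 1, so in each block of l consecutive factors only the last one is
-- not 1.
divisible-product : ∀ l′ → let l = suc l′ in Π (divisible l) ≋ euler l l
divisible-product l′ = ≋-trans (Π-blocks (divisible-conv l) l) (≋-trans
    (⊗-cong (∏<-ones l′ λ r r<l′ → ≋-trans (Π-cong λ i → not-multiple r i r<l′) Π-ones)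
            (Π-cong {λ i → divisible l (l′ + l * i)} multiple))
    (R.*-identityˡ (euler l l)))
  where
  l = suc l′
  Π-ones : Π (λ _ → 1ₛ) ≋ 1ₛ
  Π-ones = pointwise λ n → ∏<-ones (suc n) (λ _ _ → ≋-refl) at n
  multiple : ∀ i → divisible l (l′ + l * i) ≋ factor -1ℤ (l + l * i)
  multiple i = ≡⇒≋ (cong (λ b → if b then factor -1ℤ (l + l * i) else 1ₛ)
    (dec-true (l ∣? (l + l * i)) (divides (suc i) (cong (λ z → l + z) (*-comm l i)))))
  not-multiple : ∀ r i → r < l′ → divisible l (r + l * i) ≋ 1ₛ
  not-multiple r i r<l′ = ≡⇒≋ (cong (λ b → if b then factor -1ℤ (suc r + l * i) else 1ₛ)
    (dec-false (l ∣? (suc r + l * i)) λ l∣ →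
      <⇒≱ (s≤s r<l′) (∣⇒≤ (∣m+n∣m⇒∣n (subst (l ∣_) (+-comm (suc r) (l * i)) l∣) (m∣m*n i)))))

-- Bipartitions and the reduction to F modulo 7.

B-series : ℕ → ℕ → Series
B-series l m n = + B l m n

count : ∀ {I : Set} {P : I → Set} (P? : ∀ i → Dec (P i)) (w : I → Series) n →
  (∀ i → w i n ≡ (if does (P? i) then 1ℤ else 0ℤ)) → ∀ is → ∑ w is n ≡ + length (filter P? is)
count P? w n p [] = 0ₛ-at n
count P? w n p (i ∷ is) rewrite p i with does (P? i)
... | true  = cong (ℤ._+_ 1ℤ) (count P? w n p is)
... | false = trans (ℤ.+-identityˡ (∑ w is n)) (count P? w n p is)

q^-at : ∀ k n → (q^ k) n ≡ (if does (k ≟ n) then 1ℤ else 0ℤ)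
q^-at zero    zero    = refl
q^-at zero    (suc n) = refl
q^-at (suc k) zero    = refl
q^-at (suc k) (suc n) = q^-at k n

-- Modulo q^(n+1) both factors are sums over `boundedLists n n`. Their product is thus a sum over
-- exactly the list that `B` filters, and the coefficient of q^n counts the pairs that pass.
bipartitions-gf : ∀ l m → B-series l m ≋ Regulars l ⊗ Regulars m
bipartitions-gf l m = pointwise λ n → ≈₇-sym (≈₇-trans
  (≈[]-trans (⊗-cong[] (total≈∑ (term-graded l) n) (total≈∑ (term-graded m) n))
    (≋⇒≈[] (≋-trans (≋-sym (∑-cartesianProduct (term l) (term m) (boundedLists n n) (boundedLists n n)))
      (∑-cong-≋ (cartesianProduct (boundedLists n n) (boundedLists n n)) λ (ps , qs) → ≋-trans
        (only-⊗ (isRegularPartition? l ps) (isRegularPartition? m qs) (weight ps) (weight qs)) (only-cong (isRegularPartition? l ps ×-dec isRegularPartition? m qs) (≋-sym (q^-+ (sum ps) (sum qs)))))))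
    at< ≤-refl)
  (≈₇-reflexive (count (isRegularBipartition? l m n) pair n (pair-at n) (cartesianProduct (boundedLists n n) (boundedLists n n)))))
  where
  pair : List ℕ × List ℕ → Series
  pair (ps , qs) = only (isRegularPartition? l ps ×-dec isRegularPartition? m qs) (q^ (sum ps + sum qs))
  ∑-cong-≋ : ∀ {t u : List ℕ × List ℕ → Series} is → (∀ i → t i ≋ u i) → ∑ t is ≋ ∑ u is
  ∑-cong-≋ is p = ≈[]⇒≋ λ N → ∑-cong[] is (≋⇒≈[] ∘ p)
  only-cong : ∀ {P : Set} (P? : Dec P) {S T} → S ≋ T → only P? S ≋ only P? T
  only-cong P? p with does P?
  ... | true  = p
  ... | false = ≋-refl
  pair-at : ∀ n pq → pair pq n ≡ (if does (isRegularBipartition? l m n pq) then 1ℤ else 0ℤ)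
  pair-at n (ps , qs) with does (isRegularPartition? l ps) | does (isRegularPartition? m qs)
  ... | true  | true  = q^-at (sum ps + sum qs) n
  ... | true  | false = 0ₛ-at n
  ... | false | _     = 0ₛ-at n

frobenius : f₁ ⁶ ⊗ f₁ ≋ euler 7 7
frobenius = begin
  f₁ ⁶ ⊗ f₁       ≈⟨ ≋-trans (⊗-cong (≋-trans (⊗-cong Π⁴ Π²) (Π-⊗ c⁴ c²)) ≋-refl) (Π-⊗ c⁶ c) ⟩
  Π (λ i → (u i) ⁶ ⊗ u i) ≈⟨ Π-cong (λ i → ≋-trans (seventh-power (1 + 1 * i)) (≡⇒≋ (cong (factor -1ℤ) (index i)))) ⟩
  euler 7 7       ∎
  where
  open ≋-Reasoning
  u : ℕ → Series
  u i = factor -1ℤ (1 + 1 * i)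
  c : Convergent u
  c = poch-conv -1ℤ 1 1
  c² : Convergent (λ i → (u i) ²)
  c² = convergent-⊗ c c
  c⁴ : Convergent (λ i → (u i) ⁴)
  c⁴ = convergent-⊗ c² c²
  c⁶ : Convergent (λ i → (u i) ⁶)
  c⁶ = convergent-⊗ c⁴ c²
  Π² : f₁ ² ≋ Π (λ i → (u i) ²)
  Π² = Π-⊗ c c
  Π⁴ : f₁ ⁴ ≋ Π (λ i → (u i) ⁴)
  Π⁴ = ≋-trans (²-cong Π²) (Π-⊗ c² c²)
  index : ∀ i → let k = 1 + 1 * i in k + k + (k + k) + (k + k) + k ≡ 7 + 7 * i
  index = solve-∀ℕ
  seven≋0 : const (+ 7) ≋ 0ₛ
  seven≋0 = pointwise λ { zero → differBy 1ℤ refl ; (suc n) → ≈₇-refl }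
  seventh-power : ∀ k → (factor -1ℤ k) ⁶ ⊗ factor -1ℤ k ≋ factor -1ℤ (k + k + (k + k) + (k + k) + k)
  seventh-power k = begin
    (factor -1ℤ k) ⁶ ⊗ factor -1ℤ k
      -- (1 - x)^7 = 1 - x^7 + 7 (-x + 3x² - 5x³ + 5x⁴ - 3x⁵ + x⁶): the binomials 7, 21, 35 divided
      -- by 7 are 1, 3, 5. The 3x² appears as x² + 2x².
      ≈⟨ solve 1 (λ x → let a = con 1ℤ :+ con -1ℤ :* x ; a² = a :* a ; x² = x :* x in
           a² :* a² :* a² :* a := con 1ℤ :+ con -1ℤ :* (x² :* x² :* x² :* x) :+ con (+ 7) :*
             (x² :- x :+ con (+ 2) :* x² :- con (+ 5) :* (x² :* x) :+ con (+ 5) :* (x² :* x²) :- con (+ 3) :* (x² :* x² :* x) :+ x² :* x² :* x²))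
           ≋-refl (q^ k) ⟩
    1ₛ ⊕ const -1ℤ ⊗ (X₇) ⊕ const (+ 7) ⊗ Z
      ≈⟨ ≋-trans (⊕-cong {1ₛ ⊕ const -1ℤ ⊗ X₇} ≋-refl (≋-trans (⊗-cong seven≋0 (≋-refl {Z})) (R.zeroˡ Z))) (R.+-identityʳ (1ₛ ⊕ const -1ℤ ⊗ X₇)) ⟩
    1ₛ ⊕ const -1ℤ ⊗ X₇
      ≈⟨ ⊕-cong {1ₛ} ≋-refl (⊗-cong {const -1ℤ} ≋-refl (≋-sym powers)) ⟩
    factor -1ℤ (k + k + (k + k) + (k + k) + k) ∎
    where
    x₁ X₇ Z : Series
    x₁ = q^ k
    X₇ = (x₁ ²) ⊗ (x₁ ²) ⊗ (x₁ ²) ⊗ x₁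
    Z = x₁ ² ⊕ ⊝ x₁ ⊕ const (+ 2) ⊗ x₁ ² ⊕ ⊝ (const (+ 5) ⊗ (x₁ ² ⊗ x₁)) ⊕ const (+ 5) ⊗ (x₁ ² ⊗ x₁ ²)
        ⊕ ⊝ (const (+ 3) ⊗ (x₁ ² ⊗ x₁ ² ⊗ x₁)) ⊕ x₁ ² ⊗ x₁ ² ⊗ x₁ ²
    q²ᵏ : q^ (k + k) ≋ x₁ ²
    q²ᵏ = q^-+ k k
    powers : q^ (k + k + (k + k) + (k + k) + k) ≋ X₇
    powers = ≋-trans (q^-+ (k + k + (k + k) + (k + k)) k) (⊗-cong (≋-trans (q^-+ (k + k + (k + k)) (k + k))
      (⊗-cong (≋-trans (q^-+ (k + k) (k + k)) (⊗-cong q²ᵏ q²ᵏ)) q²ᵏ)) (≋-refl {x₁}))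

-- Multiplying by f₁² turns the generating function into f₃ f₇, and f₇ ≡ f₁⁷ by `frobenius`.
B-series≋F : B-series 3 7 ≋ F
B-series≋F = ⊗-cancel (f₁ ²) (⊗-unit {f₁} {f₁} f₁-unit f₁-unit) (begin
  f₁ ² ⊗ B-series 3 7                         ≈⟨ ⊗-cong {f₁ ²} ≋-refl (bipartitions-gf 3 7) ⟩
  f₁ ² ⊗ (Regulars 3 ⊗ Regulars 7)            ≈⟨ solve 3 (λ f a b → f :* f :* (a :* b) := a :* f :* (b :* f)) ≋-refl f₁ (Regulars 3) (Regulars 7) ⟩
  Regulars 3 ⊗ f₁ ⊗ (Regulars 7 ⊗ f₁)         ≈⟨ ⊗-cong (≋-trans (regulars-f₁ 3) (divisible-product 2)) (≋-trans (regulars-f₁ 7) (divisible-product 6)) ⟩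
  f₃ ⊗ euler 7 7                              ≈⟨ ⊗-cong {f₃} ≋-refl (≋-sym frobenius) ⟩
  f₃ ⊗ (f₁ ⁶ ⊗ f₁)                            ≈⟨ solve 2 (λ a f → let f² = f :* f ; f⁴ = f² :* f² in a :* (f⁴ :* f² :* f) := f² :* (f⁴ :* f :* a)) ≋-refl f₃ f₁ ⟩
  f₁ ² ⊗ F                                    ∎)
  where
  open ≋-Reasoning
  f₁-unit : Unit f₁
  f₁-unit = poch-unit -1ℤ 0 1

-- `Regulars 3` equals f₃ / f₁, so this realises f₃³ / f₁ without constructing an inverse series.
C : Series
C = f₃ ⊗ f₃ ⊗ Regulars 3

C-product : C ⊗ (T ⊗ G) ≋ X ⊗ X ⊗ (Φ ⊗ Φ)
C-product = begin
  f₃ ⊗ f₃ ⊗ Regulars 3 ⊗ (T ⊗ G)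
    ≈⟨ solve 3 (λ f r a → f :* f :* r :* a := f :* (r :* (a :* f))) ≋-refl f₃ (Regulars 3) (T ⊗ G) ⟩
  f₃ ⊗ (Regulars 3 ⊗ (T ⊗ G ⊗ f₃))
    ≈⟨ ⊗-cong {f₃} ≋-refl (≋-trans (⊗-cong {Regulars 3} ≋-refl (≋-trans (⊗-cong {T ⊗ G} ≋-refl f₃-product) (≋-sym f₁-product)))
         (≋-trans (regulars-f₁ 3) (divisible-product 2))) ⟩
  f₃ ⊗ f₃
    ≈⟨ ⊗-cong f₃-product f₃-product ⟩
  X ⊗ Φ ⊗ (X ⊗ Φ)
    ≈⟨ solve 2 (λ X Φ → X :* Φ :* (X :* Φ) := X :* X :* (Φ :* Φ)) ≋-refl X Φ ⟩
  X ⊗ X ⊗ (Φ ⊗ Φ) ∎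
  where open ≋-Reasoning

-- Iterating N ↦ 4 N + 1.

open Recurrence C C-product

-- The characteristic polynomial z² + z + 16 is (z - 3)² modulo 7.
module DoubleRoot (x : ℕ → ℤ) (recurrence : ∀ j → x (2 + j) ≈₇ ℤ.- x (1 + j) ℤ.- + 16 ℤ.* x j) where

  private
    δ : ℤ
    -- Solves x 1 ≡ 3 (x 0 + δ), since 5 is the inverse of 3 modulo 7.
    δ = + 5 ℤ.* x 1 ℤ.- x 0

  closed-form : ∀ j → x j ≈₇ (+ 3) ℤ.^ j ℤ.* (x 0 ℤ.+ + j ℤ.* δ)
  closed-form zero = ≈₇-reflexive (lemma (x 1) (x 0))
    where
    lemma : ∀ y z → z ≡ 1ℤ ℤ.* (z ℤ.+ 0ℤ ℤ.* (+ 5 ℤ.* y ℤ.- z))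
    lemma = solve-∀ℤ
  closed-form (suc zero) = differBy (ℤ.- (+ 2 ℤ.* x 1)) (lemma (x 1) (x 0))
    where
    lemma : ∀ y z → y ≡ + 3 ℤ.* 1ℤ ℤ.* (z ℤ.+ 1ℤ ℤ.* (+ 5 ℤ.* y ℤ.- z)) ℤ.+ + 7 ℤ.* (ℤ.- (+ 2 ℤ.* y))
    lemma = solve-∀ℤ
  closed-form (suc (suc j)) = ≈₇-trans (recurrence j)
    (≈₇-trans (+-cong₇ (-‿cong₇ (closed-form (suc j))) (-‿cong₇ (*-cong₇ (≈₇-refl {+ 16}) (closed-form j))))
      (differBy (ℤ.- (p ℤ.* (+ 4 ℤ.* x 0 ℤ.+ (+ 4 ℤ.* + j ℤ.+ + 3) ℤ.* δ))) (lemma p (x 0) (+ j) δ)))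
    where
    p = (+ 3) ℤ.^ j
    lemma : ∀ p a j d →
      ℤ.- (+ 3 ℤ.* p ℤ.* (a ℤ.+ (1ℤ ℤ.+ j) ℤ.* d)) ℤ.- + 16 ℤ.* (p ℤ.* (a ℤ.+ j ℤ.* d)) ≡
      + 3 ℤ.* (+ 3 ℤ.* p) ℤ.* (a ℤ.+ (1ℤ ℤ.+ (1ℤ ℤ.+ j)) ℤ.* d) ℤ.+ + 7 ℤ.* (ℤ.- (p ℤ.* (+ 4 ℤ.* a ℤ.+ (+ 4 ℤ.* j ℤ.+ + 3) ℤ.* d)))
    lemma = solve-∀ℤ

  seven-steps : x 7 ≈₇ + 3 ℤ.* x 0
  seven-steps = ≈₇-trans (closed-form 7) (differBy (+ 312 ℤ.* x 0 ℤ.+ + 2187 ℤ.* δ) (lemma (x 0) δ))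
    where
    lemma : ∀ a d → + 2187 ℤ.* (a ℤ.+ + 7 ℤ.* d) ≡ + 3 ℤ.* a ℤ.+ + 7 ℤ.* (+ 312 ℤ.* a ℤ.+ + 2187 ℤ.* d)
    lemma = solve-∀ℤ

  -- If x 1 ≡ - x 0, then δ ≡ -6 x 0 ≡ x 0, so x 0 + 6 δ ≡ 7 x 0 ≡ 0.
  six-steps : x 1 ≈₇ ℤ.- x 0 → x 6 ≈₇ 0ℤ
  six-steps (differBy k eq) = ≈₇-trans (closed-form 6) (≈₇-trans
    (≈₇-reflexive (cong (λ y → + 729 ℤ.* (x 0 ℤ.+ + 6 ℤ.* (+ 5 ℤ.* y ℤ.- x 0))) eq))
    (differBy (+ 729 ℤ.* (+ 30 ℤ.* k ℤ.- + 5 ℤ.* x 0)) (lemma (x 0) k)))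
    where
    lemma : ∀ a k → + 729 ℤ.* (a ℤ.+ + 6 ℤ.* (+ 5 ℤ.* (ℤ.- a ℤ.+ + 7 ℤ.* k) ℤ.- a)) ≡
                    0ℤ ℤ.+ + 7 ℤ.* (+ 729 ℤ.* (+ 30 ℤ.* k ℤ.- + 5 ℤ.* a))
    lemma = solve-∀ℤ

-- iterate j n is the N with 3 N + 1 = 4 ^ j (3 n + 1).
iterate : ℕ → ℕ → ℕ
iterate zero    n = n
iterate (suc j) n = suc (4 * iterate j n)

F-iterates : ∀ n j → F (iterate (2 + j) n) ≈₇ ℤ.- F (iterate (1 + j) n) ℤ.- + 16 ℤ.* F (iterate j n)
F-iterates n j = F-recurrence₁ (iterate j n)

iterate-+ : ∀ i j n → iterate (i + j) n ≡ iterate i (iterate j n)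
iterate-+ zero    j n = refl
iterate-+ (suc i) j n = cong (λ k → suc (4 * k)) (iterate-+ i j n)

F-seven-steps : ∀ m j n → F (iterate (7 * m + j) n) ≈₇ + (3 ^ m) ℤ.* F (iterate j n)
F-seven-steps zero    j n = ≈₇-reflexive (sym (ℤ.*-identityˡ (F (iterate j n))))
F-seven-steps (suc m) j n = subst (λ i → F i ≈₇ + (3 ^ suc m) ℤ.* F (iterate j n))
  (trans (sym (iterate-+ 7 (7 * m + j) n)) (cong (λ i → iterate i n) (index m j)))
  (≈₇-trans (seven-steps (λ i → F (iterate i N)) (F-iterates N))
    (≈₇-trans (*-cong₇ (≈₇-refl {+ 3}) (F-seven-steps m j n)) (≈₇-reflexive
      (trans (sym (ℤ.*-assoc (+ 3) (+ (3 ^ m)) (F (iterate j n)))) (cong (ℤ._* F (iterate j n)) (sym (ℤ.pos-* 3 (3 ^ m))))))))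
  where
  open DoubleRoot using (seven-steps)
  N = iterate (7 * m + j) n
  index : ∀ m j → 7 + (7 * m + j) ≡ 7 * suc m + j
  index = solve-∀ℕ

F-vanishing : ∀ m n → F (iterate (7 * m + 6) (4 * n + 3)) ≈₇ 0ℤ
F-vanishing m n = ≈₇-trans (F-seven-steps m 6 (4 * n + 3))
  (≈₇-trans (*-cong₇ (≈₇-refl {+ (3 ^ m)}) (six-steps (λ i → F (iterate i (4 * n + 3))) (F-iterates (4 * n + 3)) (F-recurrence₂ n)))
    (≈₇-reflexive (ℤ.*-zeroʳ (+ (3 ^ m)))))
  where open DoubleRoot using (six-steps)

-- Explicit indices and the two congruences.

repunit : ℕ → ℕ
repunit zero    = 0
repunit (suc j) = suc (4 * repunit j)

4^j≡ : ∀ j → 4 ^ j ≡ suc (repunit j * 3)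
4^j≡ zero    = refl
4^j≡ (suc j) = trans (cong (4 *_) (4^j≡ j)) (lemma (repunit j))
  where
  lemma : ∀ r → 4 * suc (r * 3) ≡ suc (suc (4 * r) * 3)
  lemma = solve-∀ℕ

iterate≡ : ∀ j n → iterate j n ≡ 4 ^ j * n + repunit j
iterate≡ zero    n = sym (trans (+-identityʳ (1 * n)) (*-identityˡ n))
iterate≡ (suc j) n = trans (cong (λ k → suc (4 * k)) (iterate≡ j n)) (lemma (4 ^ j) n (repunit j))
  where
  lemma : ∀ p n r → suc (4 * (p * n + r)) ≡ 4 * p * n + suc (4 * r)
  lemma = solve-∀ℕ

first-index : ∀ j n → 4 ^ j * n + (4 ^ j ∸ 1) / 3 ≡ iterate j n
first-index j n = trans (cong (λ p → 4 ^ j * n + (p ∸ 1) / 3) (4^j≡ j))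
  (trans (cong (λ r → 4 ^ j * n + r) (m*n/n≡m (repunit j) 3)) (sym (iterate≡ j n)))

-- The 10 comes from 3 (4 n + 3) + 1 = 12 n + 10: multiplying by 4^i gives 3 · 4^(i+1) n + 10 · 4^i.
second-index : ∀ i n → 4 ^ suc i * n + (10 * 4 ^ i ∸ 1) / 3 ≡ iterate i (4 * n + 3)
second-index i n = trans (cong (λ p → 4 ^ suc i * n + (p ∸ 1) / 3) (trans (cong (10 *_) (4^j≡ i)) (ten (repunit i))))
  (trans (cong (λ r → 4 ^ suc i * n + r) (m*n/n≡m (10 * repunit i + 3) 3))
    (trans (cong (λ p → 4 * p * n + (10 * repunit i + 3)) (4^j≡ i)) (trans (lemma (repunit i) n)
      (trans (cong (λ p → p * (4 * n + 3) + repunit i) (sym (4^j≡ i))) (sym (iterate≡ i (4 * n + 3)))))))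
  where
  ten : ∀ r → 10 * suc (r * 3) ≡ suc ((10 * r + 3) * 3)
  ten = solve-∀ℕ
  lemma : ∀ r n → 4 * suc (r * 3) * n + (10 * r + 3) ≡ suc (r * 3) * (4 * n + 3) + r
  lemma = solve-∀ℕ

≈₇⇒mod : ∀ {a b} → + a ≈₇ + b → a ≡ b [mod 7 ]
≈₇⇒mod {a} {b} (differBy k eq) = divides ∣ k ∣ (trans (distance a b) (trans (cong ∣_∣ (trans (cong (ℤ._- + b) eq) (lemma (+ b) k)))
  (ℤ.abs-* k (+ 7))))
  where
  lemma : ∀ b k → b ℤ.+ + 7 ℤ.* k ℤ.- b ≡ k ℤ.* + 7
  lemma = solve-∀ℤ
  distance : ∀ a b → ∣ a - b ∣ ≡ ∣ + a ℤ.- + b ∣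
  distance a b = trans (∣a-b∣≡∣a⊖b∣ a b) (cong ∣_∣ (sym (ℤ.m-n≡m⊖n a b)))
    where
    ∣a-b∣≡∣a⊖b∣ : ∀ a b → ∣ a - b ∣ ≡ ∣ a ℤ.⊖ b ∣
    ∣a-b∣≡∣a⊖b∣ a b with ≤-total a b
    ... | inj₁ a≤b = trans (m≤n⇒∣m-n∣≡n∸m a≤b) (sym (ℤ.∣⊖∣-≤ a≤b))
    ... | inj₂ b≤a = trans (m≤n⇒∣n-m∣≡n∸m b≤a) (trans (sym (ℤ.∣⊖∣-≤ b≤a)) (ℤ.∣m⊖n∣≡∣n⊖m∣ b a))

theorem1p1 : ∀ (n m : ℕ) →
    (B 3 7 (4 ^ (7 * m) * n + (4 ^ (7 * m) ∸ 1) / 3) ≡ 3 ^ m * B 3 7 n [mod 7 ])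
    × (B 3 7 (4 ^ (7 * m + 7) * n + (10 * 4 ^ (7 * m + 6) ∸ 1) / 3) ≡ 0 [mod 7 ])
theorem1p1 n m = ≈₇⇒mod first , ≈₇⇒mod second
  where
  first : + B 3 7 (4 ^ (7 * m) * n + (4 ^ (7 * m) ∸ 1) / 3) ≈₇ + (3 ^ m * B 3 7 n)
  first = ≈₇-trans (≈₇-reflexive (cong (λ i → + B 3 7 i) (trans (first-index (7 * m) n) (cong (λ j → iterate j n) (sym (+-identityʳ (7 * m)))))))
    (≈₇-trans (B-series≋F at iterate (7 * m + 0) n) (≈₇-trans (F-seven-steps m 0 n)
      (≈₇-trans (*-cong₇ (≈₇-refl {+ (3 ^ m)}) (≈₇-sym (B-series≋F at n))) (≈₇-reflexive (sym (ℤ.pos-* (3 ^ m) (B 3 7 n)))))))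
  second : + B 3 7 (4 ^ (7 * m + 7) * n + (10 * 4 ^ (7 * m + 6) ∸ 1) / 3) ≈₇ + 0
  second = ≈₇-trans (≈₇-reflexive (cong (λ i → + B 3 7 i) (trans
      (cong (λ j → 4 ^ j * n + (10 * 4 ^ (7 * m + 6) ∸ 1) / 3) (+-suc (7 * m) 6)) (second-index (7 * m + 6) n))))
    (≈₇-trans (B-series≋F at iterate (7 * m + 6) (4 * n + 3)) (F-vanishing m n))
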